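{- Let $K$ be a finite unramified extension of $\mathbb{Q}_\ell$ with valuation ring $\mathcal{O}$, and let $\mathbf{F}=(F_1,\dots,F_n)$ be an $n$-dimensional commutative formal group law over $\mathcal{O}$. Let $V$ be the $\mathbb{F}_\ell$-vector space of $\ell$-torsion points of $\mathbf{F}(\overline{\mathfrak{m}})$. Assume $V$ satisfies Hypothesis (H): there exists a positive rational number $\alpha$ such that for every non-zero $(x_1,\dots,x_n)\in V$ one has $\min_{1\le i\le n} v(x_i)=\alpha$. Then every element of the wild inertia group $I_{\mathrm{wild}}\subset \mathrm{Gal}(\overline{K}/K)$ acts trivially on $V$; i.e. the image of $I_{\mathrm{wild}}$ under the Galois representation attached to $V$ is trivial.
   Context: $\overline{K}$ is an algebraic closure of $K$, $v$ the valuation on $\overline{K}$ normalized by $v(\ell)=1$ (so $v(K^*)=\mathbb{Z}$), and $\overline{\mathfrak{m}}=\{x\in\overline{K}: v(x)>0\}$. An $n$-dimensional formal group law over $\mathcal{O}$ is an $n$-tuple of power series $F_i(\mathbf{X},\mathbf{Y})\in\mathcal{O}[[X_1,\dots,X_n,Y_1,\dots,Y_n]]$ with $F_i\equiv X_i+Y_i$ modulo terms of degree $\ge 2$ and satisfying associativity $F_i(\mathbf{F}(\mathbf{X},\mathbf{Y}),\mathbf{Z})=F_i(\mathbf{X},\mathbf{F}(\mathbf{Y},\mathbf{Z}))$; commutative means $F_i(\mathbf{X},\mathbf{Y})=F_i(\mathbf{Y},\mathbf{X})$. $\mathbf{F}(\overline{\mathfrak{m}})$ denotes the set $\overline{\mathfrak{m}}^{\times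 n}$ with the group law $\mathbf{x}\oplus\mathbf{y}=(F_1(\mathbf{x},\mathbf{y}),\dots,F_n(\mathbf{x},\mathbf{y}))$, on which $\mathrm{Gal}(\overline{K}/K)$ acts coordinatewise. $I_{\mathrm{wild}}$ is the wild inertia subgroup of $\mathrm{Gal}(\overline{K}/K)$. -}

module Defs where

open import Level using (Level; Lift; _⊔_; suc)
open import Algebra.Bundles using (CommutativeRing; RawRing)
open import Algebra.Morphism.Structures using (module RingMorphisms)
import Algebra.Definitions.RawSemiring as RawSemiringDefs
open import Data.Bool.Base using (if_then_else_)
open import Data.Fin.Base using (Fin; toℕ; _↑ˡ_; _↑ʳ_)
open import Data.Integer.Base using (+_)
import Data.Maybe.Base as Maybe
open import Data.Nat.Base as ℕ using (ℕ; zero)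
open import Data.Nat.Divisibility using (_∣_)
import Data.Nat.Properties as ℕₚ
open import Data.Product using (Σ; _×_; _,_; proj₁; ∃; ∃!)
open import Data.Rational.Base as ℚ using (ℚ; 0ℚ; 1ℚ)
open import Data.Vec.Base as Vec using (Vec; []; _∷_)
open import Data.Vec.Functional as Vector using (Vector; _++_)
import Data.Vec.Properties as Vecₚ
open import Function.Bundles using (_⇔_)
open import Relation.Binary.Construct.Add.Supremum.NonStrict ℚ._≤_ using (_≤⁺_)
open import Relation.Binary.Construct.Add.Supremum.Strict ℚ._<_ using (_<⁺_)
open import Relation.Binary.PropositionalEquality using (_≡_)
open import Relation.Nullary using (¬_; does)
open import Relation.Nullary.Construct.Add.Supremum using (_⁺; ⊤⁺; [_])

-- The library's `HeytingField` admits the zero ring and carries an apartness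
-- relation; this is the usual definition.

record Field a b : Set (suc (a ⊔ b)) where
  field
    commutativeRing : CommutativeRing a b
  open CommutativeRing commutativeRing public
  open RawSemiringDefs (RawRing.rawSemiring rawRing) public using (_^_; sum)
  field
    0≉1     : ¬ (0# ≈ 1#)
    inverse : ∀ x → ¬ (x ≈ 0#) → ∃ λ y → x * y ≈ 1#

record Embedding {a b} (F G : Field a b) : Set (a ⊔ b) where
  private
    module F = Field F
    module G = Field G
  open RingMorphisms F.rawRing G.rawRing using (IsRingHomomorphism)
  field
    ⟦_⟧                : F.Carrier → G.Carrier
    isRingHomomorphism : IsRingHomomorphism ⟦_⟧

module _ {a b} {F G : Field a b} (ι : Embedding F G) where
  private
    module F = Field F
  open Field G
  open Embedding ι

  evalPoly : ∀ {d} → Vector F.Carrier d → Carrier → Carrier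
  evalPoly c x = sum (λ i → ⟦ c i ⟧ * x ^ toℕ i)

  IsFinite : Set (a ⊔ b)
  IsFinite = Σ ℕ λ d → Σ (Vector Carrier d) λ e →
    ∀ x → ∃ λ (c : Vector F.Carrier d) → x ≈ sum (λ i → ⟦ c i ⟧ * e i)

  IsAlgebraic : Set (a ⊔ b)
  IsAlgebraic = ∀ x → Σ ℕ λ d → ∃ λ (c : Vector F.Carrier d) →
    x ^ d + evalPoly c x ≈ 0#

  -- F(x), which is F[x] when x is algebraic over F.
  Adjoin : Carrier → Carrier → Set (a ⊔ b)
  Adjoin x y = Σ ℕ λ d → ∃ λ (c : Vector F.Carrier d) → y ≈ evalPoly c x

IsAlgebraicallyClosed : ∀ {a b} → Field a b → Set (a ⊔ b)
IsAlgebraicallyClosed F = ∀ d (c : Vector Carrier (ℕ.suc d)) →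
  ∃ λ x → x ^ ℕ.suc d + sum (λ i → c i * x ^ toℕ i) ≈ 0#
  where open Field F

record IsAlgebraicClosure {a b} {F G : Field a b} (ι : Embedding F G)
    : Set (a ⊔ b) where
  field
    isAlgebraic           : IsAlgebraic ι
    isAlgebraicallyClosed : IsAlgebraicallyClosed G

ℚ∞ : Set
ℚ∞ = ℚ ⁺

_+∞_ : ℚ∞ → ℚ∞ → ℚ∞
_+∞_ = Maybe.zipWith ℚ._+_

_⊓∞_ : ℚ∞ → ℚ∞ → ℚ∞
⊤⁺    ⊓∞ q     = q
[ p ] ⊓∞ ⊤⁺    = [ p ]
[ p ] ⊓∞ [ q ] = [ p ℚ.⊓ q ]

module _ {a b} (F : Field a b) (v : Field.Carrier F → ℚ∞) where
  open Field F

  record IsValuation : Set (a ⊔ b) where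
    field
      v-cong : ∀ {x y} → x ≈ y → v x ≡ v y
      v-∞    : ∀ x → v x ≡ ⊤⁺ ⇔ x ≈ 0#
      v-*    : ∀ x y → v (x * y) ≡ v x +∞ v y
      v-+    : ∀ x y → (v x ⊓∞ v y) ≤⁺ v (x + y)

  _⟶_ : (ℕ → Carrier) → Carrier → Set
  s ⟶ z = ∀ (q : ℚ) → Σ ℕ λ M → ∀ N → M ℕ.≤ N → [ q ] ≤⁺ v (s N - z)

  IsCauchy : (ℕ → Carrier) → Set
  IsCauchy s = ∀ (q : ℚ) → Σ ℕ λ M →
    ∀ m n → M ℕ.≤ m → M ℕ.≤ n → [ q ] ≤⁺ v (s m - s n)

  IsComplete : Set a
  IsComplete = ∀ s → IsCauchy s → ∃ λ z → s ⟶ z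

  -- (F , v) is (ℚ_ℓ , v_ℓ): the completion of ℚ for its ℓ-adic valuation,
  -- which is pinned down on ℚ by `v-ℓ` and `v-unit`.
  record IsCompletionOfℚ (ℓ : ℕ) : Set (a ⊔ b) where
    open RingMorphisms ℚ.+-*-rawRing rawRing using (IsRingHomomorphism)
    field
      isValuation        : IsValuation
      fromℚ              : ℚ → Carrier
      isRingHomomorphism : IsRingHomomorphism fromℚ
      v-ℓ                : v (fromℚ (+ ℓ ℚ./ 1)) ≡ [ 1ℚ ]
      v-unit             : ∀ m → ¬ (ℓ ∣ m) → v (fromℚ (+ m ℚ./ 1)) ≡ [ 0ℚ ]
      dense              : ∀ x (q : ℚ) → ∃ λ r → [ q ] ≤⁺ v (x - fromℚ r)
      complete           : IsComplete

-- For subgroups Γ ⊆ Δ of ℚ, the index of Γ in Δ is e: there are e elements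
-- of Δ meeting every coset of Γ exactly once.
HasIndex : ∀ {g d} → (ℚ → Set g) → (ℚ → Set d) → ℕ → Set (g ⊔ d)
HasIndex Γ Δ e = Σ (Vector ℚ e) λ r →
  (∀ i → Δ (r i)) × (∀ δ → Δ δ → ∃! _≡_ λ i → Γ (δ ℚ.- r i))

-- Formal power series in m variables: the monomial with exponent vector
-- ν : Vec ℕ m has coefficient f ν.

degree : ∀ {m} → Vec ℕ m → ℕ
degree = Vec.sum

module PowerSeries {a b} (R : RawRing a b) where
  open RawRing R
  open RawSemiringDefs rawSemiring using (sum)

  Series : ℕ → Set a
  Series m = Vec ℕ m → Carrier

  -- Sum over the exponents μ ≤ ν (componentwise).
  sumBelow : ∀ {m} → Vec ℕ m → (Vec ℕ m → Carrier) → Carrier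
  sumBelow []      f = f []
  sumBelow (k ∷ ν) f =
    sum {ℕ.suc k} λ i → sumBelow ν λ μ → f (toℕ i ∷ μ)

  -- Sum over the exponents of total degree ≤ d.
  sumDegree≤ : ∀ {m} → ℕ → (Vec ℕ m → Carrier) → Carrier
  sumDegree≤ {zero}    d f = f []
  sumDegree≤ {ℕ.suc m} d f =
    sum {ℕ.suc d} λ i → sumDegree≤ (d ℕ.∸ toℕ i) λ μ → f (toℕ i ∷ μ)

  var : ∀ {m} → Fin m → Series m
  var {m} i ν =
    if does (Vecₚ.≡-dec ℕₚ._≟_ ν (Vec.replicate m 0 Vec.[ i ]≔ 1)) then 1# else 0#

  rawRing : ℕ → RawRing a b
  rawRing m = record
    { Carrier = Series m
    ; _≈_     = λ f g → ∀ ν → f ν ≈ g ν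
    ; _+_     = λ f g ν → f ν + g ν
    ; _*_     = λ f g ν → sumBelow ν λ μ → f μ * g (Vec.zipWith ℕ._∸_ ν μ)
    ; -_      = λ f ν → - f ν
    ; 0#      = λ _ → 0#
    ; 1#      = λ ν → if does (Vecₚ.≡-dec ℕₚ._≟_ ν (Vec.replicate m 0)) then 1# else 0#
    }

monomial : ∀ {a b} (R : RawRing a b) → let open RawRing R in
  ∀ {m} → Vector Carrier m → Vec ℕ m → Carrier
monomial R x μ = product λ j → x j ^ Vec.lookup μ j
  where open RawSemiringDefs (RawRing.rawSemiring R) using (product; _^_)

module FormalGroup {a b} (R : RawRing a b) where
  open RawRing R using () renaming (Carrier to A; _≈_ to _≈ᴿ_; _+_ to _+ᴿ_; _*_ to _*ᴿ_)
  open PowerSeries R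

  -- f(g₁,…,gₘ) for g₁,…,gₘ without constant term: g^μ then has no terms of
  -- degree < degree μ, so only the μ with degree μ ≤ degree ν contribute to
  -- the coefficient at ν.
  subst : ∀ {m k} → Series m → Vector (Series k) m → Series k
  subst {k = k} f g ν =
    sumDegree≤ (degree ν) λ μ → f μ *ᴿ monomial (rawRing k) g μ ν

  module Variables (n : ℕ) where
    X Y : Vector (Series (n ℕ.+ n)) n
    X j = var (j ↑ˡ n)
    Y j = var (n ↑ʳ j)

    X₃ Y₃ Z₃ : Vector (Series (n ℕ.+ (n ℕ.+ n))) n
    X₃ j = var (j ↑ˡ (n ℕ.+ n))
    Y₃ j = var (n ↑ʳ (j ↑ˡ n))
    Z₃ j = var (n ↑ʳ (n ↑ʳ j))

  record IsCommutativeFormalGroupLaw (n : ℕ) (F : Vector (Series (n ℕ.+ n)) n)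
      : Set (a ⊔ b) where
    open Variables n
    field
      linear : ∀ i ν → degree ν ℕ.< 2 → F i ν ≈ᴿ (X i ν +ᴿ Y i ν)
      assoc  : ∀ i ν →
        subst (F i) ((λ j → subst (F j) (X₃ ++ Y₃)) ++ Z₃) ν ≈ᴿ
        subst (F i) (X₃ ++ (λ j → subst (F j) (Y₃ ++ Z₃))) ν
      comm   : ∀ i ν → subst (F i) (X ++ Y) ν ≈ᴿ subst (F i) (Y ++ X) ν

record UnramifiedExtension (ℓ : ℕ) (a b : Level) : Set (suc (a ⊔ b)) where
  field
    ℚₗ K K̄           : Field a b
    ℚₗ→K             : Embedding ℚₗ K
    K→K̄              : Embedding K K̄
    isAlgebraicClosure : IsAlgebraicClosure K→K̄
    v                : Field.Carrier K̄ → ℚ∞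
    isValuation      : IsValuation K̄ v

  module ℚₗ = Field ℚₗ
  module K  = Field K
  module K̄  = Field K̄

  ι : K.Carrier → K̄.Carrier
  ι = Embedding.⟦_⟧ K→K̄

  vK : K.Carrier → ℚ∞
  vK x = v (ι x)

  vℚₗ : ℚₗ.Carrier → ℚ∞
  vℚₗ x = vK (Embedding.⟦_⟧ ℚₗ→K x)

  -- Value groups v(ℚ_ℓ*) and v(K*): v x ≡ [ q ] forces x to be non-zero.
  Γ-ℚₗ : ℚ → Set a
  Γ-ℚₗ q = ∃ λ x → vℚₗ x ≡ [ q ]

  Γ-K : ℚ → Set a
  Γ-K q = ∃ λ x → vK x ≡ [ q ]

  -- Residue fields of finite extensions of ℚ_ℓ are perfect, so being
  -- unramified (or tame, below) only restricts the ramification index.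
  field
    isCompletionOfℚ : IsCompletionOfℚ ℚₗ vℚₗ ℓ
    finite          : IsFinite ℚₗ→K
    unramified      : HasIndex Γ-ℚₗ Γ-K 1

module Theory {ℓ : ℕ} {a b : Level} (E : UnramifiedExtension ℓ a b) where
  open UnramifiedExtension E
  open K̄ using (_≈_; _-_; 0#) renaming (Carrier to C; _*_ to _*ᶜ_)
  open RingMorphisms K̄.rawRing K̄.rawRing using (IsRingIsomorphism)

  record Gal : Set (a ⊔ b) where
    field
      act               : C → C
      isRingIsomorphism : IsRingIsomorphism act
      fixes-K           : ∀ x → act (ι x) ≈ ι x

  -- Trivial action on the residue field of K̄.
  Inertia : Gal → Set a
  Inertia σ = ∀ x → [ 0ℚ ] ≤⁺ v x → [ 0ℚ ] <⁺ v (Gal.act σ x - x)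

  Γ-K⟨_⟩ : C → ℚ → Set (a ⊔ b)
  Γ-K⟨ x ⟩ q = ∃ λ y → Adjoin K→K̄ x y × v y ≡ [ q ]

  IsTame : C → Set (a ⊔ b)
  IsTame x = Σ ℕ λ e → HasIndex Γ-K Γ-K⟨ x ⟩ e × ¬ (ℓ ∣ e)

  -- The subgroup of inertia fixing the maximal tamely ramified extension of K,
  -- whose elements are the x with K(x) / K tamely ramified.
  WildInertia : Gal → Set (a ⊔ b)
  WildInertia σ = Inertia σ × (∀ x → IsTame x → Gal.act σ x ≈ x)

  open PowerSeries K.rawRing using (Series)
  open PowerSeries K̄.rawRing using (sumDegree≤)
  open FormalGroup K.rawRing using (IsCommutativeFormalGroupLaw)

  -- Series over 𝒪 are series over K all of whose coefficients lie in 𝒪.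
  record CommutativeFormalGroupLaw𝒪 (n : ℕ) : Set (a ⊔ b) where
    field
      F        : Vector (Series (n ℕ.+ n)) n
      integral : ∀ i ν → [ 0ℚ ] ≤⁺ vK (F i ν)
      isCommutativeFormalGroupLaw : IsCommutativeFormalGroupLaw n F

  Point : ℕ → Set a
  Point n = Σ (Vector C n) λ x → ∀ i → [ 0ℚ ] <⁺ v (x i)

  partialSum : ∀ {m} → Series m → Vector C m → ℕ → C
  partialSum f x N = sumDegree≤ N λ μ → ι (f μ) *ᶜ monomial K̄.rawRing x μ

  IsZero : ∀ {n} → Vector C n → Set b
  IsZero x = ∀ i → x i ≈ 0#

  minVal : ∀ {n} → Vector C n → ℚ∞
  minVal x = Vector.foldr _⊓∞_ ⊤⁺ (λ i → v (x i))

  module GroupOfPoints {n : ℕ} (𝓕 : CommutativeFormalGroupLaw𝒪 n) where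
    open CommutativeFormalGroupLaw𝒪 𝓕 using (F)

    -- x ⊕ y = z. The group law is given by its graph: z i is the v-adic limit
    -- of the partial sums of F i at (x , y).
    _⊕_↦_ : Point n → Point n → Point n → Set
    (x , _) ⊕ (y , _) ↦ (z , _) = ∀ i → _⟶_ K̄ v (partialSum (F i) (x ++ y)) (z i)

    -- y = x ⊕ ⋯ ⊕ x (k terms).
    IsMultiple : ℕ → Point n → Point n → Set (a ⊔ b)
    IsMultiple zero      x y = Lift (a ⊔ b) (IsZero (proj₁ y))
    IsMultiple (ℕ.suc k) x y = ∃ λ w → IsMultiple k x w × (x ⊕ w ↦ y)

    IsTorsion : Point n → Set (a ⊔ b)
    IsTorsion x = ∃ λ o → IsMultiple ℓ x o × IsZero (proj₁ o)

    HypothesisH : Set (a ⊔ b)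
    HypothesisH = Σ ℚ λ α → 0ℚ ℚ.< α ×
      (∀ x → IsTorsion x → ¬ IsZero (proj₁ x) → minVal (proj₁ x) ≡ [ α ])

{-# OPTIONS --safe #-}
module Submission where

-- For wild σ one has v(σx − x) > v(x) for all x ≠ 0 in K̄: if v(x) has denominator ℓʳe with ℓ ∤ e, then
-- x^(ℓʳ) is a unit times an element of K(t), tᵉ = ℓ, which σ fixes because K(t)/K is tame; hence
-- (σx/x)^(ℓʳ) ≡ 1 in the residue field, and σx/x ≡ 1 since Frobenius is injective.
-- Let x be torsion with σx ≠ x and let β > α be the least valuation of the coordinates of σx − x.  Then
-- z = σx ⊕ [ℓ−1]x is torsion, and since F(X,Y) = X + Y + (degree ≥ 2) it agrees with σx − x up to
-- valuation > β; so z is a non-zero torsion point of minimal valuation β ≠ α.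
-- Associativity passes from series to points by substituting t·x for the variables, which turns
-- multivariate series into series in t and truncation into a congruence.  The sums x ⊕ y exist in the
-- incomplete field K̄ because all partial sums lie in one ℚ_ℓ-subspace W of finite dimension; W is complete
-- as its integral elements are, modulo ℓ, combinations of finitely many elements with digits 0, …, ℓ−1.
-- The generators of W are found only up to double negation, which is harmless as equality in K̄ is decidable.

open import Defs
open import Data.Nat using (ℕ)
open import Data.Nat.Primality using (Prime)
open import Data.Product using (proj₁)

open import Level using (Level; _⊔_; Lift; lift)
open import Algebra.Bundles using (CommutativeRing; RawRing)
open import Algebra.Morphism.Structures using (module RingMorphisms)
import Algebra.Definitions.RawSemiring as RawSemiringDefs
import Algebra.Properties.CommutativeMonoid.Mult as CommutativeMonoidMult
import Algebra.Properties.CommutativeSemigroup as CommutativeSemigroupProperties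
import Algebra.Properties.CommutativeSemiring.Binomial as Binomial
import Algebra.Properties.CommutativeSemiring.Exp as CommutativeExp
import Algebra.Properties.Monoid.Mult as MonoidMult
import Algebra.Properties.Monoid.Sum as MonoidSum
import Algebra.Properties.Ring as RingProperties
import Algebra.Properties.Semiring.Exp as Exp
import Algebra.Properties.Semiring.Mult as SemiringMult
import Algebra.Solver.Ring as RingSolver
open import Algebra.Solver.Ring.AlmostCommutativeRing
  using (fromCommutativeRing; _-Raw-AlmostCommutative⟶_)
open import Data.Bool.Base using (if_then_else_)
open import Data.Empty using (⊥-elim)
open import Data.Fin.Base as Fin using (Fin; toℕ; splitAt; _↑ˡ_; _↑ʳ_)
import Data.Fin.Properties as Finₚ
open import Data.Integer.Base as ℤ using (+_; -[1+_])
import Data.Integer.Properties as ℤₚ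
open import Data.List.Base as List using (List; []; _∷_)
open import Data.Maybe.Base using (Maybe; just; nothing)
open import Data.Nat.Base as ℕ using (zero; suc; NonZero; _!)
open import Data.Nat.Combinatorics using (nCn≡1; nCk≡n!/k![n-k]!; k![n∸k]!∣n!)
  renaming (_C_ to infixl 7 _choose_)
open import Data.Nat.Coprimality using (Coprime; coprime-Bézout)
open import Data.Nat.Divisibility using (_∣_; _∣?_; divides; ∣⇒≤; m∣m*n)
open import Data.Nat.DivMod using (_%_; _/_; m≡m%n+[m/n]*n; m%n<n; m/n*n≡m)
open import Data.Nat.GCD using (module Bézout)
open import Data.Nat.Induction using (<-rec)
open import Data.Nat.Primality
  using (euclidsLemma; prime⇒irreducible; prime⇒nonTrivial; prime⇒nonZero)
import Data.Nat.Properties as ℕₚ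
open import Data.Product using (Σ; ∃; ∃!; _×_; _,_; proj₂)
open import Data.Rational.Base as ℚ using (ℚ; 0ℚ; 1ℚ; mkℚ; toℚᵘ)
import Data.Rational.Properties as ℚₚ
open import Data.Rational.Unnormalised.Base as ℚᵘ using (mkℚᵘ; *≡*)
import Data.Rational.Unnormalised.Properties as ℚᵘₚ
open import Data.Sum.Base as Sum using (_⊎_; inj₁; inj₂; [_,_]′)
open import Data.Unit.Base using (⊤; tt)
open import Data.Vec.Base as Vec using (Vec; []; _∷_)
open import Data.Vec.Functional as Vector using (Vector; _++_)
open import Data.Vec.Functional.Properties using (lookup-++ˡ; lookup-++ʳ)
import Data.Vec.Properties as Vecₚ
open import Function.Base using (_∘_)
open import Function.Bundles using (Equivalence)
open import Relation.Binary.Construct.Add.Supremum.NonStrict ℚ._≤_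
  using (_≤⁺_; [_]; _≤⊤⁺; ≤⁺-trans; ≤⁺-dec; [≤]-injective)
open import Relation.Binary.Construct.Add.Supremum.Strict ℚ._<_
  using (_<⁺_; [_]; [_]<⊤⁺)
open import Relation.Binary.Definitions using (Tri; tri<; tri≈; tri>)
open import Relation.Binary.PropositionalEquality as ≡ using (_≡_; _≢_; refl; cong; subst)
import Relation.Binary.Reasoning.Setoid as SetoidReasoning
open import Relation.Nullary using (¬_; Dec; yes; no; contradiction; does)
open import Relation.Nullary.Construct.Add.Supremum using (⊤⁺; [_])
open import Relation.Nullary.Decidable using (decidable-stable)

-- The point [ℓ-1]x is the inverse of x, since x ⊕ [ℓ-1]x = [ℓ]x = 0. So z is compared with x ⊕
-- [ℓ-1]x, which vanishes: the two sums differ only in their first argument, and replacing σx by x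
-- changes the terms of degree at least 2 by more than β, because σx, x and [ℓ-1]x have coordinates
-- of positive valuation. The group law on points is a relation, so a sum is available only once a
-- limit has been produced. The commutative and associative laws carry convergence from one side of
-- a series identity to the other, without further existence assumptions. Existence serves for
-- auxiliary points, such as z itself or the intermediate sum in the medial law (p ⊕ q) ⊕ (r ⊕ s) =
-- (p ⊕ r) ⊕ (q ⊕ s), which makes multiples additive and z torsion. The double negations come from
-- one alternative: when an element e is adjoined to a subspace, either e has positive distance from
-- it, and one generator is added, or e is a limit of its elements, and none is.

-- Commutative ring identities.

-- The coefficients of the solver are formal differences of natural numbers.
module IntegerSolver {c ℓ} (R : CommutativeRing c ℓ) where
  open CommutativeRing R renaming (refl to ≈-refl)
  open SemiringMult semiring renaming (_×_ to _×#_)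
  open RingProperties ring
  open CommutativeSemigroupProperties +-commutativeSemigroup using (interchange)
  open SetoidReasoning setoid

  private
    -- Cancelling the common part makes equal coefficients syntactically equal, so that both normal
    -- forms coincide and `≈-refl` closes a call of the solver.
    norm : ℕ × ℕ → ℕ × ℕ
    norm (a , b) = a ℕ.∸ b , b ℕ.∸ a

    Coeff : RawRing _ _
    Coeff = record
      { Carrier = ℕ × ℕ
      ; _≈_ = _≡_
      ; _+_ = λ (a , b) (c , d) → norm (a ℕ.+ c , b ℕ.+ d)
      ; _*_ = λ (a , b) (c , d) → norm (a ℕ.* c ℕ.+ b ℕ.* d , a ℕ.* d ℕ.+ b ℕ.* c)
      ; -_ = λ (a , b) → b , a
      ; 0# = 0 , 0
      ; 1# = 1 , 0
      }
    module Coeff = RawRing Coeff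

    diff : ℕ × ℕ → Carrier
    diff (a , b) = a ×# 1# - b ×# 1#

    -- The first two clauses let `:0` and `:1` evaluate to `0#` and `1#` on the nose, as they occur
    -- in goals.
    ⟦_⟧ : ℕ × ℕ → Carrier
    ⟦ 0 , 0 ⟧ = 0#
    ⟦ 1 , 0 ⟧ = 1#
    ⟦ p ⟧ = diff p

    ⟦⟧-diff : ∀ p → ⟦ p ⟧ ≈ diff p
    ⟦⟧-diff (0 , 0) = sym (-‿inverseʳ 0#)
    ⟦⟧-diff (1 , 0) = begin
      1# ≈⟨ +-identityʳ 1# ⟨
      1# + 0# ≈⟨ +-congˡ (-‿inverseʳ 0#) ⟨
      1# + (0# - 0#) ≈⟨ +-assoc _ _ _ ⟨
      1# + 0# - 0# ∎
    ⟦⟧-diff (0 , suc b) = ≈-refl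
    ⟦⟧-diff (1 , suc b) = ≈-refl
    ⟦⟧-diff (suc (suc a) , b) = ≈-refl

    sub-cong : ∀ a b c d → a ℕ.+ d ≡ c ℕ.+ b → diff (a , b) ≈ diff (c , d)
    sub-cong a b c d eq = begin
      A - B ≈⟨ +-congʳ (+-identityʳ A) ⟨
      A + 0# - B ≈⟨ +-congʳ (+-congˡ (-‿inverseʳ D)) ⟨
      A + (D - D) - B ≈⟨ +-congʳ (+-assoc _ _ _) ⟨
      A + D - D - B ≈⟨ +-congʳ (+-congʳ (×-homo-+ 1# a d)) ⟨
      (a ℕ.+ d) ×# 1# - D - B ≈⟨ +-congʳ (+-congʳ (reflexive (cong (_×# 1#) eq))) ⟩
      (c ℕ.+ b) ×# 1# - D - B ≈⟨ +-congʳ (+-congʳ (×-homo-+ 1# c b)) ⟩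
      C + B - D - B ≈⟨ +-congʳ (+-congʳ (+-comm C B)) ⟩
      B + C - D - B ≈⟨ +-congʳ (+-assoc _ _ _) ⟩
      B + (C - D) - B ≈⟨ xyx⁻¹≈y B (C - D) ⟩
      C - D ∎
      where
      A = a ×# 1#
      B = b ×# 1#
      C = c ×# 1#
      D = d ×# 1#

    diff-norm : ∀ p → diff (norm p) ≈ diff p
    diff-norm (a , b) = sub-cong (a ℕ.∸ b) (b ℕ.∸ a) a b (go (ℕₚ.≤-total a b))
      where
      go : a ℕ.≤ b ⊎ b ℕ.≤ a → a ℕ.∸ b ℕ.+ b ≡ a ℕ.+ (b ℕ.∸ a)
      go (inj₁ a≤b) = ≡.trans (cong (ℕ._+ b) (ℕₚ.m≤n⇒m∸n≡0 a≤b)) (≡.sym (ℕₚ.m+[n∸m]≡n a≤b))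
      go (inj₂ b≤a) = ≡.trans (ℕₚ.m∸n+n≡m b≤a)
        (≡.sym (≡.trans (cong (a ℕ.+_) (ℕₚ.m≤n⇒m∸n≡0 b≤a)) (ℕₚ.+-identityʳ a)))

    sub-+ : ∀ x y z w → (x + z) - (y + w) ≈ (x - y) + (z - w)
    sub-+ x y z w = trans (+-congˡ (sym (-‿+-comm y w))) (interchange x z (- y) (- w))

    diff-+ : ∀ p q → diff (p Coeff.+ q) ≈ diff p + diff q
    diff-+ (a , b) (c , d) = trans (diff-norm (a ℕ.+ c , b ℕ.+ d)) (trans
      (+-cong (×-homo-+ 1# a c) (-‿cong (×-homo-+ 1# b d))) (sub-+ _ _ _ _))

    diff-* : ∀ p q → diff (p Coeff.* q) ≈ diff p * diff q
    diff-* (a , b) (c , d) = begin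
      diff (norm (a ℕ.* c ℕ.+ b ℕ.* d , a ℕ.* d ℕ.+ b ℕ.* c)) ≈⟨ diff-norm (a ℕ.* c ℕ.+ b ℕ.* d , a ℕ.* d ℕ.+ b ℕ.* c) ⟩
      diff (a ℕ.* c ℕ.+ b ℕ.* d , a ℕ.* d ℕ.+ b ℕ.* c)
        ≈⟨ +-cong (trans (×-homo-+ 1# (a ℕ.* c) _) (+-cong (×1-homo-* a c) (×1-homo-* b d)))
                  (-‿cong (trans (×-homo-+ 1# (a ℕ.* d) _) (+-cong (×1-homo-* a d) (×1-homo-* b c)))) ⟩
      (A * C + B * D) - (A * D + B * C) ≈⟨ sub-+ _ _ _ _ ⟩
      (A * C - A * D) + (B * D - B * C)
        ≈⟨ +-cong (sym (x[y-z]≈xy-xz A C D)) (begin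
             B * D - B * C ≈⟨ x[y-z]≈xy-xz B D C ⟨
             B * (D - C) ≈⟨ *-congˡ (⁻¹-anti-homo‿- C D) ⟨
             B * - (C - D) ≈⟨ -‿distribʳ-* B (C - D) ⟨
             - (B * (C - D)) ≈⟨ -‿distribˡ-* B (C - D) ⟩
             - B * (C - D) ∎) ⟩
      A * (C - D) + - B * (C - D) ≈⟨ distribʳ _ _ _ ⟨
      (A - B) * (C - D) ∎
      where
      A = a ×# 1#
      B = b ×# 1#
      C = c ×# 1#
      D = d ×# 1#

    morphism : Coeff -Raw-AlmostCommutative⟶ fromCommutativeRing R
    morphism = record
      { ⟦_⟧ = ⟦_⟧
      ; +-homo = λ p q → trans (⟦⟧-diff (p Coeff.+ q))
          (trans (diff-+ p q) (+-cong (sym (⟦⟧-diff p)) (sym (⟦⟧-diff q))))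
      ; *-homo = λ p q → trans (⟦⟧-diff (p Coeff.* q))
          (trans (diff-* p q) (*-cong (sym (⟦⟧-diff p)) (sym (⟦⟧-diff q))))
      ; -‿homo = λ p@(a , b) → trans (⟦⟧-diff (b , a))
          (trans (sym (⁻¹-anti-homo‿- _ _)) (-‿cong (sym (⟦⟧-diff p))))
      ; 0-homo = ≈-refl
      ; 1-homo = ≈-refl
      }

    _≟_ : ∀ p q → Maybe (⟦ p ⟧ ≈ ⟦ q ⟧)
    p@(a , b) ≟ q@(c , d) with a ℕ.+ d ℕₚ.≟ c ℕ.+ b
    ... | yes eq = just (trans (⟦⟧-diff p) (trans (sub-cong a b c d eq) (sym (⟦⟧-diff q))))
    ... | no _ = nothing

  open RingSolver Coeff (fromCommutativeRing R) morphism _≟_ public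
    using (solve; _:=_; _:+_; _:*_; _:-_; :-_; con; Polynomial)

  :0 :1 : ∀ {n} → Polynomial n
  :0 = con (0 , 0)
  :1 = con (1 , 0)

-- Solved over an abstract ring, since the solver would normalise the arithmetic of ℚ.
module RingIdentities {c ℓ} (R : CommutativeRing c ℓ) where
  open CommutativeRing R renaming (refl to ≈-refl)
  open IntegerSolver R

  x+r-r≈x : ∀ x r → x + r + - r ≈ x
  x+r-r≈x = solve 2 (λ x r → x :+ r :+ :- r := x) ≈-refl

  x-y+y≈x : ∀ x y → x - y + y ≈ x
  x-y+y≈x = solve 2 (λ x y → x :- y :+ y := x) ≈-refl

  x-y+[n+[y+m]]≈x+n+m : ∀ x y n m → x - y + (n + (y + m)) ≈ x + n + m
  x-y+[n+[y+m]]≈x+n+m = solve 4 (λ p q n n′ → p :- q :+ (n :+ (q :+ n′)) := (p :+ n) :+ n′) ≈-refl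

  -[0-x]≈x : ∀ x → - (0# - x) ≈ x
  -[0-x]≈x = solve 1 (λ x → :- (:0 :- x) := x) ≈-refl

  -[x-y]≈y-x : ∀ x y → - (x - y) ≈ y - x
  -[x-y]≈y-x = solve 2 (λ x y → :- (x :- y) := y :- x) ≈-refl

  [d-i]-[d-k]≈k-i : ∀ d i k → d - i - (d - k) ≈ k - i
  [d-i]-[d-k]≈k-i = solve 3 (λ d i k → d :- i :- (d :- k) := k :- i) ≈-refl

  x+y≈z+w⇒w-y≈x-z : ∀ {x y z w} → x + y ≈ z + w → w - y ≈ x - z
  x+y≈z+w⇒w-y≈x-z {x} {y} {z} {w} eq = trans
    (solve 3 (λ y z w → w :- y := (z :+ w) :- z :- y) ≈-refl y z w) (trans (+-congʳ (+-congʳ (sym eq)))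
    (solve 3 (λ x y z → (x :+ y) :- z :- y := x :- z) ≈-refl x y z))

  x--y≈x+y : ∀ x y → x - - y ≈ x + y
  x--y≈x+y = solve 2 (λ p q → p :- :- q := p :+ q) ≈-refl

-- Multiples, the Archimedean property and integers in ℚ.

module RationalFacts where
  open MonoidMult ℚₚ.+-0-monoid public
    renaming (_×_ to infixr 8 _•_; ×-homo-+ to •-homo-+; ×-assocˡ to •-assoc; ×-homo-1 to •-homo-1)
    using ()
  open CommutativeMonoidMult ℚₚ.+-0-commutativeMonoid public
    using () renaming (×-distrib-+ to •-distrib-+)
  open CommutativeRing ℚₚ.+-*-commutativeRing using (semiring)
  open RingIdentities ℚₚ.+-*-commutativeRing public
  open SemiringMult semiring using (×-assoc-*)
  module ℚ-Ring = RingProperties ℚₚ.+-*-ring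

  •1≡ : ∀ n → n • 1ℚ ≡ + n ℚ./ 1
  •1≡ zero = refl
  •1≡ (suc n) = ≡.trans (cong (1ℚ ℚ.+_) (•1≡ n)) (ℚₚ.toℚᵘ-injective (begin
    toℚᵘ (1ℚ ℚ.+ (+ n ℚ./ 1)) ≈⟨ ℚₚ.toℚᵘ-homo-+ 1ℚ (+ n ℚ./ 1) ⟩
    toℚᵘ 1ℚ ℚᵘ.+ toℚᵘ (+ n ℚ./ 1)
      ≈⟨ ℚᵘₚ.+-congʳ (toℚᵘ 1ℚ) (ℚₚ.toℚᵘ-fromℚᵘ (mkℚᵘ (+ n) 0)) ⟩
    toℚᵘ 1ℚ ℚᵘ.+ mkℚᵘ (+ n) 0
      ≈⟨ *≡* (cong (ℤ._* + 1) (cong (λ i → (+ 1) ℤ.+ i) (ℤₚ.*-identityʳ (+ n)))) ⟩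
    mkℚᵘ (+ suc n) 0 ≈⟨ ℚₚ.toℚᵘ-fromℚᵘ (mkℚᵘ (+ suc n) 0) ⟨
    toℚᵘ (+ suc n ℚ./ 1) ∎))
    where open SetoidReasoning ℚᵘₚ.≃-setoid

  -- The integer (k + 1) q appears as m - n with natural m and n, so that it can be realised by
  -- powers of an element and of its inverse without a case distinction on the sign.
  clear-denominator : ∀ q → Σ ℕ λ k → Σ ℕ λ m → Σ ℕ λ n → suc k • q ℚ.+ n • 1ℚ ≡ m • 1ℚ
  clear-denominator q@(mkℚ p k _) = k , result p refl
    where
    scaled : suc k • q ≡ p ℚ./ 1
    scaled = ≡.trans (≡.trans (cong (suc k •_) (≡.sym (ℚₚ.*-identityˡ q)))
      (≡.sym (×-assoc-* (suc k) 1ℚ q))) (≡.trans (cong (ℚ._* q) (•1≡ (suc k)))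
      (ℚₚ.toℚᵘ-injective (begin
        toℚᵘ ((+ suc k ℚ./ 1) ℚ.* q) ≈⟨ ℚₚ.toℚᵘ-homo-* (+ suc k ℚ./ 1) q ⟩
        toℚᵘ (+ suc k ℚ./ 1) ℚᵘ.* toℚᵘ q
          ≈⟨ ℚᵘₚ.*-congʳ {toℚᵘ q} (ℚₚ.toℚᵘ-fromℚᵘ (mkℚᵘ (+ suc k) 0)) ⟩
        mkℚᵘ (+ suc k) 0 ℚᵘ.* toℚᵘ q
          ≈⟨ *≡* (≡.trans (ℤₚ.*-identityʳ _) (≡.trans (ℤₚ.*-comm (+ suc k) p)
               (cong (λ n → p ℤ.* + suc n) (≡.sym (ℕₚ.+-identityʳ k))))) ⟩
        mkℚᵘ p 0 ≈⟨ ℚₚ.toℚᵘ-fromℚᵘ (mkℚᵘ p 0) ⟨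
        toℚᵘ (p ℚ./ 1) ∎)))
      where open SetoidReasoning ℚᵘₚ.≃-setoid
    result : ∀ p′ → p′ ≡ p → Σ ℕ λ m → Σ ℕ λ n → suc k • q ℚ.+ n • 1ℚ ≡ m • 1ℚ
    result (+ m) eq = m , 0 , ≡.trans (ℚₚ.+-identityʳ _)
      (≡.trans scaled (≡.trans (cong (ℚ._/ 1) (≡.sym eq)) (≡.sym (•1≡ m))))
    result -[1+ n ] eq = 0 , suc n , ≡.trans
      (≡.cong₂ ℚ._+_ (≡.trans scaled (cong (ℚ._/ 1) (≡.sym eq))) (•1≡ (suc n)))
      (ℚₚ.+-inverseˡ (+ suc n ℚ./ 1))

  0≤1 : 0ℚ ℚ.≤ 1ℚ
  0≤1 = ℚₚ.nonNegative⁻¹ 1ℚ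

  0<1 : 0ℚ ℚ.< 1ℚ
  0<1 = ℚₚ.positive⁻¹ 1ℚ

  •-nonneg : ∀ {q} n → 0ℚ ℚ.≤ q → 0ℚ ℚ.≤ n • q
  •-nonneg zero 0≤q = ℚₚ.≤-refl
  •-nonneg (suc n) 0≤q = ℚₚ.+-mono-≤ 0≤q (•-nonneg n 0≤q)

  •-monoˡ : ∀ {q m n} → 0ℚ ℚ.≤ q → m ℕ.≤ n → m • q ℚ.≤ n • q
  •-monoˡ {n = n} 0≤q ℕ.z≤n = •-nonneg n 0≤q
  •-monoˡ {q} 0≤q (ℕ.s≤s m≤n) = ℚₚ.+-monoʳ-≤ q (•-monoˡ 0≤q m≤n)

  •-monoʳ : ∀ {p q} n → p ℚ.≤ q → n • p ℚ.≤ n • q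
  •-monoʳ zero p≤q = ℚₚ.≤-refl
  •-monoʳ (suc n) p≤q = ℚₚ.+-mono-≤ p≤q (•-monoʳ n p≤q)

  •-monoʳ-< : ∀ {p q} n → p ℚ.< q → suc n • p ℚ.< suc n • q
  •-monoʳ-< n p<q = ℚₚ.+-mono-<-≤ p<q (•-monoʳ n (ℚₚ.<⇒≤ p<q))

  •-cancel-≤ : ∀ {p q} n → suc n • p ℚ.≤ suc n • q → p ℚ.≤ q
  •-cancel-≤ {p} {q} n le = ℚₚ.≮⇒≥ λ q<p → ℚₚ.<-irrefl refl (ℚₚ.<-≤-trans (•-monoʳ-< n q<p) le)

  •-cancel-< : ∀ {p q} n → n • p ℚ.< n • q → p ℚ.< q
  •-cancel-< {p} {q} n lt = ℚₚ.≰⇒> λ q≤p → ℚₚ.<-irrefl refl (ℚₚ.<-≤-trans lt (•-monoʳ n q≤p))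

  •-cancel : ∀ {p q} n → suc n • p ≡ suc n • q → p ≡ q
  •-cancel n eq = ℚₚ.≤-antisym (•-cancel-≤ n (ℚₚ.≤-reflexive eq))
    (•-cancel-≤ n (ℚₚ.≤-reflexive (≡.sym eq)))

  •-cancelˡ-< : ∀ {q m n} → 0ℚ ℚ.≤ q → m • q ℚ.< n • q → m ℕ.< n
  •-cancelˡ-< 0≤q lt = ℕₚ.≰⇒> λ n≤m → ℚₚ.<-irrefl refl (ℚₚ.<-≤-trans lt (•-monoˡ 0≤q n≤m))

  n•0≡0 : ∀ n → n • 0ℚ ≡ 0ℚ
  n•0≡0 zero = refl
  n•0≡0 (suc n) = ≡.trans (ℚₚ.+-identityˡ _) (n•0≡0 n)

  ≤-+-cancelʳ : ∀ r {p q} → p ℚ.+ r ℚ.≤ q ℚ.+ r → p ℚ.≤ q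
  ≤-+-cancelʳ r {p} {q} le = ≡.subst₂ ℚ._≤_ (undo p) (undo q) (ℚₚ.+-monoˡ-≤ (ℚ.- r) le)
    where
    undo : ∀ x → x ℚ.+ r ℚ.+ ℚ.- r ≡ x
    undo x = x+r-r≈x x r

  0≤q-p : ∀ {p q} → p ℚ.≤ q → 0ℚ ℚ.≤ q ℚ.- p
  0≤q-p {p} {q} le = subst (ℚ._≤ q ℚ.- p) (ℚₚ.+-inverseʳ p) (ℚₚ.+-monoˡ-≤ (ℚ.- p) le)

  ≤-natural : ∀ q → Σ ℕ λ m → q ℚ.≤ m • 1ℚ
  ≤-natural q with clear-denominator q | ℚₚ.≤-total 0ℚ q
  ... | k , m , n , eq | inj₂ q≤0 = 0 , q≤0
  ... | k , m , n , eq | inj₁ 0≤q = m , (begin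
    q ≡⟨ •-homo-1 q ⟨
    1 • q ≤⟨ •-monoˡ {q} {1} {suc k} 0≤q (ℕ.s≤s ℕ.z≤n) ⟩
    suc k • q ≡⟨ ℚₚ.+-identityʳ _ ⟨
    suc k • q ℚ.+ 0ℚ ≤⟨ ℚₚ.+-monoʳ-≤ (suc k • q) (•-nonneg n 0≤1) ⟩
    suc k • q ℚ.+ n • 1ℚ ≡⟨ eq ⟩
    m • 1ℚ ∎)
    where open ℚₚ.≤-Reasoning

  -- Multiplying by the denominator gives a positive integer.
  1≤multiple : ∀ {δ} → 0ℚ ℚ.< δ → Σ ℕ λ k → 1ℚ ℚ.≤ suc k • δ
  1≤multiple {δ} 0<δ with clear-denominator δ
  ... | k , m , n , eq = k , ≤-+-cancelʳ (n • 1ℚ) (subst (_ ℚ.≤_) (≡.sym eq) (•-monoˡ {1ℚ} {suc n} {m} 0≤1 n<m))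
    where
    n<m : n ℕ.< m
    n<m = •-cancelˡ-< {1ℚ} {n} {m} 0≤1 (≡.subst₂ ℚ._<_ (ℚₚ.+-identityˡ (n • 1ℚ)) eq
      (ℚₚ.+-monoˡ-< (n • 1ℚ) (subst (ℚ._< suc k • δ) (n•0≡0 (suc k)) (•-monoʳ-< k 0<δ))))

  archimedean : ∀ {δ} → 0ℚ ℚ.< δ → ∀ q → Σ ℕ λ N → q ℚ.≤ N • δ
  archimedean {δ} 0<δ q = m ℕ.* suc k , (begin
    q ≤⟨ proj₂ (≤-natural q) ⟩
    m • 1ℚ ≤⟨ •-monoʳ {1ℚ} {suc k • δ} m (proj₂ (1≤multiple 0<δ)) ⟩
    m • (suc k • δ) ≡⟨ •-assoc δ m (suc k) ⟩
    (m ℕ.* suc k) • δ ∎)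
    where
    open ℚₚ.≤-Reasoning
    m = proj₁ (≤-natural q)
    k = proj₁ (1≤multiple 0<δ)

  -- The subgroup ℤ of ℚ as formal differences of naturals. It turns out to be the value group of
  -- both `ℚₗ` and `K`.
  record IsInteger (q : ℚ) : Set where
    constructor integer
    field
      m n : ℕ
      eq  : q ℚ.+ n • 1ℚ ≡ m • 1ℚ

  integer-• : ∀ m → IsInteger (m • 1ℚ)
  integer-• m = integer m 0 (ℚₚ.+-identityʳ (m • 1ℚ))

  integer-sub : ∀ {p q} → IsInteger p → IsInteger q → IsInteger (p ℚ.- q)
  integer-sub {p} {q} (integer m n eq) (integer m′ n′ eq′) = integer (m ℕ.+ n′) (n ℕ.+ m′) (begin
    p ℚ.- q ℚ.+ (n ℕ.+ m′) • 1ℚ ≡⟨ cong (p ℚ.- q ℚ.+_) (•-homo-+ 1ℚ n m′) ⟩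
    p ℚ.- q ℚ.+ (n • 1ℚ ℚ.+ m′ • 1ℚ) ≡⟨ cong (λ z → p ℚ.- q ℚ.+ (n • 1ℚ ℚ.+ z)) eq′ ⟨
    p ℚ.- q ℚ.+ (n • 1ℚ ℚ.+ (q ℚ.+ n′ • 1ℚ))
      ≡⟨ x-y+[n+[y+m]]≈x+n+m p q (n • 1ℚ) (n′ • 1ℚ) ⟩
    p ℚ.+ n • 1ℚ ℚ.+ n′ • 1ℚ ≡⟨ cong (ℚ._+ n′ • 1ℚ) eq ⟩
    m • 1ℚ ℚ.+ n′ • 1ℚ ≡⟨ •-homo-+ 1ℚ m n′ ⟨
    (m ℕ.+ n′) • 1ℚ ∎)
    where open ≡.≡-Reasoning

  integer-0 : IsInteger 0ℚ
  integer-0 = integer-• 0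

  integer-neg : ∀ {q} → IsInteger q → IsInteger (ℚ.- q)
  integer-neg {q} i = subst IsInteger (ℚₚ.+-identityˡ _) (integer-sub integer-0 i)

  integer-+ : ∀ {p q} → IsInteger p → IsInteger q → IsInteger (p ℚ.+ q)
  integer-+ {p} {q} i j = subst IsInteger
    (x--y≈x+y p q) (integer-sub i (integer-neg j))

  integer-0<⇒1≤ : ∀ {q} → IsInteger q → 0ℚ ℚ.< q → 1ℚ ℚ.≤ q
  integer-0<⇒1≤ {q} (integer m n eq) 0<q = ≤-+-cancelʳ (n • 1ℚ)
    (subst (1ℚ ℚ.+ n • 1ℚ ℚ.≤_) (≡.sym eq) (•-monoˡ {1ℚ} {suc n} {m} 0≤1 (•-cancelˡ-< {1ℚ} {n} {m} 0≤1
      (≡.subst₂ ℚ._<_ (ℚₚ.+-identityˡ (n • 1ℚ)) eq (ℚₚ.+-monoˡ-< (n • 1ℚ) 0<q)))))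

open RationalFacts

-- Elementary theory of valued fields.

module Valued {a b} (F : Field a b) (v : Field.Carrier F → ℚ∞) (isValuation : IsValuation F v) where
  open Field F renaming (refl to ≈-refl; inverse to inverse′)
  open IsValuation isValuation public
  open RingProperties ring
  open IntegerSolver commutativeRing
  module #× = SemiringMult semiring
  open #× using () renaming (_×_ to _×#_) public

  infix 4 _≼_ _≺_

  -- Estimates are phrased as membership in the ball v ≥ q with rational q. Zero lies in every ball,
  -- so no arithmetic with `⊤⁺` is involved.
  _≼_ : ℚ → Carrier → Set
  q ≼ x = [ q ] ≤⁺ v x

  _≺_ : ℚ → Carrier → Set
  q ≺ x = [ q ] <⁺ v x

  v0 : v 0# ≡ ⊤⁺
  v0 = Equivalence.from (v-∞ 0#) ≈-refl

  v≡⊤⇒≈0 : ∀ {x} → v x ≡ ⊤⁺ → x ≈ 0#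
  v≡⊤⇒≈0 {x} = Equivalence.to (v-∞ x)

  finite⇒≉0 : ∀ {x q} → v x ≡ [ q ] → ¬ (x ≈ 0#)
  finite⇒≉0 {x} vx x≈0 with ≡.trans (≡.sym vx) (Equivalence.from (v-∞ x) x≈0)
  ... | ()

  ZeroOrFinite : Carrier → Set b
  ZeroOrFinite x = (x ≈ 0#) ⊎ (∃ λ q → v x ≡ [ q ])

  -- Matching on the value `v x` decides whether x vanishes; this is the source of the decidable
  -- equality that absorbs the double negations.
  zero-or-finite : ∀ x → ZeroOrFinite x
  zero-or-finite x = decide (v x) refl
    where
    decide : ∀ w → v x ≡ w → ZeroOrFinite x
    decide ⊤⁺ eq = inj₁ (v≡⊤⇒≈0 eq)
    decide [ q ] eq = inj₂ (q , eq)

  ≉0⇒finite : ∀ {x} → ¬ (x ≈ 0#) → ∃ λ q → v x ≡ [ q ]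
  ≉0⇒finite {x} x≉0 with zero-or-finite x
  ... | inj₁ x≈0 = contradiction x≈0 x≉0
  ... | inj₂ f = f

  v-unique : ∀ {x p q} → v x ≡ [ p ] → v x ≡ [ q ] → p ≡ q
  v-unique vp vq with ≡.trans (≡.sym vp) vq
  ... | refl = refl

  ≼-cong : ∀ {q x y} → x ≈ y → q ≼ x → q ≼ y
  ≼-cong {q} x≈y = subst ([ q ] ≤⁺_) (v-cong x≈y)

  ≼-0 : ∀ {q} → q ≼ 0#
  ≼-0 {q} = subst ([ q ] ≤⁺_) (≡.sym v0) (_ ≤⊤⁺)

  ≼-≈0 : ∀ {q x} → x ≈ 0# → q ≼ x
  ≼-≈0 x≈0 = ≼-cong (sym x≈0) ≼-0

  ≼-finite : ∀ {q p x} → v x ≡ [ p ] → q ℚ.≤ p → q ≼ x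
  ≼-finite {q} vx le = subst ([ q ] ≤⁺_) (≡.sym vx) [ le ]

  ≼-finite⁻¹ : ∀ {q p x} → v x ≡ [ p ] → q ≼ x → q ℚ.≤ p
  ≼-finite⁻¹ {q} vx le = [≤]-injective (subst ([ q ] ≤⁺_) vx le)

  ≼-weaken : ∀ {p q x} → p ℚ.≤ q → q ≼ x → p ≼ x
  ≼-weaken le = ≤⁺-trans ℚₚ.≤-trans [ le ]

  _≼?_ : ∀ q x → Dec (q ≼ x)
  q ≼? x = ≤⁺-dec ℚₚ._≤?_ [ q ] (v x)

  ≺⇒≼ : ∀ {q x} → q ≺ x → q ≼ x
  ≺⇒≼ {q} {x} = go (v x)
    where
    go : ∀ w → [ q ] <⁺ w → [ q ] ≤⁺ w
    go _ [ lt ] = [ ℚₚ.<⇒≤ lt ]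
    go _ [ _ ]<⊤⁺ = _ ≤⊤⁺

  ≼⇒≺ : ∀ {p q x} → p ℚ.< q → q ≼ x → p ≺ x
  ≼⇒≺ {p} {q} {x} lt = go (v x)
    where
    go : ∀ w → [ q ] ≤⁺ w → [ p ] <⁺ w
    go _ [ le ] = [ ℚₚ.<-≤-trans lt le ]
    go _ (_ ≤⊤⁺) = [ p ]<⊤⁺

  ≺-finite : ∀ {q p x} → v x ≡ [ p ] → q ℚ.< p → q ≺ x
  ≺-finite {q} vx lt = subst ([ q ] <⁺_) (≡.sym vx) [ lt ]

  ≺-finite⁻¹ : ∀ {q p x} → v x ≡ [ p ] → q ≺ x → q ℚ.< p
  ≺-finite⁻¹ {q} vx lt with subst ([ q ] <⁺_) vx lt
  ... | [ l ] = l

  ≺-cong : ∀ {q x y} → x ≈ y → q ≺ x → q ≺ y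
  ≺-cong {q} x≈y = subst ([ q ] <⁺_) (v-cong x≈y)

  ≺-≈0 : ∀ {q x} → x ≈ 0# → q ≺ x
  ≺-≈0 {q} x≈0 = subst ([ q ] <⁺_) (≡.sym (≡.trans (v-cong x≈0) v0)) [ q ]<⊤⁺

  -- Turns a strict bound into a non-strict one with room to spare. For x = 0 there is no finite
  -- value to take, and q + 1 serves.
  ≺-witness : ∀ {q x} → q ≺ x → ∃ λ p → q ℚ.< p × p ≼ x
  ≺-witness {q} {x} = go (v x)
    where
    go : ∀ w → [ q ] <⁺ w → ∃ λ p → q ℚ.< p × [ p ] ≤⁺ w
    go [ p ] [ lt ] = p , lt , [ ℚₚ.≤-refl ]
    go _ [ _ ]<⊤⁺ = q ℚ.+ 1ℚ , subst (ℚ._< q ℚ.+ 1ℚ) (ℚₚ.+-identityʳ q) (ℚₚ.+-monoʳ-< q 0<1) , (_ ≤⊤⁺)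

  ≼-+ : ∀ {q x y} → q ≼ x → q ≼ y → q ≼ x + y
  ≼-+ {q} {x} {y} qx qy = ≤⁺-trans ℚₚ.≤-trans (go (v x) (v y) qx qy) (v-+ x y)
    where
    go : ∀ s t → [ q ] ≤⁺ s → [ q ] ≤⁺ t → [ q ] ≤⁺ (s ⊓∞ t)
    go ⊤⁺ t _ qt = qt
    go [ s ] ⊤⁺ qs _ = qs
    go [ s ] [ t ] [ qs ] [ qt ] = [ ℚₚ.⊓-glb qs qt ]

  ≼-* : ∀ {p q x y} → p ≼ x → q ≼ y → p ℚ.+ q ≼ x * y
  ≼-* {p} {q} {x} {y} px qy = subst ([ p ℚ.+ q ] ≤⁺_) (≡.sym (v-* x y)) (go (v x) (v y) px qy)
    where
    go : ∀ s t → [ p ] ≤⁺ s → [ q ] ≤⁺ t → [ p ℚ.+ q ] ≤⁺ (s +∞ t)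
    go ⊤⁺ t _ _ = _ ≤⊤⁺
    go [ s ] ⊤⁺ _ _ = _ ≤⊤⁺
    go [ s ] [ t ] [ ps ] [ qt ] = [ ℚₚ.+-mono-≤ ps qt ]

  v-*-finite : ∀ {p q x y} → v x ≡ [ p ] → v y ≡ [ q ] → v (x * y) ≡ [ p ℚ.+ q ]
  v-*-finite {x = x} {y} vx vy = ≡.trans (v-* x y) (≡.cong₂ _+∞_ vx vy)

  v1 : v 1# ≡ [ 0ℚ ]
  v1 with ≉0⇒finite {1#} (λ 1≈0 → 0≉1 (sym 1≈0))
  ... | q , eq = ≡.trans eq (cong [_] q≡0)
    where
    q≡0 : q ≡ 0ℚ
    q≡0 = ℚ-Ring.x+x≈x⇒x≈0 q
      (v-unique {1#} (≡.trans (v-cong (sym (*-identityˡ 1#))) (v-*-finite eq eq)) eq)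

  -- From (-1)² = 1 follows 2 v(-1) = 0, and ℚ has no torsion; `•-cancel 1` cancels the factor 2.
  v-neg1 : v (- 1#) ≡ [ 0ℚ ]
  v-neg1 with ≉0⇒finite { - 1# } (λ e → 0≉1 (sym (trans (sym (-‿involutive 1#)) (trans (-‿cong e) -0#≈0#))))
  ... | q , eq = ≡.trans eq (cong [_] (•-cancel 1 (≡.trans (≡.trans
      (cong (q ℚ.+_) (ℚₚ.+-identityʳ q))
      (v-unique {(- 1#) * (- 1#)} (v-*-finite eq eq)
      (≡.trans (v-cong (solve 0 (:- :1 :* :- :1 := :1) ≈-refl)) v1)))
    (≡.sym (n•0≡0 2)))))

  v-neg : ∀ x → v (- x) ≡ v x
  v-neg x = ≡.trans (v-cong (sym (-1*x≈-x x)))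
    (≡.trans (v-* (- 1#) x) (≡.trans (cong (_+∞ v x) v-neg1) (go (v x))))
    where
    go : ∀ w → [ 0ℚ ] +∞ w ≡ w
    go ⊤⁺ = refl
    go [ q ] = cong [_] (ℚₚ.+-identityˡ q)

  ≼-neg : ∀ {q x} → q ≼ x → q ≼ - x
  ≼-neg {q} {x} = subst ([ q ] ≤⁺_) (≡.sym (v-neg x))

  ≼-sub : ∀ {q x y} → q ≼ x → q ≼ y → q ≼ x - y
  ≼-sub qx qy = ≼-+ qx (≼-neg qy)

  ≼-swap : ∀ {q} x y → q ≼ x - y → q ≼ y - x
  ≼-swap x y le = ≼-cong (solve 2 (λ x y → :- (x :- y) := y :- x) ≈-refl x y) (≼-neg le)

  ≼-triangle : ∀ {q} x y z → q ≼ x - y → q ≼ y - z → q ≼ x - z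
  ≼-triangle x y z l r = ≼-cong
    (solve 3 (λ x y z → (x :- y) :+ (y :- z) := x :- z) ≈-refl x y z) (≼-+ l r)

  ≼-recover : ∀ {q} x y → q ≼ x - y → q ≼ y → q ≼ x
  ≼-recover x y d qy = ≼-cong (solve 2 (λ x y → (x :- y) :+ y := x) ≈-refl x y) (≼-+ d qy)

  ≼-1 : 0ℚ ≼ 1#
  ≼-1 = ≼-finite v1 ℚₚ.≤-refl

  ≼-*ˡ : ∀ {q x y} → 0ℚ ≼ x → q ≼ y → q ≼ x * y
  ≼-*ˡ {q} {x} {y} ox qy = subst (_≼ x * y) (ℚₚ.+-identityˡ q) (≼-* ox qy)

  ≼-*ʳ : ∀ {q x y} → q ≼ x → 0ℚ ≼ y → q ≼ x * y
  ≼-*ʳ {q} {x} {y} qx oy = subst (_≼ x * y) (ℚₚ.+-identityʳ q) (≼-* qx oy)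

  1^ : ∀ n → 1# ^ n ≈ 1#
  1^ zero = ≈-refl
  1^ (suc n) = trans (*-identityˡ _) (1^ n)

  ≼-^ : ∀ {q x} n → q ≼ x → n • q ≼ x ^ n
  ≼-^ zero qx = ≼-1
  ≼-^ (suc n) qx = ≼-* qx (≼-^ n qx)

  integral-^ : ∀ {x} n → 0ℚ ≼ x → 0ℚ ≼ x ^ n
  integral-^ {x} n 0x = subst (_≼ x ^ n) (n•0≡0 n) (≼-^ n 0x)

  v-^ : ∀ {x q} n → v x ≡ [ q ] → v (x ^ n) ≡ [ n • q ]
  v-^ zero vx = v1
  v-^ (suc n) vx = v-*-finite vx (v-^ n vx)

  integral-×# : ∀ n → 0ℚ ≼ n ×# 1#
  integral-×# zero = ≼-0
  integral-×# (suc n) = ≼-+ ≼-1 (integral-×# n)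

  ≼-sum : ∀ {q n} (f : Fin n → Carrier) → (∀ i → q ≼ f i) → q ≼ sum f
  ≼-sum {n = zero} f qf = ≼-0
  ≼-sum {n = suc n} f qf = ≼-+ (qf Fin.zero) (≼-sum (λ i → f (Fin.suc i)) (λ i → qf (Fin.suc i)))

  -- The ultrametric inequality bounds v(x + y) from below. If it exceeded p, then x = (x + y) - y
  -- would have valuation greater than p as well.
  strict : ∀ {p x y} → v x ≡ [ p ] → p ≺ y → v (x + y) ≡ [ p ]
  strict {p} {x} {y} vx p<y with zero-or-finite (x + y)
  ... | inj₁ x+y≈0 = contradiction (≺-finite⁻¹ {x = y} (≡.trans (v-cong y≈-x) (≡.trans (v-neg x) vx)) p<y)
                       (ℚₚ.<-irrefl refl)
    where
    y≈-x : y ≈ - x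
    y≈-x = trans (solve 2 (λ x y → y := (x :+ y) :- x) ≈-refl x y) (trans (+-congʳ x+y≈0) (+-identityˡ (- x)))
  ... | inj₂ (s , vs) = ≡.trans vs (cong [_] (ℚₚ.≤-antisym s≤p
          (≼-finite⁻¹ vs (≼-+ (≼-finite vx ℚₚ.≤-refl) (≺⇒≼ p<y)))))
    where
    x≈ : (x + y) - y ≈ x
    x≈ = solve 2 (λ x y → (x :+ y) :- y := x) ≈-refl x y
    s≤p : s ℚ.≤ p
    s≤p = ℚₚ.≮⇒≥ λ p<s → ℚₚ.<-irrefl refl (≺-finite⁻¹ vx
      (≺-cong x≈ (go p<s (≺-witness p<y))))
      where
      go : p ℚ.< s → (∃ λ r → p ℚ.< r × r ≼ y) → p ≺ (x + y) - y
      go p<s (r , p<r , r≼y) = ≼⇒≺ {p} {s ℚ.⊓ r} (⊓-glb-< p<s p<r)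
        (≼-sub (≼-finite vs (ℚₚ.p⊓q≤p s r)) (≼-weaken (ℚₚ.p⊓q≤q s r) r≼y))
        where
        ⊓-glb-< : ∀ {p s r} → p ℚ.< s → p ℚ.< r → p ℚ.< s ℚ.⊓ r
        ⊓-glb-< {p} {s} {r} l m with ℚₚ.⊓-sel s r
        ... | inj₁ e = subst (p ℚ.<_) (≡.sym e) l
        ... | inj₂ e = subst (p ℚ.<_) (≡.sym e) m

  v-close : ∀ {p} x y → v x ≡ [ p ] → p ≺ y - x → v y ≡ [ p ]
  v-close x y vx d = ≡.trans (v-cong (solve 2 (λ x y → y := x :+ (y :- x)) ≈-refl x y)) (strict vx d)

  infinitely-small : ∀ {x} → (∀ q → q ≼ x) → x ≈ 0#
  infinitely-small {x} small with zero-or-finite x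
  ... | inj₁ x≈0 = x≈0
  ... | inj₂ (p , vx) = contradiction
          (ℚₚ.<-≤-trans (subst (ℚ._< p ℚ.+ 1ℚ) (ℚₚ.+-identityʳ p) (ℚₚ.+-monoʳ-< p 0<1))
            (≼-finite⁻¹ vx (small (p ℚ.+ 1ℚ))))
          (ℚₚ.<-irrefl refl)

  v-inverse : ∀ {x y q} → v x ≡ [ q ] → x * y ≈ 1# → v y ≡ [ ℚ.- q ]
  v-inverse {x} {y} {q} vx xy with zero-or-finite y
  ... | inj₁ y≈0 = contradiction (trans (sym (zeroʳ x)) (trans (*-congˡ (sym y≈0)) xy)) 0≉1
  ... | inj₂ (p , vy) = ≡.trans vy (cong [_] (ℚ-Ring.+-inverseʳ-unique q p
          (v-unique {1#} (≡.trans (v-cong (sym xy)) (v-*-finite vx vy)) v1)))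

  ≼-≺-* : ∀ {p q x y} → p ≺ x → q ≼ y → p ℚ.+ q ≺ x * y
  ≼-≺-* {p} {q} px qy with ≺-witness px
  ... | r , p<r , r≼x = ≼⇒≺ (ℚₚ.+-monoˡ-< q p<r) (≼-* r≼x qy)

  ≺-+ : ∀ {q x y} → q ≺ x → q ≺ y → q ≺ x + y
  ≺-+ {q} {x} {y} qx qy with ≺-witness qx | ≺-witness qy
  ... | p , q<p , px | r , q<r , ry with ℚₚ.≤-total p r
  ... | inj₁ p≤r = ≼⇒≺ q<p (≼-+ px (≼-weaken p≤r ry))
  ... | inj₂ r≤p = ≼⇒≺ q<r (≼-+ (≼-weaken r≤p px) ry)

  inverse : ∀ {x q} → v x ≡ [ q ] → ∃ λ y → x * y ≈ 1#
  inverse {x} vx = inverse′ x (finite⇒≉0 vx)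

-- Sums over i + j = d and partial sums.

module Antidiagonal {c ℓ} (R : CommutativeRing c ℓ) where
  open CommutativeRing R renaming (refl to ≈-refl)
  open RawSemiringDefs (RawRing.rawSemiring rawRing) public using (sum)
  open CommutativeSemigroupProperties +-commutativeSemigroup using (interchange)
  open SetoidReasoning setoid

  -- The sum of h i j over i + j = d, by a recursion free of truncated subtraction; `sum≈D` relates
  -- it to the sums over `Fin (suc d)` in the definitions.
  D : ℕ → (ℕ → ℕ → Carrier) → Carrier
  D zero    h = h 0 0
  D (suc d) h = h 0 (suc d) + D d (λ i j → h (suc i) j)

  D-cong : ∀ d {h k} → (∀ i j → i ℕ.+ j ≡ d → h i j ≈ k i j) → D d h ≈ D d k
  D-cong zero    eq = eq 0 0 refl
  D-cong (suc d) eq = +-cong (eq 0 (suc d) refl) (D-cong d λ i j e → eq (suc i) j (cong suc e))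

  D-cong′ : ∀ d {h k} → (∀ i j → h i j ≈ k i j) → D d h ≈ D d k
  D-cong′ d eq = D-cong d λ i j _ → eq i j

  D-last : ∀ d h → D (suc d) h ≈ D d (λ i j → h i (suc j)) + h (suc d) 0
  D-last zero h = ≈-refl
  D-last (suc d) h = trans (+-congˡ (D-last d (λ i j → h (suc i) j))) (sym (+-assoc _ _ _))

  D-comm : ∀ d h → D d h ≈ D d (λ i j → h j i)
  D-comm zero h = ≈-refl
  D-comm (suc d) h = begin
    h 0 (suc d) + D d (λ i j → h (suc i) j) ≈⟨ +-congˡ (D-comm d _) ⟩
    h 0 (suc d) + D d (λ i j → h (suc j) i) ≈⟨ +-comm _ _ ⟩
    D d (λ i j → h (suc j) i) + h 0 (suc d) ≈⟨ D-last d (λ i j → h j i) ⟨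
    D (suc d) (λ i j → h j i) ∎

  D-0 : ∀ d → D d (λ _ _ → 0#) ≈ 0#
  D-0 zero = ≈-refl
  D-0 (suc d) = trans (+-identityˡ _) (D-0 d)

  D-+ : ∀ d h k → D d (λ i j → h i j + k i j) ≈ D d h + D d k
  D-+ zero h k = ≈-refl
  D-+ (suc d) h k = trans (+-congˡ (D-+ d _ _)) (interchange _ _ _ _)

  *-D : ∀ d x h → x * D d h ≈ D d (λ i j → x * h i j)
  *-D zero x h = ≈-refl
  *-D (suc d) x h = trans (distribˡ _ _ _) (+-congˡ (*-D d x _))

  D-* : ∀ d x h → D d h * x ≈ D d (λ i j → h i j * x)
  D-* d x h = trans (*-comm _ _) (trans (*-D d x h) (D-cong′ d λ i j → *-comm _ _))

  -- Both sides run over i + p + r = d, bracketed as (i + p) + r and as i + (p + r).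
  D-assoc : ∀ d (G : ℕ → ℕ → ℕ → Carrier) →
    D d (λ s r → D s (λ i p → G i p r)) ≈ D d (λ i t → D t (λ p r → G i p r))
  D-assoc zero G = ≈-refl
  D-assoc (suc d) G = begin
    G 0 0 (suc d) + D d (λ s r → G 0 (suc s) r + D s (λ i p → G (suc i) p r))
      ≈⟨ +-congˡ (D-+ d _ _) ⟩
    G 0 0 (suc d) + (D d (λ s r → G 0 (suc s) r) + D d (λ s r → D s (λ i p → G (suc i) p r)))
      ≈⟨ +-assoc _ _ _ ⟨
    D (suc d) (λ p r → G 0 p r) + D d (λ s r → D s (λ i p → G (suc i) p r))
      ≈⟨ +-congˡ (D-assoc d λ i → G (suc i)) ⟩
    D (suc d) (λ i t → D t (λ p r → G i p r)) ∎

  D-swap : ∀ t (K : ℕ → ℕ → ℕ → Carrier) →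
    D t (λ p r → D r (λ j q → K p j q)) ≈ D t (λ j l → D l (λ p q → K p j q))
  D-swap t K = begin
    D t (λ p r → D r (λ j q → K p j q)) ≈⟨ D-assoc t K ⟨
    D t (λ s q → D s (λ p j → K p j q)) ≈⟨ D-cong′ t (λ s q → D-comm s _) ⟩
    D t (λ s q → D s (λ j p → K p j q)) ≈⟨ D-assoc t (λ j p q → K p j q) ⟩
    D t (λ j l → D l (λ p q → K p j q)) ∎

  -- Both sides run over i + p + j + q = d. The left side groups by the two factors of a product,
  -- the right side by its first variable and the remaining ones.
  D-exchange : ∀ d (H : ℕ → ℕ → ℕ → ℕ → Carrier) →
    D d (λ s r → D s (λ i p → D r (λ j q → H i p j q))) ≈
    D d (λ k l → D k (λ i j → D l (λ p q → H i p j q)))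
  D-exchange d H = begin
    D d (λ s r → D s (λ i p → D r (λ j q → H i p j q)))
      ≈⟨ D-assoc d (λ i p r → D r (λ j q → H i p j q)) ⟩
    D d (λ i t → D t (λ p r → D r (λ j q → H i p j q)))
      ≈⟨ D-cong′ d (λ i t → D-swap t (H i)) ⟩
    D d (λ i t → D t (λ j l → D l (λ p q → H i p j q)))
      ≈⟨ D-assoc d (λ i j l → D l (λ p q → H i p j q)) ⟨
    D d (λ k l → D k (λ i j → D l (λ p q → H i p j q))) ∎

  D-zero : ∀ d h → (∀ i j → i ℕ.+ j ≡ d → h i j ≈ 0#) → D d h ≈ 0#
  D-zero d h eq = trans (D-cong d eq) (D-0 d)

  D-single : ∀ k l h → (∀ i j → i ≢ k → h i j ≈ 0#) → D (k ℕ.+ l) h ≈ h k l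
  D-single zero zero h z = ≈-refl
  D-single zero (suc l) h z = trans (+-congˡ (D-zero l _ λ i j _ → z (suc i) j λ ())) (+-identityʳ _)
  D-single (suc k) l h z = trans (+-cong (z 0 _ λ ())
    (D-single k l _ λ i j i≢k → z (suc i) j λ e → i≢k (ℕₚ.suc-injective e))) (+-identityˡ _)

  sum≈D : ∀ d h → sum {suc d} (λ i → h (toℕ i) (d ℕ.∸ toℕ i)) ≈ D d h
  sum≈D zero h = +-identityʳ _
  sum≈D (suc d) h = +-congˡ (sum≈D d λ i j → h (suc i) j)

  T : (ℕ → Carrier) → ℕ → Carrier
  T a zero    = a 0
  T a (suc N) = T a N + a (suc N)

  -- A partial sum is an antidiagonal sum that ignores the second index; in this form `D-assoc`
  -- applies to partial sums.
  T≈D : ∀ a N → T a N ≈ D N (λ i _ → a i)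
  T≈D a zero = ≈-refl
  T≈D a (suc N) = trans (+-congʳ (T≈D a N)) (sym (D-last N λ i _ → a i))

  T-cong : ∀ {a b} N → (∀ d → d ℕ.≤ N → a d ≈ b d) → T a N ≈ T b N
  T-cong zero eq = eq 0 ℕ.z≤n
  T-cong (suc N) eq = +-cong (T-cong N λ d le → eq d (ℕₚ.m≤n⇒m≤1+n le)) (eq (suc N) ℕₚ.≤-refl)

  T-stable : ∀ a {M N} → M ℕ.≤′ N → (∀ d → M ℕ.< d → a d ≈ 0#) → T a N ≈ T a M
  T-stable a ℕ.≤′-refl z = ≈-refl
  T-stable a (ℕ.≤′-step le) z =
    trans (+-cong (T-stable a le z) (z _ (ℕ.s≤s (ℕₚ.≤′⇒≤ le)))) (+-identityʳ _)

  sum-cong : ∀ {n} {f g : Fin n → Carrier} → (∀ i → f i ≈ g i) → sum f ≈ sum g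
  sum-cong {zero} eq = ≈-refl
  sum-cong {suc n} eq = +-cong (eq Fin.zero) (sum-cong λ i → eq (Fin.suc i))

  -- One notion covers finite summations as well as negation and multiplication by a constant (where
  -- X is `⊤`), so that exchanging L with each kind of finite sum is proved only once.
  record Additive {x} {X : Set x} (L : (X → Carrier) → Carrier) : Set (c ⊔ ℓ ⊔ x) where
    field
      L-cong : ∀ {f g} → (∀ x → f x ≈ g x) → L f ≈ L g
      L-0    : L (λ _ → 0#) ≈ 0#
      L-+    : ∀ f g → L (λ x → f x + g x) ≈ L f + L g

    L-sum : ∀ {n} (h : Fin n → X → Carrier) → L (λ x → sum (λ i → h i x)) ≈ sum (λ i → L (h i))
    L-sum {zero} h = L-0
    L-sum {suc n} h = trans (L-+ _ _) (+-congˡ (L-sum λ i → h (Fin.suc i)))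

    L-D : ∀ d (h : ℕ → ℕ → X → Carrier) → L (λ x → D d (λ i j → h i j x)) ≈ D d (λ i j → L (h i j))
    L-D zero h = ≈-refl
    L-D (suc d) h = trans (L-+ _ _) (+-congˡ (L-D d λ i → h (suc i)))

  open Additive public

  *-additive : ∀ x → Additive {X = ⊤} (λ f → x * f tt)
  *-additive x = record
    { L-cong = λ eq → *-congˡ (eq tt)
    ; L-0 = zeroʳ x
    ; L-+ = λ f g → distribˡ x _ _
    }

  neg-additive : Additive {X = ⊤} (λ f → - f tt)
  neg-additive = record
    { L-cong = λ eq → -‿cong (eq tt)
    ; L-0 = RingProperties.-0#≈0# ring
    ; L-+ = λ f g → sym (RingProperties.-‿+-comm ring _ _)
    }

  T-additive : ∀ N → Additive {X = ℕ} (λ a → T a N)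
  T-additive N = record
    { L-cong = λ eq → T-cong N λ d _ → eq d
    ; L-0 = T0 N
    ; L-+ = T+ N
    }
    where
    T0 : ∀ N → T (λ _ → 0#) N ≈ 0#
    T0 zero = ≈-refl
    T0 (suc N) = trans (+-identityʳ _) (T0 N)
    T+ : ∀ N f g → T (λ x → f x + g x) N ≈ T f N + T g N
    T+ zero f g = ≈-refl
    T+ (suc N) f g = trans (+-congʳ (T+ N f g)) (interchange _ _ _ _)

  sum-additive : ∀ n → Additive {X = Fin n} sum
  sum-additive n = record { L-cong = sum-cong ; L-0 = s0 n ; L-+ = s+ n }
    where
    s0 : ∀ n → sum {n} (λ _ → 0#) ≈ 0#
    s0 zero = ≈-refl
    s0 (suc n) = trans (+-identityˡ _) (s0 n)
    s+ : ∀ n (f g : Fin n → Carrier) → sum (λ i → f i + g i) ≈ sum f + sum g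
    s+ zero f g = sym (+-identityˡ _)
    s+ (suc n) f g = trans (+-congˡ (s+ n _ _)) (interchange _ _ _ _)

-- Power series restricted to the line t·x.

module SeriesAlgebra {c ℓ} (R : CommutativeRing c ℓ) where
  open CommutativeRing R renaming (refl to ≈-refl; rawRing to rawR)
  open Antidiagonal R
  open PowerSeries rawR
  open FormalGroup rawR using () renaming (subst to compose) public
  open Exp semiring using (_^_; ^-homo-*)
  open IntegerSolver R
  open SetoidReasoning setoid

  _^ᵐ_ : ∀ {m} → Vector Carrier m → Vec ℕ m → Carrier
  x ^ᵐ μ = monomial rawR x μ

  gradedSum : ∀ {m} → ℕ → (Vec ℕ m → Carrier) → Carrier
  gradedSum {zero} zero    h = h []
  gradedSum {zero} (suc d) h = 0#
  gradedSum {suc m} d h = D d (λ i j → gradedSum j (λ μ → h (i ∷ μ)))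

  gradedSum-cong : ∀ {m} d {f g : Vec ℕ m → Carrier} →
    (∀ μ → degree μ ≡ d → f μ ≈ g μ) → gradedSum d f ≈ gradedSum d g
  gradedSum-cong {zero} zero eq = eq [] refl
  gradedSum-cong {zero} (suc d) eq = ≈-refl
  gradedSum-cong {suc m} d eq = D-cong d λ i j i+j≡d →
    gradedSum-cong j λ μ e → eq (i ∷ μ) (≡.trans (cong (i ℕ.+_) e) i+j≡d)

  gradedSum-additive : ∀ {m} d → Additive {X = Vec ℕ m} (gradedSum d)
  gradedSum-additive {m} d = record
    { L-cong = λ eq → gradedSum-cong d λ μ _ → eq μ
    ; L-0 = zeros m d
    ; L-+ = λ f g → sums d f g
    }
    where
    zeros : ∀ m d → gradedSum {m} d (λ _ → 0#) ≈ 0#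
    zeros zero zero = ≈-refl
    zeros zero (suc d) = ≈-refl
    zeros (suc m) d = D-zero d _ λ i j _ → zeros m j
    sums : ∀ {m} d (f g : Vec ℕ m → Carrier) →
      gradedSum d (λ μ → f μ + g μ) ≈ gradedSum d f + gradedSum d g
    sums {zero} zero f g = ≈-refl
    sums {zero} (suc d) f g = sym (+-identityˡ _)
    sums {suc m} d f g = trans
      (D-cong′ d λ i j → sums {m} j (λ μ → f (i ∷ μ)) (λ μ → g (i ∷ μ))) (D-+ d _ _)

  gradedSum-zero : ∀ {m} d (h : Vec ℕ m → Carrier) →
    (∀ μ → degree μ ≡ d → h μ ≈ 0#) → gradedSum d h ≈ 0#
  gradedSum-zero {m} d h eq = trans (gradedSum-cong d eq) (L-0 (gradedSum-additive {m} d))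

  gradedSum-single : ∀ {m} (ν : Vec ℕ m) h → (∀ μ → μ ≢ ν → h μ ≈ 0#) →
    gradedSum (degree ν) h ≈ h ν
  gradedSum-single [] h z = ≈-refl
  gradedSum-single (k ∷ ν) h z = trans
    (D-single k (degree ν) _ λ i j i≢k → gradedSum-zero j _ λ μ _ →
      z (i ∷ μ) λ { refl → i≢k refl })
    (gradedSum-single ν _ λ μ μ≢ν → z (k ∷ μ) λ { refl → μ≢ν refl })

  sumDegree≤-D : ∀ {m} d (f : Vec ℕ (suc m) → Carrier) →
    sumDegree≤ d f ≈ D d (λ i r → sumDegree≤ r (λ μ → f (i ∷ μ)))
  sumDegree≤-D d f = sum≈D d (λ i r → sumDegree≤ r (λ μ → f (i ∷ μ)))

  -- Regroups by total degree. After the first exponent i the remaining sum is, by induction, a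
  -- partial sum up to the budget r, and `D-assoc` merges i with the degree of the rest.
  sumDegree≤≈T : ∀ {m} N (h : Vec ℕ m → Carrier) →
    sumDegree≤ N h ≈ T (λ d → gradedSum d h) N
  sumDegree≤≈T {zero} N h = sym (T-stable (λ d → gradedSum d h) (ℕₚ.≤⇒≤′ {0} {N} ℕ.z≤n) λ { (suc d) _ → ≈-refl })
  sumDegree≤≈T {suc m} N h = begin
    sumDegree≤ N h ≈⟨ sumDegree≤-D N h ⟩
    D N (λ i r → sumDegree≤ r (λ μ → h (i ∷ μ)))
      ≈⟨ D-cong′ N (λ i r → trans (sumDegree≤≈T {m} r _) (T≈D _ r)) ⟩
    D N (λ i r → D r (λ p q → gradedSum p (λ μ → h (i ∷ μ))))
      ≈⟨ D-assoc N (λ i p q → gradedSum p (λ μ → h (i ∷ μ))) ⟨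
    D N (λ s r → gradedSum s h) ≈⟨ T≈D _ N ⟨
    T (λ d → gradedSum d h) N ∎

  sumDegree≤-cong : ∀ {m} N {f g : Vec ℕ m → Carrier} → (∀ μ → f μ ≈ g μ) →
    sumDegree≤ N f ≈ sumDegree≤ N g
  sumDegree≤-cong {zero} N eq = eq []
  sumDegree≤-cong {suc m} N {f} {g} eq = sum-cong {suc N}
    {λ i → sumDegree≤ (N ℕ.∸ toℕ i) λ μ → f (toℕ i ∷ μ)} {λ i → sumDegree≤ (N ℕ.∸ toℕ i) λ μ → g (toℕ i ∷ μ)} λ i → sumDegree≤-cong (N ℕ.∸ toℕ i) λ μ → eq (toℕ i ∷ μ)

  sumDegree≤-additive : ∀ {m} N → Additive {X = Vec ℕ m} (sumDegree≤ N)
  sumDegree≤-additive {m} N = record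
    { L-cong = sumDegree≤-cong N
    ; L-0 = trans (sumDegree≤≈T {m} N _) (trans (T-cong N λ d _ → L-0 (gradedSum-additive {m} d)) (L-0 (T-additive N)))
    ; L-+ = λ f g → trans (sumDegree≤≈T {m} N _) (trans (T-cong N λ d _ → L-+ (gradedSum-additive d) f g)
        (trans (L-+ (T-additive N) _ _) (+-cong (sym (sumDegree≤≈T N f)) (sym (sumDegree≤≈T N g)))))
    }

  L-sumDegree≤ : ∀ {x} {X : Set x} {L : (X → Carrier) → Carrier} → Additive L →
    ∀ {m} N (h : Vec ℕ m → X → Carrier) →
    L (λ x → sumDegree≤ N (λ μ → h μ x)) ≈ sumDegree≤ N (λ μ → L (h μ))
  L-sumDegree≤ add {zero} N h = ≈-refl
  L-sumDegree≤ {L = L} add {suc m} N h = trans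
    (L-sum add {suc N} λ i x → sumDegree≤ (N ℕ.∸ toℕ i) λ μ → h (toℕ i ∷ μ) x)
    (sum-cong {suc N} {λ i → L λ x → sumDegree≤ (N ℕ.∸ toℕ i) λ μ → h (toℕ i ∷ μ) x}
      {λ i → sumDegree≤ (N ℕ.∸ toℕ i) λ μ → L (h (toℕ i ∷ μ))} λ i → L-sumDegree≤ add (N ℕ.∸ toℕ i) λ μ → h (toℕ i ∷ μ))

  sumDegree≤-stable : ∀ {m} {M N} (h : Vec ℕ m → Carrier) → M ℕ.≤ N →
    (∀ μ → M ℕ.< degree μ → h μ ≈ 0#) → sumDegree≤ N h ≈ sumDegree≤ M h
  sumDegree≤-stable {M = M} {N} h M≤N z = begin
    sumDegree≤ N h ≈⟨ sumDegree≤≈T N h ⟩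
    T (λ d → gradedSum d h) N
      ≈⟨ T-stable _ (ℕₚ.≤⇒≤′ M≤N) (λ d M<d → gradedSum-zero d h λ μ e → z μ (≡.subst (M ℕ.<_) (≡.sym e) M<d)) ⟩
    T (λ d → gradedSum d h) M ≈⟨ sumDegree≤≈T M h ⟨
    sumDegree≤ M h ∎

  sumBelow-cong : ∀ {m} (ν : Vec ℕ m) {f g} → (∀ μ → f μ ≈ g μ) → sumBelow ν f ≈ sumBelow ν g
  sumBelow-cong [] eq = eq []
  sumBelow-cong (k ∷ ν) {f} {g} eq = sum-cong {suc k}
    {λ i → sumBelow ν λ μ → f (toℕ i ∷ μ)} {λ i → sumBelow ν λ μ → g (toℕ i ∷ μ)} λ i → sumBelow-cong ν λ μ → eq (toℕ i ∷ μ)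

  L-sumBelow : ∀ {x} {X : Set x} {L : (X → Carrier) → Carrier} → Additive L →
    ∀ {m} (ν : Vec ℕ m) (h : Vec ℕ m → X → Carrier) →
    L (λ x → sumBelow ν (λ μ → h μ x)) ≈ sumBelow ν (λ μ → L (h μ))
  L-sumBelow add [] h = ≈-refl
  L-sumBelow {L = L} add (k ∷ ν) h = trans
    (L-sum add {suc k} λ i x → sumBelow ν λ μ → h (toℕ i ∷ μ) x)
    (sum-cong {suc k} {λ i → L λ x → sumBelow ν λ μ → h (toℕ i ∷ μ) x}
      {λ i → sumBelow ν λ μ → L (h (toℕ i ∷ μ))} λ i → L-sumBelow add ν λ μ → h (toℕ i ∷ μ))

  infixl 7 _⊛_
  _⊛_ : ∀ {m} → Series m → Series m → Series m
  _⊛_ {m} = RawRing._*_ (rawRing m)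

  ⊛-cong : ∀ {m} {f f′ g g′ : Series m} → (∀ ν → f ν ≈ f′ ν) → (∀ ν → g ν ≈ g′ ν) →
    ∀ ν → (f ⊛ g) ν ≈ (f′ ⊛ g′) ν
  ⊛-cong eq eq′ ν = sumBelow-cong ν λ μ → *-cong (eq μ) (eq′ _)

  slice : ∀ {m} → Series (suc m) → ℕ → Series m
  slice f i μ = f (i ∷ μ)

  ⊛-slice : ∀ {m} (f g : Series (suc m)) k ν →
    (f ⊛ g) (k ∷ ν) ≈ D k (λ i j → (slice f i ⊛ slice g j) ν)
  ⊛-slice f g k ν = sum≈D k (λ i j → (slice f i ⊛ slice g j) ν)

  -- Since `gradedSum d f` is the coefficient of t^d in f(t,...,t), this expresses that replacing
  -- every variable by t is multiplicative.
  gradedSum-⊛ : ∀ {m} d (f g : Series m) →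
    gradedSum d (f ⊛ g) ≈ D d (λ s r → gradedSum s f * gradedSum r g)
  gradedSum-⊛ {zero} zero f g = ≈-refl
  gradedSum-⊛ {zero} (suc d) f g = sym (D-zero (suc d) _ vanish)
    where
    vanish : ∀ i j → i ℕ.+ j ≡ suc d → gradedSum i f * gradedSum j g ≈ 0#
    vanish zero (suc j) e = zeroʳ _
    vanish (suc i) j e = zeroˡ _
  gradedSum-⊛ {suc m} d f g = begin
    D d (λ k l → gradedSum l (λ ν → (f ⊛ g) (k ∷ ν)))
      ≈⟨ D-cong′ d (λ k l → L-cong (gradedSum-additive l) (⊛-slice f g k)) ⟩
    D d (λ k l → gradedSum l (λ ν → D k (λ i j → (slice f i ⊛ slice g j) ν)))
      ≈⟨ D-cong′ d (λ k l → trans (L-D (gradedSum-additive {m} l) k _)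
           (D-cong′ k λ i j → gradedSum-⊛ {m} l (slice f i) (slice g j))) ⟩
    D d (λ k l → D k (λ i j → D l (λ p q → F i p * G j q)))
      ≈⟨ D-exchange d (λ i p j q → F i p * G j q) ⟨
    D d (λ s r → D s (λ i p → D r (λ j q → F i p * G j q)))
      ≈⟨ D-cong′ d (λ s r → trans (D-cong′ s λ i p → sym (*-D r _ _)) (sym (D-* s _ _))) ⟩
    D d (λ s r → gradedSum s f * gradedSum r g) ∎
    where
    F = λ i p → gradedSum p (slice f i)
    G = λ j q → gradedSum q (slice g j)

  -- The coefficients of f(x₁X₁,...,xₘXₘ); their sum is the value of f at x.
  weight : ∀ {m} → Vector Carrier m → Series m → Series m
  weight x f μ = f μ * x ^ᵐ μ

  scaled-⊛ : ∀ {m} (f g : Series m) y z ν →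
    ((λ μ → f μ * y) ⊛ (λ μ → g μ * z)) ν ≈ (y * z) * (f ⊛ g) ν
  scaled-⊛ f g y z ν = trans
    (sumBelow-cong ν λ μ → solve 4 (λ a y b z → (a :* y) :* (b :* z) := (y :* z) :* (a :* b)) ≈-refl _ y _ z)
    (sym (L-sumBelow (*-additive (y * z)) ν λ μ _ → f μ * g (Vec.zipWith ℕ._∸_ ν μ)))

  -- Rescaling the variables is multiplicative: along the antidiagonal i + j = k the factor x₀^k
  -- splits as x₀^i x₀^j, one power for each slice.
  weight-⊛ : ∀ {m} (x : Vector Carrier m) f g ν → weight x (f ⊛ g) ν ≈ (weight x f ⊛ weight x g) ν
  weight-⊛ x f g [] = solve 2 (λ a b → (a :* b) :* :1 := (a :* :1) :* (b :* :1)) ≈-refl (f []) (g [])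
  weight-⊛ x f g (k ∷ ν) = begin
    (f ⊛ g) (k ∷ ν) * (x₀ ^ k * x′ ^ᵐ ν) ≈⟨ *-congʳ (⊛-slice f g k ν) ⟩
    D k (λ i j → (slice f i ⊛ slice g j) ν) * (x₀ ^ k * x′ ^ᵐ ν) ≈⟨ D-* k _ _ ⟩
    D k (λ i j → (slice f i ⊛ slice g j) ν * (x₀ ^ k * x′ ^ᵐ ν)) ≈⟨ D-cong k term ⟩
    D k (λ i j → (slice (weight x f) i ⊛ slice (weight x g) j) ν)
      ≈⟨ ⊛-slice (weight x f) (weight x g) k ν ⟨
    (weight x f ⊛ weight x g) (k ∷ ν) ∎
    where
    x₀ = x Fin.zero
    x′ = x ∘ Fin.suc
    pull : ∀ h i μ → slice (weight x h) i μ ≈ weight x′ (slice h i) μ * x₀ ^ i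
    pull h i μ = solve 3 (λ a y z → a :* (y :* z) := (a :* z) :* y) ≈-refl _ _ _
    term : ∀ i j → i ℕ.+ j ≡ k → (slice f i ⊛ slice g j) ν * (x₀ ^ k * x′ ^ᵐ ν) ≈
      (slice (weight x f) i ⊛ slice (weight x g) j) ν
    term i j refl = begin
      (slice f i ⊛ slice g j) ν * (x₀ ^ (i ℕ.+ j) * x′ ^ᵐ ν) ≈⟨ *-congˡ (*-congʳ (^-homo-* x₀ i j)) ⟩
      (slice f i ⊛ slice g j) ν * (x₀ ^ i * x₀ ^ j * x′ ^ᵐ ν)
        ≈⟨ solve 3 (λ a y z → a :* (y :* z) := y :* (a :* z)) ≈-refl _ _ _ ⟩
      x₀ ^ i * x₀ ^ j * weight x′ (slice f i ⊛ slice g j) ν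
        ≈⟨ *-congˡ (weight-⊛ x′ (slice f i) (slice g j) ν) ⟩
      x₀ ^ i * x₀ ^ j * (weight x′ (slice f i) ⊛ weight x′ (slice g j)) ν
        ≈⟨ scaled-⊛ (weight x′ (slice f i)) (weight x′ (slice g j)) _ _ ν ⟨
      ((λ μ → weight x′ (slice f i) μ * x₀ ^ i) ⊛ (λ μ → weight x′ (slice g j) μ * x₀ ^ j)) ν
        ≈⟨ ⊛-cong (pull f i) (pull g j) ν ⟨
      (slice (weight x f) i ⊛ slice (weight x g) j) ν ∎

  -- part x f is the one-variable series f(x₁t,…,xₘt).
  part : ∀ {m} → Vector Carrier m → Series m → ℕ → Carrier
  part x f d = gradedSum d (weight x f)

  δ₀ : ℕ → Carrier
  δ₀ zero = 1#
  δ₀ (suc _) = 0#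

  infixl 7 _⋆_
  _⋆_ : (ℕ → Carrier) → (ℕ → Carrier) → ℕ → Carrier
  (a ⋆ b) d = D d (λ i j → a i * b j)

  ⋆-cong : ∀ {a a′ b b′} → (∀ d → a d ≈ a′ d) → (∀ d → b d ≈ b′ d) → ∀ d → (a ⋆ b) d ≈ (a′ ⋆ b′) d
  ⋆-cong eq eq′ d = D-cong′ d λ i j → *-cong (eq i) (eq′ j)

  -- Series in t with the Cauchy product, packaged so that `monomial` and the powers of the
  -- definitions apply to them verbatim.
  oneVariable : RawRing c ℓ
  oneVariable = record
    { Carrier = ℕ → Carrier
    ; _≈_ = λ a b → ∀ d → a d ≈ b d
    ; _+_ = λ a b d → a d + b d
    ; _*_ = _⋆_
    ; -_ = λ a d → - a d
    ; 0# = λ _ → 0#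
    ; 1# = δ₀
    }

  part-cong : ∀ {m} (x : Vector Carrier m) {f g : Series m} → (∀ ν → f ν ≈ g ν) → ∀ d → part x f d ≈ part x g d
  part-cong x eq d = gradedSum-cong d λ μ _ → *-congʳ (eq μ)

  part-⊛ : ∀ {m} (x : Vector Carrier m) f g d → part x (f ⊛ g) d ≈ (part x f ⋆ part x g) d
  part-⊛ x f g d = trans (gradedSum-cong d λ μ _ → weight-⊛ x f g μ)
    (gradedSum-⊛ d (weight x f) (weight x g))

  single : ∀ {m} → Vec ℕ m → Series m
  single ν μ = if does (Vecₚ.≡-dec ℕₚ._≟_ μ ν) then 1# else 0#

  single-≢ : ∀ {m} (ν μ : Vec ℕ m) → μ ≢ ν → single ν μ ≈ 0#
  single-≢ ν μ μ≢ν with Vecₚ.≡-dec ℕₚ._≟_ μ ν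
  ... | yes e = contradiction e μ≢ν
  ... | no _ = ≈-refl

  single-≡ : ∀ {m} (ν : Vec ℕ m) → single ν ν ≈ 1#
  single-≡ ν with Vecₚ.≡-dec ℕₚ._≟_ ν ν
  ... | yes e = ≈-refl
  ... | no ν≢ν = contradiction refl ν≢ν

  part-single : ∀ {m} (x : Vector Carrier m) ν → part x (single ν) (degree ν) ≈ x ^ᵐ ν
  part-single x ν = trans
    (gradedSum-single ν _ λ μ μ≢ν → trans (*-congʳ (single-≢ ν μ μ≢ν)) (zeroˡ _))
    (trans (*-congʳ (single-≡ ν)) (*-identityˡ _))

  part-single-≢ : ∀ {m} (x : Vector Carrier m) ν d → d ≢ degree ν → part x (single ν) d ≈ 0#
  part-single-≢ x ν d d≢ = gradedSum-zero d _ λ μ e →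
    trans (*-congʳ (single-≢ ν μ λ { refl → d≢ (≡.sym e) })) (zeroˡ _)

  degree-replicate : ∀ m → degree (Vec.replicate m 0) ≡ 0
  degree-replicate zero = refl
  degree-replicate (suc m) = degree-replicate m

  ^ᵐ-replicate : ∀ {m} (x : Vector Carrier m) → x ^ᵐ Vec.replicate m 0 ≈ 1#
  ^ᵐ-replicate {zero} x = ≈-refl
  ^ᵐ-replicate {suc m} x = trans (*-identityˡ _) (^ᵐ-replicate (x ∘ Fin.suc))

  unit : ∀ {m} → Fin m → Vec ℕ m
  unit {m} i = Vec.replicate m 0 Vec.[ i ]≔ 1

  degree-unit : ∀ {m} (i : Fin m) → degree (unit i) ≡ 1
  degree-unit {suc m} Fin.zero = cong suc (degree-replicate m)
  degree-unit (Fin.suc i) = degree-unit i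

  ^ᵐ-unit : ∀ {m} (x : Vector Carrier m) i → x ^ᵐ unit i ≈ x i
  ^ᵐ-unit x Fin.zero = trans (*-cong (*-identityʳ _) (^ᵐ-replicate (x ∘ Fin.suc))) (*-identityʳ _)
  ^ᵐ-unit x (Fin.suc i) = trans (*-identityˡ _) (^ᵐ-unit (x ∘ Fin.suc) i)

  one : ∀ {m} → Series m
  one {m} = RawRing.1# (rawRing m)

  part-one : ∀ {m} (x : Vector Carrier m) d → part x one d ≈ δ₀ d
  part-one {m} x zero = trans (subst (λ d → part x one d ≈ x ^ᵐ Vec.replicate m 0) (degree-replicate m)
    (part-single x (Vec.replicate m 0))) (^ᵐ-replicate x)
  part-one {m} x (suc d) = part-single-≢ x (Vec.replicate m 0) (suc d)
    λ e → ℕₚ.1+n≢0 (≡.trans e (degree-replicate m))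

  part-var-1 : ∀ {m} (x : Vector Carrier m) i → part x (var i) 1 ≈ x i
  part-var-1 x i = trans (subst (λ d → part x (var i) d ≈ x ^ᵐ unit i) (degree-unit i)
    (part-single x (unit i))) (^ᵐ-unit x i)

  part-var-≢ : ∀ {m} (x : Vector Carrier m) i d → d ≢ 1 → part x (var i) d ≈ 0#
  part-var-≢ x i d d≢1 = part-single-≢ x (unit i) d λ e → d≢1 (≡.trans e (degree-unit i))

  -- A variable sits in degree 1, so the partial sum at N = 0 is still 0; hence the condition 1 ≤ N
  -- here and in the estimates built on it.
  T-part-var : ∀ {m} (x : Vector Carrier m) i N → 1 ℕ.≤ N → T (part x (var i)) N ≈ x i
  T-part-var x i N 1≤N = trans
    (T-stable _ (ℕₚ.≤⇒≤′ 1≤N) λ d 1<d → part-var-≢ x i d λ { refl → ℕₚ.<-irrefl refl 1<d })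
    (trans (+-cong (part-var-≢ x i 0 λ ()) (part-var-1 x i)) (+-identityˡ _))

  _^ˢ_ : ∀ {m} → Vector (ℕ → Carrier) m → Vec ℕ m → ℕ → Carrier
  G ^ˢ μ = monomial oneVariable G μ

  part-^ : ∀ {k} (x : Vector Carrier k) (g : Series k) n d →
    part x (RawSemiringDefs._^_ (RawRing.rawSemiring (rawRing k)) g n) d ≈
    RawSemiringDefs._^_ (RawRing.rawSemiring oneVariable) (part x g) n d
  part-^ x g zero d = part-one x d
  part-^ x g (suc n) d = trans (part-⊛ x g _ d) (⋆-cong (λ _ → ≈-refl) (part-^ x g n) d)

  part-monomial : ∀ {m k} (x : Vector Carrier k) (g : Vector (Series k) m) μ d →
    part x (monomial (rawRing k) g μ) d ≈ ((λ j → part x (g j)) ^ˢ μ) d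
  part-monomial x g [] d = part-one x d
  part-monomial x g (n ∷ μ) d = trans (part-⊛ x _ _ d)
    (⋆-cong (part-^ x (g Fin.zero) n) (part-monomial x (g ∘ Fin.suc) μ) d)

  -- Restricting f(g₁,...,gₘ) to the line t·x amounts to substituting the series gⱼ(t·x) into f. The
  -- cutoff `degree ν` becomes d because only exponents ν of degree d contribute to t^d.
  part-compose : ∀ {m k} (x : Vector Carrier k) (f : Series m) (g : Vector (Series k) m) d →
    part x (compose f g) d ≈ sumDegree≤ d (λ μ → f μ * ((λ j → part x (g j)) ^ˢ μ) d)
  part-compose {m} {k} x f g d = begin
    gradedSum d (λ ν → sumDegree≤ (degree ν) (λ μ → f μ * gᵐ μ ν) * x ^ᵐ ν)
      ≈⟨ gradedSum-cong d term ⟩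
    gradedSum d (λ ν → sumDegree≤ d (λ μ → f μ * (gᵐ μ ν * x ^ᵐ ν)))
      ≈⟨ L-sumDegree≤ (gradedSum-additive d) d (λ μ ν → f μ * (gᵐ μ ν * x ^ᵐ ν)) ⟩
    sumDegree≤ d (λ μ → gradedSum d (λ ν → f μ * (gᵐ μ ν * x ^ᵐ ν)))
      ≈⟨ sumDegree≤-cong d (λ μ → trans (sym (gradedSum-*ˡ {k} d (f μ) _)) (*-congˡ (part-monomial x g μ d))) ⟩
    sumDegree≤ d (λ μ → f μ * ((λ j → part x (g j)) ^ˢ μ) d) ∎
    where
    gᵐ = monomial (rawRing k) g
    term : ∀ ν → degree ν ≡ d → sumDegree≤ (degree ν) (λ μ → f μ * gᵐ μ ν) * x ^ᵐ ν ≈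
      sumDegree≤ d (λ μ → f μ * (gᵐ μ ν * x ^ᵐ ν))
    term ν e = begin
      sumDegree≤ (degree ν) (λ μ → f μ * gᵐ μ ν) * x ^ᵐ ν
        ≡⟨ cong (λ d → sumDegree≤ d (λ μ → f μ * gᵐ μ ν) * x ^ᵐ ν) e ⟩
      sumDegree≤ d (λ μ → f μ * gᵐ μ ν) * x ^ᵐ ν ≈⟨ *-comm _ _ ⟩
      x ^ᵐ ν * sumDegree≤ d (λ μ → f μ * gᵐ μ ν)
        ≈⟨ L-sumDegree≤ (*-additive (x ^ᵐ ν)) d (λ μ _ → f μ * gᵐ μ ν) ⟩
      sumDegree≤ d (λ μ → x ^ᵐ ν * (f μ * gᵐ μ ν))
        ≈⟨ sumDegree≤-cong {m} d (λ μ → solve 3 (λ x f g → x :* (f :* g) := f :* (g :* x)) ≈-refl _ _ _) ⟩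
      sumDegree≤ d (λ μ → f μ * (gᵐ μ ν * x ^ᵐ ν)) ∎
    gradedSum-*ˡ : ∀ {m} d y (h : Vec ℕ m → Carrier) →
      y * gradedSum d h ≈ gradedSum d (λ μ → y * h μ)
    gradedSum-*ˡ {zero} zero y h = ≈-refl
    gradedSum-*ˡ {zero} (suc d) y h = zeroʳ y
    gradedSum-*ˡ {suc m} d y h = trans (*-D d y _) (D-cong′ d λ i j → gradedSum-*ˡ {m} j y _)

  HasOrder : (ℕ → Carrier) → ℕ → Set ℓ
  HasOrder a k = ∀ d → d ℕ.< k → a d ≈ 0#

  order-⋆ : ∀ {a b} k l → HasOrder a k → HasOrder b l → HasOrder (a ⋆ b) (k ℕ.+ l)
  order-⋆ k l oa ob d d<k+l = D-zero d _ vanish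
    where
    vanish : ∀ i j → i ℕ.+ j ≡ d → _ ≈ 0#
    vanish i j e with i ℕₚ.<? k
    ... | yes i<k = trans (*-congʳ (oa i i<k)) (zeroˡ _)
    ... | no i≮k = trans (*-congˡ (ob j j<l)) (zeroʳ _)
      where
      j<l : j ℕ.< l
      j<l = ℕₚ.≰⇒> λ l≤j → ℕₚ.<-irrefl refl (ℕₚ.<-≤-trans d<k+l
        (subst (k ℕ.+ l ℕ.≤_) e (ℕₚ.+-mono-≤ (ℕₚ.≮⇒≥ i≮k) l≤j)))

  order-^ : ∀ {a} n → HasOrder a 1 → HasOrder (RawSemiringDefs._^_ (RawRing.rawSemiring oneVariable) a n) n
  order-^ zero oa d ()
  order-^ (suc n) oa = order-⋆ 1 n oa (order-^ n oa)

  order-^ˢ : ∀ {m} (G : Vector (ℕ → Carrier) m) → (∀ j → HasOrder (G j) 1) → ∀ μ → HasOrder (G ^ˢ μ) (degree μ)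
  order-^ˢ G o [] d ()
  order-^ˢ G o (n ∷ μ) = order-⋆ n (degree μ) (order-^ n (o Fin.zero)) (order-^ˢ (G ∘ Fin.suc) (o ∘ Fin.suc) μ)

  -- The cutoff in `part-compose` varies with d. As the gⱼ(t·x) have no constant term, the product
  -- with exponent μ starts in degree at least `degree μ`; so the cutoff can be raised to N for all
  -- d at once, and the two sums then interchange.
  T-part-compose : ∀ {m k} (x : Vector Carrier k) (f : Series m) (g : Vector (Series k) m) →
    (∀ j → HasOrder (part x (g j)) 1) → ∀ N →
    T (part x (compose f g)) N ≈ sumDegree≤ N (λ μ → f μ * T ((λ j → part x (g j)) ^ˢ μ) N)
  T-part-compose x f g o N = begin
    T (part x (compose f g)) N
      ≈⟨ T-cong N (λ d d≤N → trans (part-compose x f g d) (sym (sumDegree≤-stable _ d≤N λ μ d<μ →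
           trans (*-congˡ (order-^ˢ _ o μ d d<μ)) (zeroʳ _)))) ⟩
    T (λ d → sumDegree≤ N (λ μ → f μ * (G ^ˢ μ) d)) N
      ≈⟨ L-sumDegree≤ (T-additive N) N (λ μ d → f μ * (G ^ˢ μ) d) ⟩
    sumDegree≤ N (λ μ → T (λ d → f μ * (G ^ˢ μ) d) N)
      ≈⟨ sumDegree≤-cong N (λ μ → sym (T-*ˡ (f μ) (G ^ˢ μ) N)) ⟩
    sumDegree≤ N (λ μ → f μ * T (G ^ˢ μ) N) ∎
    where
    G = λ j → part x (g j)
    T-*ˡ : ∀ y a N → y * T a N ≈ T (λ d → y * a d) N
    T-*ˡ y a zero = ≈-refl
    T-*ˡ y a (suc N) = trans (distribˡ _ _ _) (+-congʳ (T-*ˡ y a N))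

-- Valuation estimates and limits.

module Estimates {a b} (F : Field a b) (v : Field.Carrier F → ℚ∞) (isValuation : IsValuation F v) where
  open Field F renaming (refl to ≈-refl) hiding (inverse; sum)
  open Valued F v isValuation
  open Antidiagonal commutativeRing
  open SeriesAlgebra commutativeRing
  open PowerSeries rawRing using (Series; sumDegree≤; var)
  open IntegerSolver commutativeRing

  private
    Conv = _⟶_ F v

  ≼-D : ∀ {q} d {h} → (∀ i j → i ℕ.+ j ≡ d → q ≼ h i j) → q ≼ D d h
  ≼-D zero qh = qh 0 0 refl
  ≼-D (suc d) qh = ≼-+ (qh 0 (suc d) refl) (≼-D d λ i j e → qh (suc i) j (cong suc e))

  ≼-T : ∀ {q a} N → (∀ d → q ≼ a d) → q ≼ T a N
  ≼-T zero qa = qa 0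
  ≼-T (suc N) qa = ≼-+ (≼-T N qa) (qa (suc N))

  ≼-gradedSum : ∀ {q m} d {h : Vec ℕ m → Carrier} → (∀ μ → degree μ ≡ d → q ≼ h μ) →
    q ≼ gradedSum d h
  ≼-gradedSum {m = zero} zero qh = qh [] refl
  ≼-gradedSum {m = zero} (suc d) qh = ≼-0
  ≼-gradedSum {m = suc m} d qh = ≼-D d λ i j i+j≡d →
    ≼-gradedSum {m = m} j λ μ e → qh (i ∷ μ) (≡.trans (cong (i ℕ.+_) e) i+j≡d)

  ≼-sumDegree≤ : ∀ {q m} N {h : Vec ℕ m → Carrier} → (∀ μ → q ≼ h μ) → q ≼ sumDegree≤ N h
  ≼-sumDegree≤ {m = m} N {h} qh = ≼-cong (sym (sumDegree≤≈T {m} N h))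
    (≼-T N λ d → ≼-gradedSum {m = m} d λ μ _ → qh μ)

  sumDegree≤-sub : ∀ {m} N (h k : Vec ℕ m → Carrier) →
    sumDegree≤ N (λ μ → h μ - k μ) ≈ sumDegree≤ N h - sumDegree≤ N k
  sumDegree≤-sub {m} N h k = trans (L-+ (sumDegree≤-additive {m} N) h (λ μ → - k μ))
    (+-congˡ (sym (L-sumDegree≤ neg-additive {m} N (λ μ _ → k μ))))

  ≼-sumDegree≤-sub : ∀ {q m} N {h k : Vec ℕ m → Carrier} → (∀ μ → q ≼ h μ - k μ) →
    q ≼ sumDegree≤ N h - sumDegree≤ N k
  ≼-sumDegree≤-sub {m = m} N {h} {k} qhk = ≼-cong (sumDegree≤-sub {m} N h k) (≼-sumDegree≤ {m = m} N qhk)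

  -- From x y - x′ y′ = x (y - y′) + (x - x′) y′.
  ≼-*-sub : ∀ {p q r x x′ y y′} → p ≼ x → q ≼ y - y′ → r ≼ x - x′ → ∀ {s} → s ≼ y′ →
    ∀ {t} → t ℚ.≤ p ℚ.+ q → t ℚ.≤ r ℚ.+ s → t ≼ x * y - x′ * y′
  ≼-*-sub {x = x} {x′} {y} {y′} px qy rx sy l l′ = ≼-cong
    (solve 4 (λ x x′ y y′ → x :* (y :- y′) :+ (x :- x′) :* y′ := x :* y :- x′ :* y′) ≈-refl x x′ y y′)
    (≼-+ (≼-weaken l (≼-* px qy)) (≼-weaken l′ (≼-* rx sy)))

  ^ᵐ-bound : ∀ {m δ} {x : Vector Carrier m} → (∀ j → δ ≼ x j) → ∀ μ → degree μ • δ ≼ x ^ᵐ μ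
  ^ᵐ-bound δx [] = ≼-1
  ^ᵐ-bound {δ = δ} {x} δx (n ∷ μ) = subst (_≼ x ^ᵐ (n ∷ μ)) (≡.sym (•-homo-+ δ n (degree μ)))
    (≼-* (≼-^ n (δx Fin.zero)) (^ᵐ-bound (δx ∘ Fin.suc) μ))

  Integral : ∀ {m} → Series m → Set
  Integral f = ∀ μ → 0ℚ ≼ f μ

  -- The growth condition satisfied by f(t·x) when f is integral and every v(x j) ≥ δ. It is stable
  -- under products and under substitution into integral series, and for δ > 0 it forces convergence
  -- of the tails.
  Bounded : ℚ → (ℕ → Carrier) → Set
  Bounded δ a = ∀ d → d • δ ≼ a d

  weight-bound : ∀ {m δ} {x : Vector Carrier m} {f : Series m} → Integral f → (∀ j → δ ≼ x j) →
    ∀ μ → degree μ • δ ≼ weight x f μ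
  weight-bound int δx μ = ≼-*ˡ (int μ) (^ᵐ-bound δx μ)

  part-bounded : ∀ {m δ} {x : Vector Carrier m} {f : Series m} → Integral f → (∀ j → δ ≼ x j) →
    Bounded δ (part x f)
  part-bounded {m} {δ} {x} {f} int δx d = ≼-gradedSum {m = m} d λ μ e →
    subst (λ k → k • δ ≼ weight x f μ) e (weight-bound int δx μ)

  var-integral : ∀ {m} (i : Fin m) → Integral (var i)
  var-integral i μ with Vecₚ.≡-dec ℕₚ._≟_ μ (unit i)
  ... | yes _ = ≼-1
  ... | no _ = ≼-0

  ⋆-bounded : ∀ {δ a b} → Bounded δ a → Bounded δ b → Bounded δ (a ⋆ b)
  ⋆-bounded {δ} {a} {b} δa δb d = ≼-D d λ i j e →
    subst (_≼ a i * b j) (≡.trans (≡.sym (•-homo-+ δ i j)) (cong (_• δ) e)) (≼-* (δa i) (δb j))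

  δ₀-bounded : ∀ {δ} → Bounded δ δ₀
  δ₀-bounded zero = ≼-1
  δ₀-bounded (suc d) = ≼-0

  infixr 8 _^⋆_
  _^⋆_ : (ℕ → Carrier) → ℕ → ℕ → Carrier
  _^⋆_ = RawSemiringDefs._^_ (RawRing.rawSemiring oneVariable)

  ^⋆-bounded : ∀ {δ a} → Bounded δ a → ∀ n → Bounded δ (a ^⋆ n)
  ^⋆-bounded δa zero = δ₀-bounded
  ^⋆-bounded δa (suc n) = ⋆-bounded δa (^⋆-bounded δa n)

  ^ˢ-bounded : ∀ {m δ} {G : Vector (ℕ → Carrier) m} → (∀ j → Bounded δ (G j)) → ∀ μ → Bounded δ (G ^ˢ μ)
  ^ˢ-bounded δG [] = δ₀-bounded
  ^ˢ-bounded δG (n ∷ μ) = ⋆-bounded (^⋆-bounded (δG Fin.zero) n) (^ˢ-bounded (δG ∘ Fin.suc) μ)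

  part-compose-bounded : ∀ {m k δ} {x : Vector Carrier k} {f : Series m} {g : Vector (Series k) m} →
    Integral f → (∀ j → Bounded δ (part x (g j))) → Bounded δ (part x (compose f g))
  part-compose-bounded {m} {x = x} {f} {g} int δg d = ≼-cong (sym (part-compose x f g d))
    (≼-sumDegree≤ {m = m} d λ μ → ≼-*ˡ (int μ) (^ˢ-bounded δg μ d))

  module _ {δ : ℚ} (0≤δ : 0ℚ ℚ.≤ δ) where

    bounded-integral : ∀ {a} → Bounded δ a → ∀ d → 0ℚ ≼ a d
    bounded-integral δa d = ≼-weaken (•-nonneg d 0≤δ) (δa d)

    T-tail : ∀ {a} → Bounded δ a → ∀ {M N} → M ℕ.≤′ N → suc M • δ ≼ T a N - T a M
    T-tail {a} δa {M} ℕ.≤′-refl = ≼-≈0 (-‿inverseʳ (T a M))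
    T-tail {a} δa {M} (ℕ.≤′-step {N} le) = ≼-cong
      (solve 3 (λ s t u → (s :- t) :+ u := (s :+ u) :- t) ≈-refl (T a N) (T a M) (a (suc N)))
      (≼-+ (T-tail δa le) (≼-weaken (•-monoˡ {δ} {suc M} {suc N} 0≤δ (ℕ.s≤s (ℕₚ.≤′⇒≤ le))) (δa (suc N))))

    -- The product of the truncations contains in addition the terms a i · b p with i, p ≤ N < i +
    -- p. They are collected as a i times the tail of b after t = N - i, of valuation at least i δ +
    -- (t + 1) δ = (N + 1) δ.
    T-⋆ : ∀ {a b} → Bounded δ a → Bounded δ b → ∀ N → suc N • δ ≼ T (a ⋆ b) N - T a N * T b N
    T-⋆ {a} {b} δa δb N = ≼-swap (T a N * T b N) (T (a ⋆ b) N) (≼-cong difference (≼-D N term))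
      where
      open SetoidReasoning setoid
      difference : D N (λ i t → a i * (T b N - T b t)) ≈ T a N * T b N - T (a ⋆ b) N
      difference = begin
        D N (λ i t → a i * (T b N - T b t))
          ≈⟨ D-cong′ N (λ i t → solve 3 (λ a b c → a :* (b :- c) := a :* b :+ (:- :1) :* (a :* c)) ≈-refl (a i) (T b N) (T b t)) ⟩
        D N (λ i t → a i * T b N + - 1# * (a i * T b t)) ≈⟨ D-+ N _ _ ⟩
        D N (λ i t → a i * T b N) + D N (λ i t → - 1# * (a i * T b t))
          ≈⟨ +-cong (sym (D-* N (T b N) _)) (sym (*-D N (- 1#) _)) ⟩
        D N (λ i t → a i) * T b N + - 1# * D N (λ i t → a i * T b t)
          ≈⟨ +-cong (*-congʳ (sym (T≈D a N))) (*-congˡ (D-cong′ N λ i t → trans (*-congˡ (T≈D b t)) (*-D t (a i) _))) ⟩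
        T a N * T b N + - 1# * D N (λ i t → D t (λ p r → a i * b p))
          ≈⟨ +-congˡ (*-congˡ (D-assoc N λ i p r → a i * b p)) ⟨
        T a N * T b N + - 1# * D N (λ s r → D s (λ i p → a i * b p))
          ≈⟨ +-congˡ (*-congˡ (T≈D (a ⋆ b) N)) ⟨
        T a N * T b N + - 1# * T (a ⋆ b) N
          ≈⟨ solve 2 (λ x y → x :+ (:- :1) :* y := x :- y) ≈-refl _ _ ⟩
        T a N * T b N - T (a ⋆ b) N ∎
      term : ∀ i t → i ℕ.+ t ≡ N → suc N • δ ≼ a i * (T b N - T b t)
      term i t e = subst (_≼ a i * (T b N - T b t))
        (≡.trans (≡.sym (•-homo-+ δ i (suc t))) (cong (_• δ) (≡.trans (ℕₚ.+-suc i t) (cong suc e))))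
        (≼-* (δa i) (T-tail δb (ℕₚ.≤⇒≤′ (subst (t ℕ.≤_) e (ℕₚ.m≤n+m t i)))))

    ≼-mod-* : ∀ {q x x′ y y′} → 0ℚ ≼ x → q ≼ y - y′ → q ≼ x - x′ → 0ℚ ≼ y′ → q ≼ x * y - x′ * y′
    ≼-mod-* {q} {x} {x′} {y} {y′} ox qy qx oy = ≼-*-sub {x = x} {x′} {y} {y′} ox qy qx oy
      (ℚₚ.≤-reflexive (≡.sym (ℚₚ.+-identityˡ q))) (ℚₚ.≤-reflexive (≡.sym (ℚₚ.+-identityʳ q)))

    T-δ₀ : ∀ N → T δ₀ N ≈ 1#
    T-δ₀ N = T-stable δ₀ (ℕₚ.≤⇒≤′ (ℕ.z≤n {N})) λ { (suc d) _ → ≈-refl }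

    T-integral : ∀ {a} → Bounded δ a → ∀ N → 0ℚ ≼ T a N
    T-integral δa N = ≼-T N (bounded-integral δa)

    T-^⋆ : ∀ {a} → Bounded δ a → ∀ n N → suc N • δ ≼ T (a ^⋆ n) N - T a N ^ n
    T-^⋆ δa zero N = ≼-≈0 (trans (+-congʳ (T-δ₀ N)) (-‿inverseʳ 1#))
    T-^⋆ {a} δa (suc n) N = ≼-triangle (T (a ^⋆ suc n) N) (T a N * T (a ^⋆ n) N) (T a N ^ suc n)
      (T-⋆ δa (^⋆-bounded δa n) N)
      (≼-mod-* {x = T a N} {T a N} {T (a ^⋆ n) N} {T a N ^ n} (T-integral δa N) (T-^⋆ δa n N) (≼-≈0 (-‿inverseʳ _))
        (integral-^ n (T-integral δa N)))

    T-^ˢ : ∀ {m} {G : Vector (ℕ → Carrier) m} → (∀ j → Bounded δ (G j)) → ∀ μ N →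
      suc N • δ ≼ T (G ^ˢ μ) N - (λ j → T (G j) N) ^ᵐ μ
    T-^ˢ δG [] N = ≼-≈0 (trans (+-congʳ (T-δ₀ N)) (-‿inverseʳ 1#))
    T-^ˢ {suc m} {G} δG (n ∷ μ) N = ≼-triangle (T (G ^ˢ (n ∷ μ)) N)
      (T (G Fin.zero ^⋆ n) N * T (G′ ^ˢ μ) N) ((λ j → T (G j) N) ^ᵐ (n ∷ μ))
      (T-⋆ (^⋆-bounded (δG Fin.zero) n) (^ˢ-bounded (δG ∘ Fin.suc) μ) N)
      (≼-mod-* {x = T (G Fin.zero ^⋆ n) N} {T (G Fin.zero) N ^ n} {T (G′ ^ˢ μ) N} {(λ j → T (G′ j) N) ^ᵐ μ}
        (T-integral (^⋆-bounded (δG Fin.zero) n) N)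
        (T-^ˢ (δG ∘ Fin.suc) μ N) (T-^⋆ (δG Fin.zero) n N)
        (≼-weaken (•-nonneg (degree μ) ℚₚ.≤-refl) (^ᵐ-bound (λ j → T-integral (δG (Fin.suc j)) N) μ)))
      where
      G′ = G ∘ Fin.suc

    partial : ∀ {m} → Series m → Vector Carrier m → ℕ → Carrier
    partial f x N = sumDegree≤ N (weight x f)

    -- By `T-part-compose` both sides are sums over the same μ, and `T-^ˢ` says that truncating a
    -- product of the gⱼ(t·x) or multiplying their truncations is the same up to valuation (N + 1)
    -- δ.
    compose-estimate : ∀ {m k} {x : Vector Carrier k} {f : Series m} {g : Vector (Series k) m} →
      Integral f → (∀ j → HasOrder (part x (g j)) 1) → (∀ j → Bounded δ (part x (g j))) → ∀ N →
      suc N • δ ≼ T (part x (compose f g)) N - partial f (λ j → T (part x (g j)) N) N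
    compose-estimate {m} {x = x} {f} {g} int order δg N = ≼-cong
      (+-congʳ (sym (T-part-compose x f g order N)))
      (≼-sumDegree≤-sub {m = m} N λ μ → ≼-cong
        (solve 3 (λ f a b → f :* (a :- b) := f :* a :- f :* b) ≈-refl (f μ) _ _)
        (≼-*ˡ (int μ) (T-^ˢ δg μ N)))

  module _ {δ : ℚ} (0≤δ : 0ℚ ℚ.≤ δ) {γ : ℚ} where

    -- Here γ is the excess of the bound on x - y over the bound δ on x and y; it may be negative.
    -- It survives because x^n - y^n is x - y times a form of degree n - 1 in x and y.
    ^-difference : ∀ {x y} → δ ≼ x → δ ≼ y → γ ℚ.+ δ ≼ x - y → ∀ n → γ ℚ.+ n • δ ≼ x ^ n - y ^ n
    ^-difference {x} {y} δx δy d zero = ≼-≈0 (-‿inverseʳ 1#)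
    ^-difference {x} {y} δx δy d (suc n) = ≼-*-sub {x = x} {y} {x ^ n} {y ^ n} δx (^-difference δx δy d n) d (≼-^ n δy)
      (ℚₚ.≤-reflexive (≡.trans (≡.sym (ℚₚ.+-assoc γ δ (n • δ))) (≡.trans (cong (ℚ._+ n • δ) (ℚₚ.+-comm γ δ)) (ℚₚ.+-assoc δ γ (n • δ)))))
      (ℚₚ.≤-reflexive (≡.sym (ℚₚ.+-assoc γ δ (n • δ))))

    ^ᵐ-difference : ∀ {m} {x y : Vector Carrier m} → (∀ j → δ ≼ x j) → (∀ j → δ ≼ y j) →
      (∀ j → γ ℚ.+ δ ≼ x j - y j) → ∀ μ → γ ℚ.+ degree μ • δ ≼ x ^ᵐ μ - y ^ᵐ μ
    ^ᵐ-difference δx δy d [] = ≼-≈0 (-‿inverseʳ 1#)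
    ^ᵐ-difference {x = x} {y} δx δy d (n ∷ μ) = ≼-*-sub
      {x = x Fin.zero ^ n} {y Fin.zero ^ n} {(x ∘ Fin.suc) ^ᵐ μ} {(y ∘ Fin.suc) ^ᵐ μ}
      (≼-^ n (δx Fin.zero)) (^ᵐ-difference (δx ∘ Fin.suc) (δy ∘ Fin.suc) (d ∘ Fin.suc) μ)
      (^-difference (δx Fin.zero) (δy Fin.zero) (d Fin.zero) n) (^ᵐ-bound (δy ∘ Fin.suc) μ)
      (ℚₚ.≤-reflexive (≡.trans (cong (γ ℚ.+_) (•-homo-+ δ n (degree μ)))
        (≡.trans (≡.sym (ℚₚ.+-assoc γ (n • δ) (degree μ • δ)))
        (≡.trans (cong (ℚ._+ degree μ • δ) (ℚₚ.+-comm γ (n • δ))) (ℚₚ.+-assoc (n • δ) γ (degree μ • δ))))))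
      (ℚₚ.≤-reflexive (≡.trans (cong (γ ℚ.+_) (•-homo-+ δ n (degree μ)))
        (≡.sym (ℚₚ.+-assoc γ (n • δ) (degree μ • δ)))))

    -- Only monomials of degree at least k occur, and each adds its degree times δ to the excess γ.
    -- The case k = 1 is continuity of f, the case k = 2 controls the non-linear part of the group
    -- law.
    partial-difference : ∀ {m} {x y : Vector Carrier m} {f : Series m} → Integral f →
      (∀ j → δ ≼ x j) → (∀ j → δ ≼ y j) → (∀ j → γ ℚ.+ δ ≼ x j - y j) →
      ∀ k → (∀ μ → degree μ ℕ.< k → f μ ≈ 0#) → ∀ N →
      γ ℚ.+ k • δ ≼ sumDegree≤ N (weight x f) - sumDegree≤ N (weight y f)
    partial-difference {m} {x} {y} {f} int δx δy d k f≈0 N = ≼-sumDegree≤-sub {m = m} N term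
      where
      term : ∀ μ → γ ℚ.+ k • δ ≼ weight x f μ - weight y f μ
      term μ with degree μ ℕₚ.<? k
      ... | yes lt = ≼-≈0 (trans (+-cong (trans (*-congʳ (f≈0 μ lt)) (zeroˡ _))
              (-‿cong (trans (*-congʳ (f≈0 μ lt)) (zeroˡ _)))) (-‿inverseʳ 0#))
      ... | no ≮ = ≼-cong (solve 3 (λ f a b → f :* (a :- b) := f :* a :- f :* b) ≈-refl (f μ) _ _)
              (≼-*ˡ (int μ) (≼-weaken (ℚₚ.+-monoʳ-≤ γ (•-monoˡ {δ} {k} {degree μ} 0≤δ (ℕₚ.≮⇒≥ ≮))) (^ᵐ-difference δx δy d μ)))

  Null : (ℕ → Carrier) → Set
  Null s = ∀ (q : ℚ) → Σ ℕ λ M → ∀ N → M ℕ.≤ N → q ≼ s N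

  limit-transfer : ∀ {s s′ z} → Null (λ N → s N - s′ N) → Conv s z → Conv s′ z
  limit-transfer {s} {s′} {z} n c q with n q | c q
  ... | M , h | M′ , h′ = M ℕ.⊔ M′ , λ N le → ≼-triangle (s′ N) (s N) z
    (≼-swap (s N) (s′ N) (h N (ℕₚ.≤-trans (ℕₚ.m≤m⊔n M M′) le))) (h′ N (ℕₚ.≤-trans (ℕₚ.m≤n⊔m M M′) le))

  limit-≈ : ∀ {s s′ z} → (∀ N → s N ≈ s′ N) → Conv s z → Conv s′ z
  limit-≈ {s} {s′} eq c q with c q
  ... | M , h = M , λ N le → ≼-cong (+-congʳ (eq N)) (h N le)

  limit-difference-bound : ∀ {s s′ z z′ q} c → (∀ N → 1 ℕ.≤ N → q ≼ (s N - s′ N) - c) →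
    Conv s z → Conv s′ z′ → q ≼ (z - z′) - c
  limit-difference-bound {s} {s′} {z} {z′} {q} c b l l′ with l q | l′ q
  ... | M , h | M′ , h′ = ≼-cong
    (solve 5 (λ s s′ z z′ c → ((s :- s′) :- c) :- (s :- z) :+ (s′ :- z′) := (z :- z′) :- c) ≈-refl (s N) (s′ N) z z′ c)
    (≼-+ (≼-sub (b N (ℕ.s≤s ℕ.z≤n)) (h N (ℕₚ.m≤n⇒m≤1+n (ℕₚ.m≤m⊔n M M′)))) (h′ N (ℕₚ.m≤n⇒m≤1+n (ℕₚ.m≤n⊔m M M′))))
    where N = suc (M ℕ.⊔ M′)

  limit-bound : ∀ {s z q} → (∀ N → q ≼ s N) → Conv s z → q ≼ z
  limit-bound {s} {z} {q} qs l with l q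
  ... | M , h = ≼-recover z (s M) (≼-swap (s M) z (h M ℕₚ.≤-refl)) (qs M)

  null-multiples : ∀ {δ} → 0ℚ ℚ.< δ → ∀ {s} → (∀ N → suc N • δ ≼ s N) → Null s
  null-multiples {δ} 0<δ b q = proj₁ bound , λ N M≤N → ≼-weaken (ℚₚ.≤-trans (proj₂ bound)
    (•-monoˡ {δ} {proj₁ bound} {suc N} (ℚₚ.<⇒≤ 0<δ) (ℕₚ.m≤n⇒m≤1+n M≤N))) (b N)
    where bound = archimedean 0<δ q

  eventually-all : ∀ {n p} {P : Fin n → ℕ → Set p} → (∀ j → Σ ℕ λ M → ∀ N → M ℕ.≤ N → P j N) →
    Σ ℕ λ M → ∀ N → M ℕ.≤ N → ∀ j → P j N
  eventually-all {zero} e = 0 , λ N _ ()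
  eventually-all {suc n} e with e Fin.zero | eventually-all (e ∘ Fin.suc)
  ... | M , h | M′ , h′ = M ℕ.⊔ M′ , λ
    { N le Fin.zero → h N (ℕₚ.≤-trans (ℕₚ.m≤m⊔n M M′) le)
    ; N le (Fin.suc j) → h′ N (ℕₚ.≤-trans (ℕₚ.m≤n⊔m M M′) le) j }

  part-constant : ∀ {m} {x : Vector Carrier m} {f : Series m} → (∀ μ → degree μ ℕ.< 1 → f μ ≈ 0#) →
    HasOrder (part x f) 1
  part-constant {m} {f = f} f≈0 d d<1 = gradedSum-zero {m} d _ λ μ e →
    trans (*-congʳ (f≈0 μ (subst (ℕ._< 1) (≡.sym e) d<1))) (zeroˡ _)

  var-constant : ∀ {m} (i : Fin m) → ∀ {x : Vector Carrier m} → HasOrder (part x (var i)) 1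
  var-constant i {x} zero _ = part-var-≢ x i 0 λ ()
  var-constant i {x} (suc d) (ℕ.s≤s ())

  T-bound : ∀ {δ} → 0ℚ ℚ.≤ δ → ∀ {a} → HasOrder a 1 → Bounded δ a → ∀ N → δ ≼ T a N
  T-bound {δ} 0≤δ {a} o δa N = ≼-T N term
    where
    term : ∀ d → δ ≼ a d
    term zero = ≼-≈0 (o 0 (ℕ.s≤s ℕ.z≤n))
    term (suc d) = ≼-weaken (subst (ℚ._≤ suc d • δ) (•-homo-1 δ) (•-monoˡ {δ} {1} {suc d} 0≤δ (ℕ.s≤s ℕ.z≤n))) (δa (suc d))

  -- Two errors add up: the truncation error of `compose-estimate`, and the replacement of the
  -- partial sums of gⱼ by their limits inside f. For the latter, γ = q - δ in `partial-difference`
  -- with k = 1 gives exactly the bound q.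
  compose-null : ∀ {δ} → 0ℚ ℚ.< δ → ∀ {m k} {x : Vector Carrier k} {f : Series m} {g : Vector (Series k) m} →
    Integral f → (∀ μ → degree μ ℕ.< 1 → f μ ≈ 0#) →
    (∀ j → HasOrder (part x (g j)) 1) → (∀ j → Bounded δ (part x (g j))) →
    ∀ {y} → (∀ j → Conv (T (part x (g j))) (y j)) →
    Null (λ N → T (part x (compose f g)) N - sumDegree≤ N (weight y f))
  compose-null {δ} 0<δ {m} {k} {x} {f} {g} int f≈0 order δg {y} conv q = M ℕ.⊔ M′ , λ N le →
    ≼-triangle (T (part x (compose f g)) N) (sumDegree≤ N (weight (λ j → T (part x (g j)) N) f)) (sumDegree≤ N (weight y f))
      (proj₂ small N (ℕₚ.≤-trans (ℕₚ.m≤m⊔n M M′) le))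
      (subst (_≼ sumDegree≤ N (weight (λ j → T (part x (g j)) N) f) - sumDegree≤ N (weight y f)) γ+1δ
        (partial-difference 0≤δ {q ℚ.- δ} int (λ j → T-bound 0≤δ (order j) (δg j) N)
        (λ j → limit-bound (T-bound 0≤δ (order j) (δg j)) (conv j))
        (λ j → subst (_≼ T (part x (g j)) N - y j) (≡.sym γ+δ) (proj₂ near N (ℕₚ.≤-trans (ℕₚ.m≤n⊔m M M′) le) j)) 1 f≈0 N))
    where
    0≤δ = ℚₚ.<⇒≤ 0<δ
    small = null-multiples 0<δ (compose-estimate 0≤δ {f = f} {g} int order δg) q
    near = eventually-all λ j → conv j q
    M = proj₁ small
    M′ = proj₁ near
    γ+δ : q ℚ.- δ ℚ.+ δ ≡ q
    γ+δ = ≡.trans (ℚₚ.+-assoc q (ℚ.- δ) δ) (≡.trans (cong (q ℚ.+_) (ℚₚ.+-inverseˡ δ)) (ℚₚ.+-identityʳ q))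
    γ+1δ : q ℚ.- δ ℚ.+ 1 • δ ≡ q
    γ+1δ = ≡.trans (cong (q ℚ.- δ ℚ.+_) (•-homo-1 δ)) γ+δ

-- Ring homomorphisms and series.

module RingHomomorphism {c₁ ℓ₁ c₂ ℓ₂} (R : CommutativeRing c₁ ℓ₁) (S : CommutativeRing c₂ ℓ₂)
  (φ : CommutativeRing.Carrier R → CommutativeRing.Carrier S)
  (hom : RingMorphisms.IsRingHomomorphism (CommutativeRing.rawRing R) (CommutativeRing.rawRing S) φ) where
  private
    module R = CommutativeRing R
    module R′ = RawSemiringDefs (RawRing.rawSemiring R.rawRing)
    module PR = PowerSeries R.rawRing
    module FR = FormalGroup R.rawRing
  open CommutativeRing S renaming (refl to ≈-refl)
  private
    module S′ = RawSemiringDefs (RawRing.rawSemiring rawRing)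
    module PS = PowerSeries rawRing
    module FS = FormalGroup rawRing
    module AS = Antidiagonal S
    module SS = SeriesAlgebra S
  open RingMorphisms.IsRingHomomorphism hom public
    using (⟦⟧-cong; +-homo; *-homo; 0#-homo; 1#-homo; -‿homo)

  sub-homo : ∀ x y → φ (x R.- y) ≈ φ x - φ y
  sub-homo x y = trans (+-homo x (R.- y)) (+-congˡ (-‿homo y))

  sum-homo : ∀ {n} (f : Fin n → R.Carrier) → φ (R′.sum f) ≈ S′.sum (φ ∘ f)
  sum-homo {zero} f = 0#-homo
  sum-homo {suc n} f = trans (+-homo _ _) (+-congˡ (sum-homo (f ∘ Fin.suc)))

  ^-homo : ∀ x n → φ (x R′.^ n) ≈ φ x S′.^ n
  ^-homo x zero = 1#-homo
  ^-homo x (suc n) = trans (*-homo _ _) (*-congˡ (^-homo x n))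

  monomial-homo : ∀ {m} (x : Vector R.Carrier m) μ →
    φ (monomial R.rawRing x μ) ≈ monomial rawRing (φ ∘ x) μ
  monomial-homo x [] = 1#-homo
  monomial-homo x (n ∷ μ) = trans (*-homo _ _) (*-cong (^-homo _ n) (monomial-homo (x ∘ Fin.suc) μ))

  sumDegree≤-homo : ∀ {m} N (f : Vec ℕ m → R.Carrier) → φ (PR.sumDegree≤ N f) ≈ PS.sumDegree≤ N (φ ∘ f)
  sumDegree≤-homo {zero} N f = ≈-refl
  sumDegree≤-homo {suc m} N f = trans (sum-homo {suc N} λ i → PR.sumDegree≤ (N ℕ.∸ toℕ i) λ μ → f (toℕ i ∷ μ))
    (AS.sum-cong {suc N} {λ i → φ (PR.sumDegree≤ (N ℕ.∸ toℕ i) λ μ → f (toℕ i ∷ μ))}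
      {λ i → PS.sumDegree≤ (N ℕ.∸ toℕ i) λ μ → φ (f (toℕ i ∷ μ))}
      λ i → sumDegree≤-homo {m} (N ℕ.∸ toℕ i) λ μ → f (toℕ i ∷ μ))

  sumBelow-homo : ∀ {m} (ν : Vec ℕ m) (f : Vec ℕ m → R.Carrier) → φ (PR.sumBelow ν f) ≈ PS.sumBelow ν (φ ∘ f)
  sumBelow-homo [] f = ≈-refl
  sumBelow-homo (k ∷ ν) f = trans (sum-homo {suc k} λ i → PR.sumBelow ν λ μ → f (toℕ i ∷ μ))
    (AS.sum-cong {suc k} {λ i → φ (PR.sumBelow ν λ μ → f (toℕ i ∷ μ))} {λ i → PS.sumBelow ν λ μ → φ (f (toℕ i ∷ μ))}
      λ i → sumBelow-homo ν λ μ → f (toℕ i ∷ μ))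

  product-homo : ∀ {m} (f g : PR.Series m) ν →
    φ (RawRing._*_ (PR.rawRing m) f g ν) ≈ ((φ ∘ f) SS.⊛ (φ ∘ g)) ν
  product-homo f g ν = trans (sumBelow-homo ν _) (SS.sumBelow-cong ν λ μ → *-homo _ _)

  var-homo : ∀ {m} (i : Fin m) ν → φ (PR.var i ν) ≈ PS.var i ν
  var-homo {m} i ν with Vecₚ.≡-dec ℕₚ._≟_ ν (Vec.replicate m 0 Vec.[ i ]≔ 1)
  ... | yes _ = 1#-homo
  ... | no _ = 0#-homo

  one-homo : ∀ {m} ν → φ (RawRing.1# (PR.rawRing m) ν) ≈ SS.one ν
  one-homo {m} ν with Vecₚ.≡-dec ℕₚ._≟_ ν (Vec.replicate m 0)
  ... | yes _ = 1#-homo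
  ... | no _ = 0#-homo

  series-^-homo : ∀ {k} (g : PR.Series k) n ν →
    φ (RawSemiringDefs._^_ (RawRing.rawSemiring (PR.rawRing k)) g n ν) ≈
    RawSemiringDefs._^_ (RawRing.rawSemiring (PS.rawRing k)) (φ ∘ g) n ν
  series-^-homo g zero ν = one-homo ν
  series-^-homo {k} g (suc n) ν = trans
    (product-homo g (RawSemiringDefs._^_ (RawRing.rawSemiring (PR.rawRing k)) g n) ν) (SS.⊛-cong (λ _ → ≈-refl) (series-^-homo g n) ν)

  series-monomial-homo : ∀ {m k} (g : Vector (PR.Series k) m) μ ν →
    φ (monomial (PR.rawRing k) g μ ν) ≈ monomial (PS.rawRing k) (λ j → φ ∘ g j) μ ν
  series-monomial-homo g [] ν = one-homo ν
  series-monomial-homo {k = k} g (n ∷ μ) ν = trans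
    (product-homo (RawSemiringDefs._^_ (RawRing.rawSemiring (PR.rawRing k)) (g Fin.zero) n)
      (monomial (PR.rawRing k) (g ∘ Fin.suc) μ) ν)
    (SS.⊛-cong (series-^-homo (g Fin.zero) n) (series-monomial-homo (g ∘ Fin.suc) μ) ν)

  -- The formal group laws are identities of series over K; this carries them to K̄, where the
  -- points live.
  compose-homo : ∀ {m k} (f : PR.Series m) (g : Vector (PR.Series k) m) ν →
    φ (FR.subst f g ν) ≈ SS.compose (φ ∘ f) (λ j → φ ∘ g j) ν
  compose-homo {m} f g ν = trans (sumDegree≤-homo {m} (degree ν) _)
    (SS.sumDegree≤-cong {m} (degree ν) λ μ → trans (*-homo _ _) (*-congˡ (series-monomial-homo g μ ν)))

-- The group of points.

++-pointwise : ∀ {a b p} {A : Set a} {B : Set b} (P : A → B → Set p) {m n} {u : Vector A m} {u′ : Vector B m}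
  {w : Vector A n} {w′ : Vector B n} → (∀ j → P (u j) (u′ j)) → (∀ j → P (w j) (w′ j)) →
  ∀ k → P ((u ++ w) k) ((u′ ++ w′) k)
++-pointwise P {m} l r k with splitAt m k
... | inj₁ j = l j
... | inj₂ j = r j

++-all : ∀ {a p} {A : Set a} (P : A → Set p) {m n} {u : Vector A m} {w : Vector A n} →
  (∀ j → P (u j)) → (∀ j → P (w j)) → ∀ k → P ((u ++ w) k)
++-all P {u = u} {w} l r = ++-pointwise (λ x _ → P x) {u = u} {u} {w} {w} l r

module PointGroup {ℓ : ℕ} {a b : Level} (E : UnramifiedExtension ℓ a b) {n : ℕ}
  (𝓕 : Theory.CommutativeFormalGroupLaw𝒪 E n) where
  open UnramifiedExtension E
  open Theory E
  open CommutativeFormalGroupLaw𝒪 𝓕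
  open GroupOfPoints 𝓕
  open K̄ using (Carrier; _≈_; _+_; _*_; _-_; -_; 0#; 1#; trans; sym; +-cong; +-congˡ; +-congʳ; -‿cong; -‿inverseʳ;
    *-congˡ; *-congʳ; *-cong; setoid) renaming (refl to ≈-refl)
  open Valued K̄ v isValuation
  open Antidiagonal K̄.commutativeRing
  open SeriesAlgebra K̄.commutativeRing
  open Estimates K̄ v isValuation
  open IntegerSolver K̄.commutativeRing
  open PowerSeries K̄.rawRing using (sumDegree≤; var)
  module PK = PowerSeries K.rawRing
  module FK = FormalGroup K.rawRing
  module IsF = FK.IsCommutativeFormalGroupLaw isCommutativeFormalGroupLaw
  module ι = RingHomomorphism K.commutativeRing K̄.commutativeRing ι (Embedding.isRingHomomorphism K→K̄)

  private
    Conv = _⟶_ K̄ v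

  f : Fin n → Vec ℕ (n ℕ.+ n) → Carrier
  f i μ = ι (F i μ)

  linear-part : ∀ i μ → degree μ ℕ.< 2 → f i μ ≈ var (i ↑ˡ n) μ + var (n ↑ʳ i) μ
  linear-part i μ lt = trans (ι.⟦⟧-cong (IsF.linear i μ lt)) (trans (ι.+-homo _ _)
    (+-cong (ι.var-homo (i ↑ˡ n) μ) (ι.var-homo (n ↑ʳ i) μ)))

  var-constant-coefficient : ∀ {m} (i : Fin m) μ → degree μ ℕ.< 1 → var i μ ≈ 0#
  var-constant-coefficient i μ lt = single-≢ (unit i) μ λ { refl → ℕₚ.<-irrefl (degree-unit i) lt }

  constant-part : ∀ i μ → degree μ ℕ.< 1 → f i μ ≈ 0#
  constant-part i μ lt = trans (linear-part i μ (ℕₚ.m≤n⇒m≤1+n lt))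
    (trans (+-cong (var-constant-coefficient (i ↑ˡ n) μ lt) (var-constant-coefficient (n ↑ʳ i) μ lt)) (K̄.+-identityʳ 0#))

  -- Says that g(x) = y, together with the conditions on g(t·x) that make the relation stable under
  -- substitution into `F i`.
  record Represents {m} (δ : ℚ) (x : Vector Carrier m) (g : PK.Series m) (y : Carrier) : Set (a ⊔ b) where
    field
      order : HasOrder (part x (ι ∘ g)) 1
      bound : Bounded δ (part x (ι ∘ g))
      limit : Conv (T (part x (ι ∘ g))) y

  open Represents

  var-represents : ∀ {m δ} {x : Vector Carrier m} → (∀ j → δ ≼ x j) → ∀ i → Represents δ x (PK.var i) (x i)
  var-represents {x = x} δx i = record
    { order = λ d d<1 → trans (ι-part d) (var-constant i d d<1)
    ; bound = λ d → ≼-cong (sym (ι-part d)) (part-bounded (var-integral i) δx d)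
    ; limit = λ q → 1 , λ N le → ≼-≈0 (trans (+-congʳ (trans (T-cong N λ d _ → ι-part d) (T-part-var x i N le))) (-‿inverseʳ (x i)))
    }
    where
    ι-part : ∀ d → part x (ι ∘ PK.var i) d ≈ part x (var i) d
    ι-part = part-cong x (ι.var-homo i)

  module _ {δ : ℚ} (0<δ : 0ℚ ℚ.< δ) {k} {x : Vector Carrier k} {g : Vector (PK.Series k) (n ℕ.+ n)}
    {y : Vector Carrier (n ℕ.+ n)} (g↦y : ∀ j → Represents δ x (g j) (y j)) (i : Fin n) where

    private
      Φ : ℕ → Carrier
      Φ = part x (ι ∘ FK.subst (F i) g)

      ι-part : ∀ d → Φ d ≈ part x (compose (f i) (λ j → ι ∘ g j)) d
      ι-part = part-cong x (ι.compose-homo (F i) g)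

      null : Null (λ N → T Φ N - partialSum (F i) y N)
      null q = proj₁ base , λ N le → ≼-cong (+-congʳ (T-cong N λ d _ → sym (ι-part d))) (proj₂ base N le)
        where base = compose-null 0<δ {f = f i} {λ j → ι ∘ g j} (integral i) (constant-part i)
                (order ∘ g↦y) (bound ∘ g↦y) {y} (limit ∘ g↦y) q

    compose-represents : ∀ {z} → Conv (partialSum (F i) y) z → Represents δ x (FK.subst (F i) g) z
    compose-represents c = record
      { order = λ d d<1 → trans (ι-part d) (order₁ d d<1)
      ; bound = λ d → ≼-cong (sym (ι-part d)) (part-compose-bounded {f = f i} {λ j → ι ∘ g j} (integral i) (bound ∘ g↦y) d)
      ; limit = limit-transfer (λ q → proj₁ (null q) , λ N le → ≼-swap (T Φ N) (partialSum (F i) y N) (proj₂ (null q) N le)) c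
      }
      where
      order₁ : HasOrder (part x (compose (f i) (λ j → ι ∘ g j))) 1
      order₁ zero _ = trans (part-compose x (f i) (λ j → ι ∘ g j) 0) (trans (sumDegree≤≈T {n ℕ.+ n} 0 _)
        (gradedSum-zero {n ℕ.+ n} 0 _ λ μ e → trans (*-congʳ (constant-part i μ (ℕ.s≤s (ℕₚ.≤-reflexive e)))) (K̄.zeroˡ _)))
      order₁ (suc d) (ℕ.s≤s ())

    -- Converse to `compose-represents`: if the composed series has a sum, so does `F i` at y. This
    -- is how the other side of a formal group law is shown to converge.
    compose-limit : ∀ {z} → Conv (T Φ) z → Conv (partialSum (F i) y) z
    compose-limit = limit-transfer null

  common-bound : ∀ {m} (x : Vector Carrier m) → (∀ j → 0ℚ ≺ x j) → ∃ λ δ → 0ℚ ℚ.< δ × ∀ j → δ ≼ x j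
  common-bound {zero} x pos = 1ℚ , 0<1 , λ ()
  common-bound {suc m} x pos with ≺-witness {x = x Fin.zero} (pos Fin.zero) | common-bound (x ∘ Fin.suc) (pos ∘ Fin.suc)
  ... | p , 0<p , px | δ , 0<δ , δx with ℚₚ.≤-total p δ
  ... | inj₁ p≤δ = p , 0<p , λ { Fin.zero → px ; (Fin.suc j) → ≼-weaken p≤δ (δx j) }
  ... | inj₂ δ≤p = δ , 0<δ , λ { Fin.zero → ≼-weaken δ≤p px ; (Fin.suc j) → δx j }

  var-represents-↑ˡ : ∀ {m k δ} (p : Vector Carrier m) (w : Vector Carrier k) → (∀ j → δ ≼ (p ++ w) j) →
    ∀ j → Represents δ (p ++ w) (PK.var (j ↑ˡ k)) (p j)
  var-represents-↑ˡ {m} {k} p w δx j = subst (Represents _ (p ++ w) (PK.var (j ↑ˡ k)))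
    (lookup-++ˡ p w j) (var-represents δx (j ↑ˡ k))

  var-represents-↑ʳ : ∀ {m k δ} (p : Vector Carrier m) (w : Vector Carrier k) → (∀ j → δ ≼ (p ++ w) j) →
    ∀ j → Represents δ (p ++ w) (PK.var (m ↑ʳ j)) (w j)
  var-represents-↑ʳ {m} {k} p w δx j = subst (Represents _ (p ++ w) (PK.var (m ↑ʳ j)))
    (lookup-++ʳ p w j) (var-represents δx (m ↑ʳ j))

  -- F(X,Y) and F(Y,X) are equal series in the same variables, both evaluated at p ++ q; the second
  -- substitution is read as `F i` at q ++ p.
  ⊕-comm : ∀ p q s → p ⊕ q ↦ s → q ⊕ p ↦ s
  ⊕-comm P@(p , 0<p) Q@(q , 0<q) S@(s , _) pq i = compose-limit 0<δ yx i
    (limit-≈ (λ N → T-cong N λ d _ → part-cong (p ++ q) (λ ν → ι.⟦⟧-cong (IsF.comm i ν)) d)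
      (limit (compose-represents 0<δ xy i (pq i))))
    where
    open FK.Variables n
    bounded = common-bound (p ++ q) (++-all (0ℚ ≺_) 0<p 0<q)
    δ = proj₁ bounded
    0<δ = proj₁ (proj₂ bounded)
    δx = proj₂ (proj₂ bounded)
    xy : ∀ j → Represents δ (p ++ q) ((X ++ Y) j) ((p ++ q) j)
    xy = ++-pointwise (Represents δ (p ++ q)) (var-represents-↑ˡ p q δx) (var-represents-↑ʳ p q δx)
    yx : ∀ j → Represents δ (p ++ q) ((Y ++ X) j) ((q ++ p) j)
    yx = ++-pointwise (Represents δ (p ++ q)) (var-represents-↑ʳ p q δx) (var-represents-↑ˡ p q δx)

  -- Both sides of the associative law are evaluated at p ++ (q ++ r). The left one sums to t, hence
  -- so does the right one; the existence of p ⊕ u is thus a conclusion.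
  ⊕-assoc : ∀ p q r s u t → p ⊕ q ↦ s → q ⊕ r ↦ u → s ⊕ r ↦ t → p ⊕ u ↦ t
  ⊕-assoc (p , 0<p) (q , 0<q) (r , 0<r) (s , _) (u , _) (t , _) pq qr sr i = compose-limit 0<δ right i
    (limit-≈ (λ N → T-cong N λ d _ → part-cong x (λ ν → ι.⟦⟧-cong (IsF.assoc i ν)) d)
      (limit (compose-represents 0<δ left i (sr i))))
    where
    open FK.Variables n
    x = p ++ (q ++ r)
    bounded = common-bound x (++-all (0ℚ ≺_) 0<p (++-all (0ℚ ≺_) 0<q 0<r))
    δ = proj₁ bounded
    0<δ = proj₁ (proj₂ bounded)
    δx = proj₂ (proj₂ bounded)
    X₃↦ : ∀ j → Represents δ x (X₃ j) (p j)
    X₃↦ = var-represents-↑ˡ p (q ++ r) δx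
    Y₃↦ : ∀ j → Represents δ x (Y₃ j) (q j)
    Y₃↦ j = subst (Represents δ x (Y₃ j)) (lookup-++ˡ q r j)
      (var-represents-↑ʳ p (q ++ r) δx (j ↑ˡ n))
    Z₃↦ : ∀ j → Represents δ x (Z₃ j) (r j)
    Z₃↦ j = subst (Represents δ x (Z₃ j)) (lookup-++ʳ q r j)
      (var-represents-↑ʳ p (q ++ r) δx (n ↑ʳ j))
    left : ∀ j → Represents δ x (((λ j → FK.subst (F j) (X₃ ++ Y₃)) ++ Z₃) j) ((s ++ r) j)
    left = ++-pointwise (Represents δ x)
      (λ j → compose-represents 0<δ (++-pointwise (Represents δ x) X₃↦ Y₃↦) j (pq j)) Z₃↦
    right : ∀ j → Represents δ x ((X₃ ++ (λ j → FK.subst (F j) (Y₃ ++ Z₃))) j) ((p ++ u) j)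
    right = ++-pointwise (Represents δ x) X₃↦
      (λ j → compose-represents 0<δ (++-pointwise (Represents δ x) Y₃↦ Z₃↦) j (qr j))

  -- Commutativity reverses the order of the three summands and thereby exchanges the two
  -- bracketings.
  ⊕-assoc′ : ∀ p q r s u t → p ⊕ q ↦ s → q ⊕ r ↦ u → p ⊕ u ↦ t → s ⊕ r ↦ t
  ⊕-assoc′ p q r s u t pq qr pu = ⊕-comm r s t
    (⊕-assoc r q p u s t (⊕-comm q r u qr) (⊕-comm p q s pq) (⊕-comm p u t pu))

  ⊕-bound : ∀ {q} → 0ℚ ℚ.≤ q → ∀ p r s → p ⊕ r ↦ s →
    (∀ j → q ≼ proj₁ p j) → (∀ j → q ≼ proj₁ r j) → ∀ i → q ≼ proj₁ s i
  ⊕-bound {q} 0≤q (p , _) (r , _) (s , _) pr qp qr i = limit-bound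
    (λ N → ≼-cong (sym (sumDegree≤≈T {n ℕ.+ n} N (weight (p ++ r) (f i))))
      (T-bound 0≤q (part-constant (constant-part i)) (part-bounded (integral i) (++-all (q ≼_) qp qr)) N))
    (pr i)

  ⊕-zero : ∀ p r s → p ⊕ r ↦ s → IsZero (proj₁ p) → IsZero (proj₁ r) → IsZero (proj₁ s)
  -- `⊕-bound` asks for a non-negative bound, hence q ⊔ 0 in place of q.
  ⊕-zero p r s pr p≈0 r≈0 i = infinitely-small λ q → ≼-weaken (ℚₚ.p≤p⊔q q 0ℚ)
    (⊕-bound (ℚₚ.p≤q⊔p q 0ℚ) p r s pr (λ j → ≼-≈0 (p≈0 j)) (λ j → ≼-≈0 (r≈0 j)) i)

  -- F i − X i − Y i has no terms of degree < 2, which gains the summand δ.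
  ⊕-difference : ∀ {δ β} → 0ℚ ℚ.≤ δ → ∀ p q r s t → p ⊕ r ↦ s → q ⊕ r ↦ t →
    (∀ j → δ ≼ proj₁ p j) → (∀ j → δ ≼ proj₁ q j) → (∀ j → δ ≼ proj₁ r j) →
    (∀ j → β ≼ proj₁ p j - proj₁ q j) →
    ∀ i → β ℚ.+ δ ≼ (proj₁ s i - proj₁ t i) - (proj₁ p i - proj₁ q i)
  ⊕-difference {δ} {β} 0≤δ (p , _) (q , _) (r , _) (s , _) (t , _) pr qr δp δq δr βpq i =
    limit-difference-bound (p i - q i) estimate (pr i) (qr i)
    where
    h : Vec ℕ (n ℕ.+ n) → Carrier
    h μ = f i μ - var (i ↑ˡ n) μ - var (n ↑ʳ i) μ

    -- The excess of the bound β on p - q over δ; with k = 2, `partial-difference` then yields γ +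
    -- 2δ = β + δ.
    γ = β ℚ.- δ

    γ+δ : γ ℚ.+ δ ≡ β
    γ+δ = ≡.trans (ℚₚ.+-assoc β (ℚ.- δ) δ) (≡.trans (cong (β ℚ.+_) (ℚₚ.+-inverseˡ δ)) (ℚₚ.+-identityʳ β))

    γ+2δ : γ ℚ.+ 2 • δ ≡ β ℚ.+ δ
    γ+2δ = ≡.trans (≡.sym (ℚₚ.+-assoc γ δ (1 • δ))) (≡.cong₂ ℚ._+_ γ+δ (•-homo-1 δ))

    h-integral : Integral h
    h-integral μ = ≼-sub (≼-sub (integral i μ) (var-integral (i ↑ˡ n) μ)) (var-integral (n ↑ʳ i) μ)

    h≈0 : ∀ μ → degree μ ℕ.< 2 → h μ ≈ 0#
    h≈0 μ lt = trans (+-congʳ (+-congʳ (linear-part i μ lt)))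
      (solve 2 (λ x y → (x :+ y) :- x :- y := :0) ≈-refl (var (i ↑ˡ n) μ) (var (n ↑ʳ i) μ))

    partial-var : ∀ (x : Vector Carrier (n ℕ.+ n)) j N → 1 ℕ.≤ N → sumDegree≤ N (weight x (var j)) ≈ x j
    partial-var x j N le = trans (sumDegree≤≈T {n ℕ.+ n} N _) (T-part-var x j N le)

    partial-h : ∀ (x : Vector Carrier (n ℕ.+ n)) N → 1 ℕ.≤ N →
      sumDegree≤ N (weight x h) ≈ partialSum (F i) x N - x (i ↑ˡ n) - x (n ↑ʳ i)
    partial-h x N le = begin
      sumDegree≤ N (weight x h)
        ≈⟨ sumDegree≤-cong {n ℕ.+ n} N (λ μ → solve 4 (λ f u w y → (f :- u :- w) :* y := f :* y :- u :* y :- w :* y) ≈-refl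
             (f i μ) (var (i ↑ˡ n) μ) (var (n ↑ʳ i) μ) (x ^ᵐ μ)) ⟩
      sumDegree≤ N (λ μ → weight x (f i) μ - weight x (var (i ↑ˡ n)) μ - weight x (var (n ↑ʳ i)) μ)
        ≈⟨ sumDegree≤-sub {n ℕ.+ n} N _ _ ⟩
      sumDegree≤ N (λ μ → weight x (f i) μ - weight x (var (i ↑ˡ n)) μ) - sumDegree≤ N (weight x (var (n ↑ʳ i)))
        ≈⟨ +-cong (sumDegree≤-sub {n ℕ.+ n} N _ _) (-‿cong (partial-var x (n ↑ʳ i) N le)) ⟩
      partialSum (F i) x N - sumDegree≤ N (weight x (var (i ↑ˡ n))) - x (n ↑ʳ i)
        ≈⟨ +-congʳ (+-congˡ (-‿cong (partial-var x (i ↑ˡ n) N le))) ⟩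
      partialSum (F i) x N - x (i ↑ˡ n) - x (n ↑ʳ i) ∎
      where open SetoidReasoning setoid

    left : ∀ (p : Vector Carrier n) → (p ++ r) (i ↑ˡ n) ≡ p i
    left p = lookup-++ˡ p r i

    right : ∀ (p : Vector Carrier n) → (p ++ r) (n ↑ʳ i) ≡ r i
    right p = lookup-++ʳ p r i

    partial-h′ : ∀ (p : Vector Carrier n) N → 1 ℕ.≤ N →
      sumDegree≤ N (weight (p ++ r) h) ≈ partialSum (F i) (p ++ r) N - p i - r i
    partial-h′ p N le = ≡.subst₂ (λ y z → sumDegree≤ N (weight (p ++ r) h) ≈ partialSum (F i) (p ++ r) N - y - z)
      (left p) (right p) (partial-h (p ++ r) N le)

    estimate : ∀ N → 1 ℕ.≤ N → β ℚ.+ δ ≼ (partialSum (F i) (p ++ r) N - partialSum (F i) (q ++ r) N) - (p i - q i)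
    estimate N le = ≼-cong
      (trans (+-cong (partial-h′ p N le) (-‿cong (partial-h′ q N le)))
        (solve 5 (λ f g p q r → (f :- p :- r) :- (g :- q :- r) := (f :- g) :- (p :- q)) ≈-refl _ _ (p i) (q i) (r i)))
      (subst (_≼ sumDegree≤ N (weight (p ++ r) h) - sumDegree≤ N (weight (q ++ r) h)) γ+2δ
        (partial-difference 0≤δ {γ} h-integral (++-all (δ ≼_) δp δr) (++-all (δ ≼_) δq δr)
          (++-pointwise (λ x y → γ ℚ.+ δ ≼ x - y) {u = p} {q} {r} {r}
            (λ j → subst (_≼ p j - q j) (≡.sym γ+δ) (βpq j)) (λ j → ≼-≈0 (-‿inverseʳ (r j)))) 2 h≈0 N))

  module _ (⊕-exists : ∀ p q → ¬ ¬ (∃ λ s → p ⊕ q ↦ s)) where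

    -- Passes through p ⊕ (q ⊕ (r ⊕ s)). Only q ⊕ (r ⊕ s) is not among the given sums and has to be
    -- supplied by `⊕-exists`.
    ⊕-medial : ∀ p q r s pq rs pr qs t →
      p ⊕ q ↦ pq → r ⊕ s ↦ rs → p ⊕ r ↦ pr → q ⊕ s ↦ qs → pq ⊕ rs ↦ t → ¬ ¬ (pr ⊕ qs ↦ t)
    ⊕-medial p q r s pq rs pr qs t p⊕q r⊕s p⊕r q⊕s pq⊕rs k = ⊕-exists q rs λ (u , q⊕rs) → k
      (⊕-assoc′ p r qs pr u t p⊕r
        (⊕-comm qs r u (⊕-assoc′ q s r qs rs u q⊕s (⊕-comm r s rs r⊕s) q⊕rs))
        (⊕-assoc p q rs pq u t p⊕q q⊕rs pq⊕rs))

    multiple-⊕ : ∀ k p q s kp kq → p ⊕ q ↦ s → IsMultiple k p kp → IsMultiple k q kq →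
      ¬ ¬ (∃ λ ks → IsMultiple k s ks × (kp ⊕ kq ↦ ks))
    multiple-⊕ zero p q s kp kq pq (lift kp≈0) (lift kq≈0) κ = ⊕-exists kp kq λ (o , kp⊕kq) →
      κ (o , lift (⊕-zero kp kq o kp⊕kq kp≈0 kq≈0) , kp⊕kq)
    multiple-⊕ (suc k) p q s kp kq pq (p′ , mp , p⊕p′) (q′ , mq , q⊕q′) κ =
      multiple-⊕ k p q s p′ q′ pq mp mq λ (s′ , ms , p′⊕q′) →
      ⊕-exists s s′ λ (t , s⊕s′) →
      ⊕-medial p q p′ q′ s s′ kp kq t pq p′⊕q′ p⊕p′ q⊕q′ s⊕s′ λ kp⊕kq →
      κ (t , (s′ , ms , s⊕s′) , kp⊕kq)

    torsion-⊕ : ∀ p q s → p ⊕ q ↦ s → IsTorsion p → IsTorsion q → ¬ ¬ IsTorsion s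
    torsion-⊕ p q s pq (kp , mp , kp≈0) (kq , mq , kq≈0) κ =
      multiple-⊕ ℓ p q s kp kq pq mp mq λ (ks , ms , kp⊕kq) →
      κ (ks , ms , ⊕-zero kp kq ks kp⊕kq kp≈0 kq≈0)

    zero-torsion : ∀ o → IsZero (proj₁ o) → ¬ ¬ IsTorsion o
    zero-torsion o o≈0 κ = multiple ℓ λ (ko , mo , ko≈0) → κ (ko , mo , ko≈0)
      where
      multiple : ∀ k → ¬ ¬ (∃ λ ko → IsMultiple k o ko × IsZero (proj₁ ko))
      multiple zero κ = κ (o , lift o≈0 , o≈0)
      multiple (suc k) κ = multiple k λ (ko , mo , ko≈0) → ⊕-exists o ko λ (t , o⊕ko) →
        κ (t , (ko , mo , o⊕ko) , ⊕-zero o ko t o⊕ko o≈0 ko≈0)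

    -- Applied to [ℓ-1]x, the second summand of the critical point z.
    multiple-torsion : ∀ k p kp → IsTorsion p → IsMultiple k p kp → ¬ ¬ IsTorsion kp
    multiple-torsion zero p kp tp (lift kp≈0) = zero-torsion kp kp≈0
    multiple-torsion (suc k) p kp tp (p′ , mp , p⊕p′) κ = multiple-torsion k p p′ tp mp λ tp′ →
      torsion-⊕ p p′ kp p⊕p′ tp tp′ κ

  module _ (σ : Gal) (v-σ : ∀ x → v (Gal.act σ x) ≡ v x) where
    open Gal σ
    private
      module σ = RingHomomorphism K̄.commutativeRing K̄.commutativeRing act
        (RingMorphisms.IsRingIsomorphism.isRingHomomorphism isRingIsomorphism)

    ≼-act : ∀ {q y} → q ≼ y → q ≼ act y
    ≼-act {q} {y} = subst ([ q ] ≤⁺_) (≡.sym (v-σ y))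

    ≺-act : ∀ {q y} → q ≺ y → q ≺ act y
    ≺-act {q} {y} = subst ([ q ] <⁺_) (≡.sym (v-σ y))

    act-point : Point n → Point n
    act-point (x , 0<x) = (λ i → act (x i)) , λ i → ≺-act (0<x i)

    act-partialSum : ∀ i (x : Vector Carrier (n ℕ.+ n)) (y : Vector Carrier (n ℕ.+ n)) → (∀ j → act (x j) ≈ y j) →
      ∀ N → act (partialSum (F i) x N) ≈ partialSum (F i) y N
    act-partialSum i x y xy N = trans (σ.sumDegree≤-homo {n ℕ.+ n} N _) (sumDegree≤-cong {n ℕ.+ n} N λ μ →
      trans (σ.*-homo _ _) (*-cong (fixes-K (F i μ)) (trans (σ.monomial-homo x μ) (^ᵐ-cong xy μ))))
      where
      ^ᵐ-cong : ∀ {m} {x y : Vector Carrier m} → (∀ j → x j ≈ y j) → ∀ μ → x ^ᵐ μ ≈ y ^ᵐ μ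
      ^ᵐ-cong xy [] = ≈-refl
      ^ᵐ-cong xy (k ∷ μ) = *-cong (Exp.^-congˡ K̄.semiring k (xy Fin.zero)) (^ᵐ-cong (xy ∘ Fin.suc) μ)

    -- As σ fixes the coefficients of F, it maps partial sums to partial sums; as it preserves v, it
    -- commutes with limits.
    act-⊕ : ∀ p q s → p ⊕ q ↦ s → act-point p ⊕ act-point q ↦ act-point s
    act-⊕ (p , _) (q , _) (s , _) pq i r = proj₁ (pq i r) , λ N le → ≼-cong
      (trans (σ.sub-homo _ _) (+-congʳ (act-partialSum i (p ++ q) _
        (++-pointwise (λ x y → act x ≈ y) {u = p} {act ∘ p} {q} {act ∘ q} (λ _ → ≈-refl) (λ _ → ≈-refl)) N)))
      (≼-act (proj₂ (pq i r) N le))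

    act-zero : ∀ p → IsZero (proj₁ p) → IsZero (proj₁ (act-point p))
    act-zero p p≈0 i = trans (σ.⟦⟧-cong (p≈0 i)) σ.0#-homo

    act-multiple : ∀ k p kp → IsMultiple k p kp → IsMultiple k (act-point p) (act-point kp)
    act-multiple zero p kp (lift kp≈0) = lift (act-zero kp kp≈0)
    act-multiple (suc k) p kp (p′ , mp , p⊕p′) = act-point p′ , act-multiple k p p′ mp , act-⊕ p p′ kp p⊕p′

    act-torsion : ∀ p → IsTorsion p → IsTorsion (act-point p)
    act-torsion p (o , mo , o≈0) = act-point o , act-multiple ℓ p o mo , act-zero o o≈0

-- ℓ-adic numbers: integral valuations and residues.

prime-coprime : ∀ {p} → Prime p → ∀ {n} → ¬ (p ∣ n) → Coprime n p
prime-coprime {p} p-prime p∤n {d} (d∣n , d∣p) with prime⇒irreducible p-prime d∣p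
... | inj₁ d≡1 = d≡1
... | inj₂ refl = contradiction d∣n p∤n

module ℓ-Adic {ℓ : ℕ} {a b : Level} (ℓ-prime : Prime ℓ) (E : UnramifiedExtension ℓ a b) where
  open UnramifiedExtension E
  open IsCompletionOfℚ isCompletionOfℚ using (fromℚ; dense; v-ℓ; v-unit)
  open K̄ hiding (inverse) renaming (refl to ≈-refl)
  open Valued K̄ v isValuation
  open IntegerSolver K̄.commutativeRing
  module ι = RingHomomorphism K.commutativeRing K̄.commutativeRing ι (Embedding.isRingHomomorphism K→K̄)
  module ℚₗ→K = RingHomomorphism ℚₗ.commutativeRing K.commutativeRing (Embedding.⟦_⟧ ℚₗ→K)
    (Embedding.isRingHomomorphism ℚₗ→K)
  module fromℚ = RingHomomorphism ℚₚ.+-*-commutativeRing ℚₗ.commutativeRing fromℚ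
    (IsCompletionOfℚ.isRingHomomorphism isCompletionOfℚ)

  j : ℚₗ.Carrier → Carrier
  j x = ι (Embedding.⟦_⟧ ℚₗ→K x)

  j-isRingHomomorphism : RingMorphisms.IsRingHomomorphism ℚₗ.rawRing K̄.rawRing j
  j-isRingHomomorphism = record
    { isSemiringHomomorphism = record
      { isNearSemiringHomomorphism = record
        { +-isMonoidHomomorphism = record
          { isMagmaHomomorphism = record
            { isRelHomomorphism = record { cong = λ e → ι.⟦⟧-cong (ℚₗ→K.⟦⟧-cong e) }
            ; homo = λ x y → trans (ι.⟦⟧-cong (ℚₗ→K.+-homo x y)) (ι.+-homo _ _)
            }
          ; ε-homo = trans (ι.⟦⟧-cong ℚₗ→K.0#-homo) ι.0#-homo
          }
        ; *-homo = λ x y → trans (ι.⟦⟧-cong (ℚₗ→K.*-homo x y)) (ι.*-homo _ _)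
        }
      ; 1#-homo = trans (ι.⟦⟧-cong ℚₗ→K.1#-homo) ι.1#-homo
      }
    ; -‿homo = λ x → trans (ι.⟦⟧-cong (ℚₗ→K.-‿homo x)) (ι.-‿homo _)
    }

  module j = RingHomomorphism ℚₗ.commutativeRing K̄.commutativeRing j j-isRingHomomorphism

  φ : ℚ → Carrier
  φ q = j (fromℚ q)

  nat : ℕ → Carrier
  nat n = n ×# 1#

  nat-+ : ∀ m n → nat (m ℕ.+ n) ≈ nat m + nat n
  nat-+ = #×.×-homo-+ 1#

  nat-* : ∀ m n → nat (m ℕ.* n) ≈ nat m * nat n
  nat-* = #×.×1-homo-*

  φ-× : ∀ n q → φ (n • q) ≈ nat n * φ q
  φ-× zero q = trans (j.⟦⟧-cong fromℚ.0#-homo) (trans j.0#-homo (sym (zeroˡ _)))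
  φ-× (suc n) q = trans (j.⟦⟧-cong (fromℚ.+-homo q (n • q))) (trans (j.+-homo _ _)
    (trans (+-congˡ (φ-× n q)) (solve 2 (λ q n → q :+ n :* q := (:1 :+ n) :* q) ≈-refl (φ q) (nat n))))

  φ-1 : φ 1ℚ ≈ 1#
  φ-1 = trans (j.⟦⟧-cong fromℚ.1#-homo) j.1#-homo

  φ-+ : ∀ p q → φ (p ℚ.+ q) ≈ φ p + φ q
  φ-+ p q = trans (j.⟦⟧-cong (fromℚ.+-homo p q)) (j.+-homo _ _)

  φ-nat : ∀ n → φ (n • 1ℚ) ≈ nat n
  φ-nat n = trans (φ-× n 1ℚ) (trans (*-congˡ φ-1) (*-identityʳ _))

  nat≈φ : ∀ n → nat n ≈ φ (+ n ℚ./ 1)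
  nat≈φ n = trans (sym (φ-nat n)) (reflexive (cong φ (•1≡ n)))

  v-natℓ : v (nat ℓ) ≡ [ 1ℚ ]
  v-natℓ = ≡.trans (v-cong (nat≈φ ℓ)) v-ℓ

  v-nat-unit : ∀ m → ¬ (ℓ ∣ m) → v (nat m) ≡ [ 0ℚ ]
  v-nat-unit m ℓ∤m = ≡.trans (v-cong (nat≈φ m)) (v-unit m ℓ∤m)

  ℓ>1 : 1 ℕ.< ℓ
  ℓ>1 = ℕ.nonTrivial⇒n>1 ℓ {{prime⇒nonTrivial ℓ-prime}}

  quotient< : ∀ n c → suc n ≡ c ℕ.* ℓ → c ℕ.< suc n
  quotient< n zero ()
  quotient< n (suc c) e = subst (suc c ℕ.<_) (≡.sym e) (ℕₚ.m<m*n (suc c) ℓ ℓ>1)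

  v-nat : ∀ n → ∃ λ q → v (nat (suc n)) ≡ [ q ] × IsInteger q
  v-nat n = <-rec (λ n → .{{NonZero n}} → ∃ λ q → v (nat n) ≡ [ q ] × IsInteger q) step (suc n)
    where
    step : ∀ n → (∀ {k} → k ℕ.< n → .{{NonZero k}} → ∃ λ q → v (nat k) ≡ [ q ] × IsInteger q) →
      .{{NonZero n}} → ∃ λ q → v (nat n) ≡ [ q ] × IsInteger q
    step (suc n) rec with ℓ ∣? suc n
    ... | no ℓ∤n = 0ℚ , v-nat-unit (suc n) ℓ∤n , integer-0
    ... | yes (divides (suc c) e) with rec {suc c} (quotient< n (suc c) e)
    ... | q , vq , iq = q ℚ.+ 1ℚ ,
      ≡.trans (v-cong (trans (reflexive (cong nat e)) (nat-* (suc c) ℓ))) (v-*-finite vq v-natℓ) ,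
      integer-+ iq (subst IsInteger (•-homo-1 1ℚ) (integer-• 1))

  nat-signed : ∀ m n → ∃ λ t → (nat m - nat n ≈ nat t) ⊎ (nat m - nat n ≈ - nat t)
  nat-signed m n with ℕₚ.≤-total n m
  ... | inj₁ n≤m = m ℕ.∸ n , inj₁ (trans (+-congʳ (trans (reflexive (cong nat (≡.sym (ℕₚ.m∸n+n≡m n≤m)))) (nat-+ (m ℕ.∸ n) n)))
          (solve 2 (λ x y → x :+ y :- y := x) ≈-refl (nat (m ℕ.∸ n)) (nat n)))
  ... | inj₂ m≤n = n ℕ.∸ m , inj₂ (trans (+-congˡ (-‿cong (trans (reflexive (cong nat (≡.sym (ℕₚ.m∸n+n≡m m≤n)))) (nat-+ (n ℕ.∸ m) m))))
          (solve 2 (λ x y → x :- (y :+ x) := :- y) ≈-refl (nat m) (nat (n ℕ.∸ m))))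

  IsFraction : ℚ → Set b
  IsFraction r = ∃ λ k → ∃ λ t → (nat (suc k) * φ r ≈ nat t) ⊎ (nat (suc k) * φ r ≈ - nat t)

  fraction : ∀ r → IsFraction r
  fraction r = go (clear-denominator r)
    where
    go : (Σ ℕ λ k → Σ ℕ λ m → Σ ℕ λ n → suc k • r ℚ.+ n • 1ℚ ≡ m • 1ℚ) →
      IsFraction r
    go (k , m , n , eq) = k , proj₁ (nat-signed m n) , Sum.map (trans kr) (trans kr) (proj₂ (nat-signed m n))
      where
      kr+n : nat (suc k) * φ r + nat n ≈ nat m
      kr+n = trans (+-cong (sym (φ-× (suc k) r)) (sym (φ-nat n)))
        (trans (sym (φ-+ (suc k • r) (n • 1ℚ))) (trans (reflexive (cong φ eq)) (φ-nat m)))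
      kr : nat (suc k) * φ r ≈ nat m - nat n
      kr = trans (solve 2 (λ x y → x := x :+ y :- y) ≈-refl (nat (suc k) * φ r) (nat n)) (+-congʳ kr+n)

  nat-finite-integer : ∀ t {q} → v (nat t) ≡ [ q ] → IsInteger q
  nat-finite-integer zero vt = contradiction ≈-refl (finite⇒≉0 vt)
  nat-finite-integer (suc t) vt with v-nat t
  ... | q , vq , iq = subst IsInteger (v-unique vq vt) iq

  v-φ-integer : ∀ r {q} → v (φ r) ≡ [ q ] → IsInteger q
  v-φ-integer r {q} vr = go (fraction r)
    where
    go : IsFraction r → IsInteger q
    go (k , t , e) = subst IsInteger p+q-p≡q (integer-sub (nat-finite-integer t vt) (proj₂ (proj₂ (v-nat k))))
      where
      p = proj₁ (v-nat k)
      vt′ : v (nat (suc k) * φ r) ≡ [ p ℚ.+ q ]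
      vt′ = v-*-finite (proj₁ (proj₂ (v-nat k))) vr
      vt : v (nat t) ≡ [ p ℚ.+ q ]
      vt = [ (λ e → ≡.trans (≡.sym (v-cong e)) vt′)
           , (λ e → ≡.trans (≡.sym (v-neg (nat t))) (≡.trans (≡.sym (v-cong e)) vt′)) ]′ e
      p+q-p≡q : p ℚ.+ q ℚ.- p ≡ q
      p+q-p≡q = ≡.trans (cong (ℚ._- p) (ℚₚ.+-comm p q)) (x+r-r≈x q p)

  -- A rational number closer to x than q = v(x) has the same valuation (the distance q + 1 is close
  -- enough), and for rational numbers integrality is read off numerator and denominator.
  v-ℚₗ-integer : ∀ x {q} → v (j x) ≡ [ q ] → IsInteger q
  v-ℚₗ-integer x {q} vx = v-φ-integer (proj₁ d) (v-close (j x) (φ (proj₁ d)) vx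
    (≼⇒≺ q<q+1 (≼-swap (j x) (φ (proj₁ d)) (≼-cong (j.sub-homo x (fromℚ (proj₁ d))) (proj₂ d)))))
    where
    d = dense x (q ℚ.+ 1ℚ)
    q<q+1 : q ℚ.< q ℚ.+ 1ℚ
    q<q+1 = subst (ℚ._< q ℚ.+ 1ℚ) (ℚₚ.+-identityʳ q) (ℚₚ.+-monoʳ-< q 0<1)

  ≼-cancel-unit : ∀ {q x y} → v x ≡ [ 0ℚ ] → q ≼ x * y → q ≼ y
  ≼-cancel-unit {q} {x} {y} vx qxy = subst ([ q ] ≤⁺_) v-xy qxy
    where
    v-xy : v (x * y) ≡ v y
    v-xy = ≡.trans (v-* x y) (≡.trans (cong (_+∞ v y) vx) (go (v y)))
      where
      go : ∀ w → [ 0ℚ ] +∞ w ≡ w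
      go ⊤⁺ = refl
      go [ q ] = cong [_] (ℚₚ.+-identityˡ q)

  ℓ-multiple : ∀ {x} → 0ℚ ≼ x → 1ℚ ≼ nat ℓ * x
  ℓ-multiple {x} 0x = ≼-*ʳ (≼-finite v-natℓ ℚₚ.≤-refl) 0x

  HasDigit : Carrier → Set
  HasDigit y = ∃ λ c → 1ℚ ≼ y - nat c

  -- -c ≡ (ℓ - 1) c modulo ℓ.
  negative-digit : ∀ y c → 1ℚ ≼ y + nat c → HasDigit y
  negative-digit y c d = ℓ-1 ℕ.* c , ≼-cong eq (≼-sub d (ℓ-multiple (integral-×# c)))
    where
    ℓ-1 = ℓ ℕ.∸ 1
    eq : (y + nat c) - nat ℓ * nat c ≈ y - nat (ℓ-1 ℕ.* c)
    eq = begin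
      (y + nat c) - nat ℓ * nat c ≡⟨ cong (λ n → (y + nat c) - nat n * nat c) (ℕₚ.m∸n+n≡m (ℕₚ.<⇒≤ ℓ>1)) ⟨
      (y + nat c) - nat (ℓ-1 ℕ.+ 1) * nat c ≈⟨ +-congˡ (-‿cong (*-congʳ (trans (nat-+ ℓ-1 1) (+-congˡ (+-identityʳ 1#))))) ⟩
      (y + nat c) - (nat ℓ-1 + 1#) * nat c
        ≈⟨ solve 3 (λ y c l → (y :+ c) :- (l :+ :1) :* c := y :- l :* c) ≈-refl y (nat c) (nat ℓ-1) ⟩
      y - nat ℓ-1 * nat c ≈⟨ +-congˡ (-‿cong (nat-* ℓ-1 c)) ⟨
      y - nat (ℓ-1 ℕ.* c) ∎
      where open SetoidReasoning setoid

  -- Bézout provides an inverse of k modulo ℓ, of the form x or -x, so that y = t / k is congruent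
  -- to t x or -t x; the second case goes through `negative-digit`.
  unit-digit : ∀ k t y → ¬ (ℓ ∣ k) → nat k * y ≈ nat t → HasDigit y
  unit-digit k t y ℓ∤k eq with coprime-Bézout (prime-coprime ℓ-prime ℓ∤k)
  ... | Bézout.+- x u e = t ℕ.* x , ≼-cancel-unit (v-nat-unit k ℓ∤k) (≼-cong (sym eq′) (≼-neg (ℓ-multiple (≼-*ˡ (integral-×# t) (integral-×# u)))))
    where
    e′ : nat x * nat k ≈ 1# + nat u * nat ℓ
    e′ = trans (sym (nat-* x k)) (trans (reflexive (cong nat (≡.sym e))) (+-congˡ (nat-* u ℓ)))
    open SetoidReasoning setoid
    eq′ : nat k * (y - nat (t ℕ.* x)) ≈ - (nat ℓ * (nat t * nat u))
    eq′ = begin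
      nat k * (y - nat (t ℕ.* x)) ≈⟨ *-congˡ (+-congˡ (-‿cong (nat-* t x))) ⟩
      nat k * (y - nat t * nat x) ≈⟨ solve 4 (λ k y t x → k :* (y :- t :* x) := k :* y :- t :* (x :* k)) ≈-refl (nat k) y (nat t) (nat x) ⟩
      nat k * y - nat t * (nat x * nat k) ≈⟨ +-cong eq (-‿cong (*-congˡ e′)) ⟩
      nat t - nat t * (1# + nat u * nat ℓ)
        ≈⟨ solve 3 (λ t u l → t :- t :* (:1 :+ u :* l) := :- (l :* (t :* u))) ≈-refl (nat t) (nat u) (nat ℓ) ⟩
      - (nat ℓ * (nat t * nat u)) ∎
  ... | Bézout.-+ x u e = negative-digit y (t ℕ.* x) (≼-cancel-unit (v-nat-unit k ℓ∤k)
      (≼-cong (sym eq′) (ℓ-multiple (≼-*ˡ (integral-×# t) (integral-×# u)))))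
    where
    e′ : 1# + nat x * nat k ≈ nat u * nat ℓ
    e′ = trans (+-congˡ (sym (nat-* x k))) (trans (reflexive (cong nat e)) (nat-* u ℓ))
    open SetoidReasoning setoid
    eq′ : nat k * (y + nat (t ℕ.* x)) ≈ nat ℓ * (nat t * nat u)
    eq′ = begin
      nat k * (y + nat (t ℕ.* x)) ≈⟨ *-congˡ (+-congˡ (nat-* t x)) ⟩
      nat k * (y + nat t * nat x) ≈⟨ solve 4 (λ k y t x → k :* (y :+ t :* x) := k :* y :+ t :* (x :* k)) ≈-refl (nat k) y (nat t) (nat x) ⟩
      nat k * y + nat t * (nat x * nat k) ≈⟨ +-congʳ eq ⟩
      nat t + nat t * (nat x * nat k) ≈⟨ solve 2 (λ t w → t :+ t :* w := t :* (:1 :+ w)) ≈-refl (nat t) (nat x * nat k) ⟩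
      nat t * (1# + nat x * nat k) ≈⟨ *-congˡ e′ ⟩
      nat t * (nat u * nat ℓ) ≈⟨ solve 3 (λ t u l → t :* (u :* l) := l :* (t :* u)) ≈-refl (nat t) (nat u) (nat ℓ) ⟩
      nat ℓ * (nat t * nat u) ∎

  nat-cancel : ∀ n {x y} → nat (suc n) * x ≈ nat (suc n) * y → x ≈ y
  nat-cancel n {x} {y} eq with inverse (proj₁ (proj₂ (v-nat n)))
  ... | u , nu = begin
    x ≈⟨ *-identityˡ x ⟨
    1# * x ≈⟨ *-congʳ nu ⟨
    nat (suc n) * u * x ≈⟨ solve 3 (λ n u x → n :* u :* x := u :* (n :* x)) ≈-refl (nat (suc n)) u x ⟩
    u * (nat (suc n) * x) ≈⟨ *-congˡ eq ⟩
    u * (nat (suc n) * y) ≈⟨ solve 3 (λ n u x → n :* u :* x := u :* (n :* x)) ≈-refl (nat (suc n)) u y ⟨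
    nat (suc n) * u * y ≈⟨ *-congʳ nu ⟩
    1# * y ≈⟨ *-identityˡ y ⟩
    y ∎
    where open SetoidReasoning setoid

  -- A common factor ℓ of the denominator and the numerator is cancelled until the denominator is a unit.
  fraction-digit : ∀ k t y → 0ℚ ≼ y → nat (suc k) * y ≈ nat t → HasDigit y
  fraction-digit k t y 0y = <-rec (λ k → .{{NonZero k}} → ∀ t → nat k * y ≈ nat t → HasDigit y) step (suc k) t
    where
    step : ∀ k → (∀ {m} → m ℕ.< k → .{{NonZero m}} → ∀ t → nat m * y ≈ nat t → HasDigit y) →
      .{{NonZero k}} → ∀ t → nat k * y ≈ nat t → HasDigit y
    step k@(suc k-1) rec t eq with ℓ ∣? k | ℓ ∣? t
    ... | no ℓ∤k | _ = unit-digit k t y ℓ∤k eq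
    ... | yes (divides (suc c) e) | yes (divides d e′) = rec {suc c} (quotient< k-1 (suc c) e) d cancelled
      where
      ℓ-nonZero : ∃ λ m → ℓ ≡ suc m
      ℓ-nonZero = ℓ ℕ.∸ 1 , ≡.trans (≡.sym (ℕₚ.m∸n+n≡m (ℕₚ.<⇒≤ ℓ>1))) (ℕₚ.+-comm (ℓ ℕ.∸ 1) 1)
      open SetoidReasoning setoid
      scaled : nat ℓ * (nat (suc c) * y) ≈ nat ℓ * nat d
      scaled = begin
        nat ℓ * (nat (suc c) * y) ≈⟨ solve 3 (λ l c y → l :* (c :* y) := (c :* l) :* y) ≈-refl (nat ℓ) (nat (suc c)) y ⟩
        (nat (suc c) * nat ℓ) * y ≈⟨ *-congʳ (nat-* (suc c) ℓ) ⟨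
        nat (suc c ℕ.* ℓ) * y ≡⟨ cong (λ n → nat n * y) e ⟨
        nat k * y ≈⟨ eq ⟩
        nat t ≡⟨ cong nat e′ ⟩
        nat (d ℕ.* ℓ) ≈⟨ nat-* d ℓ ⟩
        nat d * nat ℓ ≈⟨ *-comm _ _ ⟩
        nat ℓ * nat d ∎
      cancelled : nat (suc c) * y ≈ nat d
      cancelled = nat-cancel (proj₁ ℓ-nonZero)
        (subst (λ m → nat m * (nat (suc c) * y) ≈ nat m * nat d) (proj₂ ℓ-nonZero) scaled)
    -- Impossible for integral y: v(k y) ≥ 1, whereas v(t) = 0.
    ... | yes (divides c e) | no ℓ∤t = contradiction
          (ℚₚ.<-≤-trans 0<1 (≼-finite⁻¹ (v-nat-unit t ℓ∤t) (≼-cong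
            (trans (solve 3 (λ l c y → l :* (c :* y) := (c :* l) :* y) ≈-refl (nat ℓ) (nat c) y)
              (trans (*-congʳ (trans (sym (nat-* c ℓ)) (reflexive (cong nat (≡.sym e))))) eq))
            (ℓ-multiple (≼-*ˡ (integral-×# c) 0y)))))
          (ℚₚ.<-irrefl refl)

  φ-digit : ∀ r → 0ℚ ≼ φ r → HasDigit (φ r)
  φ-digit r 0r = go (fraction r)
    where
    go : IsFraction r → HasDigit (φ r)
    go (k , t , inj₁ e) = fraction-digit k t (φ r) 0r e
    go (k , t , inj₂ e) = negative (fraction-digit k t (- φ r) (≼-neg 0r) (trans
      (solve 2 (λ k r → k :* :- r := :- (k :* r)) ≈-refl (nat (suc k)) (φ r))
      (trans (-‿cong e) (solve 1 (λ t → :- :- t := t) ≈-refl (nat t)))))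
      where
      negative : HasDigit (- φ r) → HasDigit (φ r)
      negative (c , d) = negative-digit (φ r) c
        (≼-cong (solve 2 (λ r c → :- (:- r :- c) := r :+ c) ≈-refl (φ r) (nat c)) (≼-neg d))

  -- The residue field of ℚ_ℓ is represented by 0, ..., ℓ - 1: by density x is congruent to a
  -- rational number, which has a natural number as residue, and that number is reduced modulo ℓ.
  digit : ∀ x → 0ℚ ≼ j x → ∃ λ (c : Fin ℓ) → 1ℚ ≼ j x - nat (toℕ c)
  digit x 0x = Fin.fromℕ< c%ℓ<ℓ , subst (λ m → 1ℚ ≼ j x - nat m) (≡.sym (Finₚ.toℕ-fromℕ< c%ℓ<ℓ)) reduced
    where
    instance _ = prime⇒nonZero ℓ-prime
    d = dense x 1ℚ
    r = proj₁ d
    near : 1ℚ ≼ j x - φ r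
    near = ≼-cong (j.sub-homo x (fromℚ r)) (proj₂ d)
    0r : 0ℚ ≼ φ r
    0r = ≼-recover (φ r) (j x) (≼-weaken 0≤1 (≼-swap (j x) (φ r) near)) 0x
    c = proj₁ (φ-digit r 0r)
    c%ℓ<ℓ : c % ℓ ℕ.< ℓ
    c%ℓ<ℓ = m%n<n c ℓ
    c≈ : nat c ≈ nat (c % ℓ) + nat ℓ * nat (c / ℓ)
    c≈ = trans (reflexive (cong nat (m≡m%n+[m/n]*n c ℓ))) (trans (nat-+ (c % ℓ) _)
      (+-congˡ (trans (nat-* (c / ℓ) ℓ) (*-comm _ _))))
    reduced : 1ℚ ≼ j x - nat (c % ℓ)
    reduced = ≼-triangle (j x) (φ r) (nat (c % ℓ)) near (≼-triangle (φ r) (nat c) (nat (c % ℓ)) (proj₂ (φ-digit r 0r))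
      (≼-cong (trans (solve 2 (λ y z → z := (y :+ z) :- y) ≈-refl (nat (c % ℓ)) (nat ℓ * nat (c / ℓ))) (+-congʳ (sym c≈)))
        (ℓ-multiple (integral-×# (c / ℓ)))))

-- Completeness of finite-dimensional ℚ_ℓ-subspaces.

module Spans {ℓ : ℕ} {a b : Level} (ℓ-prime : Prime ℓ) (E : UnramifiedExtension ℓ a b) where
  open UnramifiedExtension E
  open IsCompletionOfℚ isCompletionOfℚ using (fromℚ; complete)
  open K̄ hiding (inverse; sum) renaming (refl to ≈-refl)
  open Valued K̄ v isValuation
  open Antidiagonal K̄.commutativeRing
  open Estimates K̄ v isValuation
  open IntegerSolver K̄.commutativeRing
  open ℓ-Adic ℓ-prime E
  module Qₗ = Valued ℚₗ vℚₗ (IsCompletionOfℚ.isValuation isCompletionOfℚ)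

  private
    Conv = _⟶_ K̄ v

  π π⁻¹ : ℚₗ.Carrier
  π = fromℚ (+ ℓ ℚ./ 1)
  π⁻¹ = proj₁ (Qₗ.inverse (IsCompletionOfℚ.v-ℓ isCompletionOfℚ))

  v-π : v (j π) ≡ [ 1ℚ ]
  v-π = IsCompletionOfℚ.v-ℓ isCompletionOfℚ

  ππ⁻¹ : j π * j π⁻¹ ≈ 1#
  ππ⁻¹ = trans (sym (j.*-homo π π⁻¹)) (trans (j.⟦⟧-cong (proj₂ (Qₗ.inverse (IsCompletionOfℚ.v-ℓ isCompletionOfℚ)))) j.1#-homo)

  ϖ : ℕ → ℚₗ.Carrier
  ϖ N = π ℚₗ.^ N

  ϖ⁻ : ℕ → ℚₗ.Carrier
  ϖ⁻ N = π⁻¹ ℚₗ.^ N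

  jϖ-suc : ∀ N → j (ϖ (suc N)) ≈ j π * j (ϖ N)
  jϖ-suc N = j.*-homo π (ϖ N)

  jϖ⁻-suc : ∀ N → j (ϖ⁻ (suc N)) ≈ j π⁻¹ * j (ϖ⁻ N)
  jϖ⁻-suc N = j.*-homo π⁻¹ (ϖ⁻ N)

  ϖϖ⁻ : ∀ N → j (ϖ N) * j (ϖ⁻ N) ≈ 1#
  ϖϖ⁻ zero = trans (*-cong j.1#-homo j.1#-homo) (*-identityˡ 1#)
  ϖϖ⁻ (suc N) = begin
    j (ϖ (suc N)) * j (ϖ⁻ (suc N)) ≈⟨ *-cong (jϖ-suc N) (jϖ⁻-suc N) ⟩
    (j π * j (ϖ N)) * (j π⁻¹ * j (ϖ⁻ N))
      ≈⟨ solve 4 (λ p P q Q → (p :* P) :* (q :* Q) := (p :* q) :* (P :* Q)) ≈-refl _ _ _ _ ⟩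
    (j π * j π⁻¹) * (j (ϖ N) * j (ϖ⁻ N)) ≈⟨ *-cong ππ⁻¹ (ϖϖ⁻ N) ⟩
    1# * 1# ≈⟨ *-identityˡ 1# ⟩
    1# ∎
    where open SetoidReasoning setoid

  v-ϖ : ∀ N → v (j (ϖ N)) ≡ [ N • 1ℚ ]
  v-ϖ N = ≡.trans (v-cong (j.^-homo π N)) (v-^ N v-π)

  v-ϖ⁻ : ∀ N → v (j (ϖ⁻ N)) ≡ [ ℚ.- (N • 1ℚ) ]
  v-ϖ⁻ N = v-inverse (v-ϖ N) (ϖϖ⁻ N)

  ≼-ϖ* : ∀ {q x} N → q ≼ x → N • 1ℚ ℚ.+ q ≼ j (ϖ N) * x
  ≼-ϖ* N qx = ≼-* (≼-finite (v-ϖ N) ℚₚ.≤-refl) qx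

  integral-ϖ⁻* : ∀ {x} N → N • 1ℚ ≼ x → 0ℚ ≼ j (ϖ⁻ N) * x
  integral-ϖ⁻* {x} N Nx = subst (_≼ j (ϖ⁻ N) * x) (ℚₚ.+-inverseˡ (N • 1ℚ)) (≼-* (≼-finite (v-ϖ⁻ N) ℚₚ.≤-refl) Nx)

  clears : ∀ x → ∃ λ N → 1ℚ ≼ j (ϖ N) * x
  clears x = go (zero-or-finite x)
    where
    go : ZeroOrFinite x → ∃ λ N → 1ℚ ≼ j (ϖ N) * x
    go (inj₁ x≈0) = 0 , ≼-≈0 (trans (*-congˡ x≈0) (zeroʳ _))
    go (inj₂ (q , vx)) = N , ≼-finite (v-*-finite (v-ϖ N) vx)
      (subst (ℚ._≤ N • 1ℚ ℚ.+ q) (x-y+y≈x 1ℚ q) (ℚₚ.+-monoˡ-≤ q (proj₂ bound)))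
      where
      bound = ≤-natural (1ℚ ℚ.- q)
      N = proj₁ bound

  Span : List Carrier → Carrier → Set (a ⊔ b)
  Span [] x = Lift a (x ≈ 0#)
  Span (e ∷ es) x = ∃ λ c → ∃ λ w → Span es w × x ≈ w + j c * e

  span-cong : ∀ es {x y} → x ≈ y → Span es x → Span es y
  span-cong [] x≈y (lift x≈0) = lift (trans (sym x≈y) x≈0)
  span-cong (e ∷ es) x≈y (c , w , sw , eq) = c , w , sw , trans (sym x≈y) eq

  span-0 : ∀ es → Span es 0#
  span-0 [] = lift ≈-refl
  span-0 (e ∷ es) = ℚₗ.0# , 0# , span-0 es ,
    sym (trans (+-identityˡ _) (trans (*-congʳ j.0#-homo) (zeroˡ e)))

  span-+ : ∀ es {x y} → Span es x → Span es y → Span es (x + y)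
  span-+ [] (lift x≈0) (lift y≈0) = lift (trans (+-cong x≈0 y≈0) (+-identityˡ 0#))
  span-+ (e ∷ es) (c , w , sw , eq) (c′ , w′ , sw′ , eq′) = c ℚₗ.+ c′ , w + w′ , span-+ es sw sw′ ,
    trans (+-cong eq eq′) (trans
      (solve 5 (λ w c w′ c′ e → (w :+ c :* e) :+ (w′ :+ c′ :* e) := (w :+ w′) :+ (c :+ c′) :* e) ≈-refl w (j c) w′ (j c′) e)
      (+-congˡ (*-congʳ (sym (j.+-homo c c′)))))

  span-* : ∀ es c {x} → Span es x → Span es (j c * x)
  span-* [] c (lift x≈0) = lift (trans (*-congˡ x≈0) (zeroʳ _))
  span-* (e ∷ es) c (c′ , w , sw , eq) = c ℚₗ.* c′ , j c * w , span-* es c sw ,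
    trans (*-congˡ eq) (trans
      (solve 4 (λ c w c′ e → c :* (w :+ c′ :* e) := c :* w :+ (c :* c′) :* e) ≈-refl (j c) w (j c′) e)
      (+-congˡ (*-congʳ (sym (j.*-homo c c′)))))

  span-neg : ∀ es {x} → Span es x → Span es (- x)
  span-neg es {x} sx = span-cong es (trans (*-congʳ (trans (j.-‿homo ℚₗ.1#) (-‿cong j.1#-homo)))
    (solve 1 (λ x → (:- :1) :* x := :- x) ≈-refl x)) (span-* es (ℚₗ.- ℚₗ.1#) sx)

  span-tail : ∀ e es {x} → Span es x → Span (e ∷ es) x
  span-tail e es {x} sx = ℚₗ.0# , x , sx , sym (trans (+-congˡ (trans (*-congʳ j.0#-homo) (zeroˡ e))) (+-identityʳ x))

  natₗ : ℕ → ℚₗ.Carrier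
  natₗ n = fromℚ (+ n ℚ./ 1)

  j-natₗ : ∀ n → j (natₗ n) ≈ nat n
  j-natₗ n = sym (nat≈φ n)

  -- Congruence modulo ℓ to a combination of the g i with digits 0, ..., ℓ - 1. Being a finite
  -- search over decidable conditions, it is decidable, which lets `near` work with approximations
  -- known only up to double negation.
  Digits : ∀ {m} → Vector Carrier m → Carrier → Set
  Digits {zero} g x = 1ℚ ≼ x
  Digits {suc m} g x = ∃ λ (c : Fin ℓ) → Digits (g ∘ Fin.suc) (x - nat (toℕ c) * g Fin.zero)

  digits? : ∀ {m} (g : Vector Carrier m) x → Dec (Digits g x)
  digits? {zero} g x = 1ℚ ≼? x
  digits? {suc m} g x = Finₚ.any? λ c → digits? (g ∘ Fin.suc) _

  digits-close : ∀ {m} (g : Vector Carrier m) x y → 1ℚ ≼ y - x → Digits g x → Digits g y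
  digits-close {zero} g x y d dx = ≼-recover y x d dx
  digits-close {suc m} g x y d (c , dx) = c , digits-close (g ∘ Fin.suc) _ _
    (≼-cong (solve 3 (λ x y z → y :- x := (y :- z) :- (x :- z)) ≈-refl x y _) d) dx

  combination : ∀ {m} → Vector Carrier m → Vector ℚₗ.Carrier m → Carrier
  combination g c = sum (λ i → j (c i) * g i)

  digits-combination : ∀ {m} (g : Vector Carrier m) x → Digits g x →
    ∃ λ c → (∀ i → 0ℚ ≼ j (c i)) × 1ℚ ≼ x - combination g c
  digits-combination {zero} g x dx = (λ ()) , (λ ()) , ≼-cong (solve 1 (λ x → x := x :- :0) ≈-refl x) dx
  digits-combination {suc m} g x (d , dx) with digits-combination (g ∘ Fin.suc) _ dx
  ... | c , ic , near = (λ { Fin.zero → natₗ (toℕ d) ; (Fin.suc i) → c i }) ,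
    (λ { Fin.zero → ≼-cong (sym (j-natₗ (toℕ d))) (integral-×# (toℕ d)) ; (Fin.suc i) → ic i }) ,
    ≼-cong (trans (solve 3 (λ x y z → (x :- y) :- z := x :- (y :+ z)) ≈-refl x _ _)
      (+-congˡ (-‿cong (+-congʳ (*-congʳ (sym (j-natₗ (toℕ d)))))))) near

  -- Elements of the lattice of integral elements of the span that generate it modulo ℓ. Dividing
  -- the remainder by ℓ and repeating gives ℓ-adic expansions, from which completeness follows.
  -- Linear independence is not demanded.
  record Generators (es : List Carrier) : Set (a ⊔ b) where
    field
      {size}   : ℕ
      gen      : Vector Carrier size
      gen-span : ∀ i → Span es (gen i)
      integral : ∀ i → 0ℚ ≼ gen i
      digits   : ∀ x → Span es x → 0ℚ ≼ x → Digits gen x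

  -- ℓ^N e and e span the same line, so the adjoined element may be taken integral.
  generators-rescale : ∀ {e} es N → Generators (j (ϖ N) * e ∷ es) → Generators (e ∷ es)
  generators-rescale {e} es N G = record
    { gen = gen
    ; gen-span = λ i → unscale (gen-span i)
    ; integral = integral
    ; digits = λ x (c , w , sw , eq) → digits x (c ℚₗ.* ϖ⁻ N , w , sw , trans eq (+-congˡ (sym (begin
        j (c ℚₗ.* ϖ⁻ N) * (j (ϖ N) * e) ≈⟨ *-congʳ (j.*-homo c (ϖ⁻ N)) ⟩
        (j c * j (ϖ⁻ N)) * (j (ϖ N) * e)
          ≈⟨ solve 4 (λ c q p e → (c :* q) :* (p :* e) := (p :* q) :* (c :* e)) ≈-refl (j c) (j (ϖ⁻ N)) (j (ϖ N)) e ⟩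
        (j (ϖ N) * j (ϖ⁻ N)) * (j c * e) ≈⟨ *-congʳ (ϖϖ⁻ N) ⟩
        1# * (j c * e) ≈⟨ *-identityˡ _ ⟩
        j c * e ∎))))
    }
    where
    open Generators G
    open SetoidReasoning setoid
    unscale : ∀ {x} → Span (j (ϖ N) * e ∷ es) x → Span (e ∷ es) x
    unscale (c , w , sw , eq) = c ℚₗ.* ϖ N , w , sw , trans eq (+-congˡ (trans (sym (*-assoc _ _ _)) (*-congʳ (sym (j.*-homo c (ϖ N))))))

  module Adjoin-generator {e} (es : List Carrier) (0e : 0ℚ ≼ e) (G : Generators es) where
    open Generators G

    -- Q N says that the distance from e to the span of es is at most ∣ℓ^N∣.
    Q : ℕ → Set (a ⊔ b)
    Q N = ∃ λ w → Span es w × 0ℚ ≼ w + j (ϖ⁻ N) * e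

    Q0 : Q 0
    Q0 = 0# , span-0 es , ≼-cong (sym (trans (+-identityˡ _) (trans (*-congʳ j.1#-homo) (*-identityˡ e)))) 0e

    -- With N the last index satisfying `Q`, the element h = w + ℓ^(-N) e completes the generators.
    -- An integral x = w′ + c e equals y + c̃ h with y in the old span and c̃ = c ℓ^N; by maximality
    -- of N the coordinate c̃ is integral, so y is integral too and has digits.
    far : ∀ N → Q N → ¬ Q (suc N) → Generators (e ∷ es)
    far N (w , sw , ih) ¬Q = record
      { gen = λ { Fin.zero → h ; (Fin.suc i) → gen i }
      ; gen-span = λ { Fin.zero → ϖ⁻ N , w , sw , ≈-refl ; (Fin.suc i) → span-tail e es (gen-span i) }
      ; integral = λ { Fin.zero → ih ; (Fin.suc i) → integral i }
      ; digits = digits′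
      }
      where
      h = w + j (ϖ⁻ N) * e

      module _ (x : Carrier) (c : ℚₗ.Carrier) (w′ : Carrier) (sw′ : Span es w′) (eq : x ≈ w′ + j c * e) (0x : 0ℚ ≼ x) where
        c̃ : ℚₗ.Carrier
        c̃ = c ℚₗ.* ϖ N

        jc̃ : j c̃ ≈ j c * j (ϖ N)
        jc̃ = j.*-homo c (ϖ N)

        c̃-integral : 0ℚ ≼ j c̃
        c̃-integral = decidable-stable (0ℚ ≼? j c̃) λ not → ¬Q (contra not)
          where
          contra : ¬ (0ℚ ≼ j c̃) → Q (suc N)
          contra not = j u * w′ , span-* es u sw′ , ≼-cong ux≈ (≼-*ˡ u-integral 0x)
            where
            c̃-finite : ∃ λ r → v (j c̃) ≡ [ r ]
            c̃-finite = ≉0⇒finite λ c̃≈0 → not (≼-≈0 c̃≈0)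
            r = proj₁ c̃-finite
            r<0 : r ℚ.< 0ℚ
            r<0 = ℚₚ.≰⇒> λ 0≤r → not (≼-finite (proj₂ c̃-finite) 0≤r)
            1≤-r : 1ℚ ℚ.≤ ℚ.- r
            1≤-r = integer-0<⇒1≤ (integer-neg (v-ℚₗ-integer c̃ (proj₂ c̃-finite))) (ℚₚ.neg-antimono-< r<0)
            inv = Qₗ.inverse {c̃} (proj₂ c̃-finite)
            -- u = (ℓ c̃)⁻¹ is integral because v(c̃) is a negative integer. The integral element u
            -- x has e-coefficient ℓ^(-N-1), which is `Q (suc N)`.
            u = proj₁ inv ℚₗ.* π⁻¹
            c̃inv : j c̃ * j (proj₁ inv) ≈ 1#
            c̃inv = trans (sym (j.*-homo c̃ (proj₁ inv))) (trans (j.⟦⟧-cong (proj₂ inv)) j.1#-homo)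
            u-integral : 0ℚ ≼ j u
            u-integral = ≼-cong (sym (j.*-homo (proj₁ inv) π⁻¹)) (≼-finite
              (v-*-finite (v-inverse (proj₂ c̃-finite) c̃inv) (v-inverse v-π ππ⁻¹)) (0≤q-p 1≤-r))
            ux≈ : j u * x ≈ j u * w′ + j (ϖ⁻ (suc N)) * e
            ux≈ = begin
              j u * x ≈⟨ *-congˡ eq ⟩
              j u * (w′ + j c * e) ≈⟨ solve 4 (λ u w c e → u :* (w :+ c :* e) := u :* w :+ (u :* c :* :1) :* e) ≈-refl (j u) w′ (j c) e ⟩
              j u * w′ + (j u * j c * 1#) * e ≈⟨ +-congˡ (*-congʳ (*-cong (*-congʳ (j.*-homo _ _)) (sym (ϖϖ⁻ N)))) ⟩
              j u * w′ + ((i * p) * j c * (P * P⁻)) * e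
                ≈⟨ solve 7 (λ uw i p c P Q e → uw :+ ((i :* p) :* c :* (P :* Q)) :* e := uw :+ ((c :* P) :* i) :* (p :* Q) :* e) ≈-refl (j u * w′) i p (j c) P P⁻ e ⟩
              j u * w′ + ((j c * P) * i) * (p * P⁻) * e ≈⟨ +-congˡ (*-congʳ (*-cong (trans (*-congʳ (sym jc̃)) c̃inv) (sym (jϖ⁻-suc N)))) ⟩
              j u * w′ + 1# * j (ϖ⁻ (suc N)) * e ≈⟨ +-congˡ (*-congʳ (*-identityˡ _)) ⟩
              j u * w′ + j (ϖ⁻ (suc N)) * e ∎
              where
              open SetoidReasoning setoid
              i = j (proj₁ inv)
              p = j π⁻¹
              P = j (ϖ N)
              P⁻ = j (ϖ⁻ N)

        y = w′ - j c̃ * w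

        y≈ : y ≈ x - j c̃ * h
        y≈ = begin
          w′ - j c̃ * w ≈⟨ solve 4 (λ w′ c w e → w′ :- c :* w := (w′ :+ e) :- (c :* w :+ e)) ≈-refl w′ (j c̃) w (j c * e) ⟩
          (w′ + j c * e) - (j c̃ * w + j c * e) ≈⟨ +-cong (sym eq) (-‿cong (+-congˡ ce≈)) ⟩
          x - (j c̃ * w + j c̃ * (j (ϖ⁻ N) * e)) ≈⟨ +-congˡ (-‿cong (sym (distribˡ _ _ _))) ⟩
          x - j c̃ * h ∎
          where
          open SetoidReasoning setoid
          ce≈ : j c * e ≈ j c̃ * (j (ϖ⁻ N) * e)
          ce≈ = begin
            j c * e ≈⟨ *-identityˡ _ ⟨
            1# * (j c * e) ≈⟨ *-congʳ (ϖϖ⁻ N) ⟨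
            j (ϖ N) * j (ϖ⁻ N) * (j c * e)
              ≈⟨ solve 4 (λ c q p e → (p :* q) :* (c :* e) := (c :* p) :* (q :* e)) ≈-refl (j c) (j (ϖ⁻ N)) (j (ϖ N)) e ⟩
            j c * j (ϖ N) * (j (ϖ⁻ N) * e) ≈⟨ *-congʳ jc̃ ⟨
            j c̃ * (j (ϖ⁻ N) * e) ∎

        y-digits : Digits gen y
        y-digits = digits y (span-+ es sw′ (span-neg es (span-* es c̃ sw)))
          (≼-cong (sym y≈) (≼-sub 0x (≼-*ˡ c̃-integral ih)))

        result : ∃ λ (d : Fin ℓ) → Digits gen (x - nat (toℕ d) * h)
        -- Replacing c̃ by its digit changes y = x - c̃ h by an element of valuation at least 1, as
        -- h is integral.
        result = proj₁ d , digits-close gen y _ (≼-cong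
          (trans (solve 4 (λ x c n h → (c :- n) :* h := (x :- n :* h) :- (x :- c :* h)) ≈-refl x (j c̃) (nat (toℕ (proj₁ d))) h)
            (+-congˡ (-‿cong (sym y≈))))
          (≼-*ʳ (proj₂ d) ih)) y-digits
          where d = digit c̃ c̃-integral

      digits′ : ∀ x → Span (e ∷ es) x → 0ℚ ≼ x → ∃ λ (d : Fin ℓ) → Digits gen (x - nat (toℕ d) * h)
      digits′ x (c , w′ , sw′ , eq) 0x = result x c w′ sw′ eq 0x

    -- Here e is a limit of elements of the old span. With N so large that c ℓ^N has valuation at
    -- least 1, the element x = w + c e is congruent modulo ℓ to an integral element of the old
    -- span, and the old generators suffice.
    near : (∀ N → ¬ ¬ Q N) → Generators (e ∷ es)
    near q = record
      { gen = gen
      ; gen-span = λ i → span-tail e es (gen-span i)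
      ; integral = integral
      ; digits = λ x (c , w , sw , eq) 0x → decidable-stable (digits? gen x) λ not →
          q (proj₁ (clears (j c))) λ (w′ , sw′ , iw′) → not (close x c w sw eq 0x (proj₁ (clears (j c))) (proj₂ (clears (j c))) w′ sw′ iw′)
      }
      where
      close : ∀ x c w → Span es w → x ≈ w + j c * e → 0ℚ ≼ x → ∀ N → 1ℚ ≼ j (ϖ N) * j c →
        ∀ w′ → Span es w′ → 0ℚ ≼ w′ + j (ϖ⁻ N) * e → Digits gen x
      close x c w sw eq 0x N cN w′ sw′ iw′ = digits-close gen y x x-y (digits y
        (span-+ es sw (span-neg es (span-cong es (*-congʳ (j.*-homo c (ϖ N))) (span-* es (c ℚₗ.* ϖ N) sw′))))
        (≼-recover y x (≼-swap x y (≼-weaken 0≤1 x-y)) 0x))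
        where
        y = w - j c * j (ϖ N) * w′
        x-y : 1ℚ ≼ x - y
        x-y = ≼-cong (begin
          (j (ϖ N) * j c) * (w′ + j (ϖ⁻ N) * e)
            ≈⟨ solve 6 (λ P c w w′ Q e → (P :* c) :* (w′ :+ Q :* e) := (w :+ (P :* Q) :* (c :* e)) :- (w :- c :* P :* w′)) ≈-refl (j (ϖ N)) (j c) w w′ (j (ϖ⁻ N)) e ⟩
          (w + j (ϖ N) * j (ϖ⁻ N) * (j c * e)) - y ≈⟨ +-congʳ (+-congˡ (trans (*-congʳ (ϖϖ⁻ N)) (*-identityˡ _))) ⟩
          (w + j c * e) - y ≈⟨ +-congʳ (sym eq) ⟩
          x - y ∎) (≼-*ʳ cN iw′)
          where open SetoidReasoning setoid

    -- If no generators existed, `far` would exclude that `Q` stops holding at some N; so `Q` would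
    -- hold throughout, up to double negation, and `near` would give generators.
    generators : ¬ ¬ Generators (e ∷ es)
    generators k = k (near all)
      where
      all : ∀ N → ¬ ¬ Q N
      all zero ¬q = ¬q Q0
      all (suc N) ¬q = all N λ q → k (far N q ¬q)

  generators : ∀ es → ¬ ¬ Generators es
  generators [] k = k (record { gen = λ () ; gen-span = λ () ; integral = λ () ; digits = λ x (lift x≈0) _ → ≼-≈0 x≈0 })
  generators (e ∷ es) k = generators es λ G →
    Adjoin-generator.generators es (≼-weaken 0≤1 (proj₂ (clears e))) G λ G′ →
    k (generators-rescale es (proj₁ (clears e)) G′)

  module Limit (es : List Carrier) (G : Generators es) (S : ℕ → Carrier) (S-span : ∀ N → Span es (S N))
    (S-integral : ∀ N → 0ℚ ≼ S N) (cauchy : IsCauchy K̄ v S) where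
    open Generators G

    -- A monotone modulus: from `index k` on, S is constant modulo ℓ^k. For k = 0 any index will do,
    -- since all terms are integral.
    index : ℕ → ℕ
    index zero = 0
    index (suc k) = index k ℕ.⊔ proj₁ (cauchy (suc k • 1ℚ))

    s : ℕ → Carrier
    s k = S (index k)

    index-mono : ∀ k → index k ℕ.≤ index (suc k)
    index-mono k = ℕₚ.m≤m⊔n _ _

    s-close : ∀ k N → index k ℕ.≤ N → k • 1ℚ ≼ S N - s k
    s-close zero N le = ≼-sub (S-integral N) (S-integral (index 0))
    s-close (suc k) N le = proj₂ (cauchy (suc k • 1ℚ)) N (index (suc k))
      (ℕₚ.≤-trans (ℕₚ.m≤n⊔m _ _) le) (ℕₚ.m≤n⊔m _ _)

    combination-span : ∀ {m} (g : Vector Carrier m) → (∀ i → Span es (g i)) → ∀ c → Span es (combination g c)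
    combination-span {zero} g sg c = span-0 es
    combination-span {suc m} g sg c = span-+ es (span-* es (c Fin.zero) (sg Fin.zero))
      (combination-span (g ∘ Fin.suc) (sg ∘ Fin.suc) (c ∘ Fin.suc))

    Approximation : ℕ → Set a
    Approximation k = ∃ λ (A : Vector ℚₗ.Carrier size) → k • 1ℚ ≼ s k - combination gen A

    combination-0 : ∀ {m} (g : Vector Carrier m) → combination g (λ _ → ℚₗ.0#) ≈ 0#
    combination-0 {m} g = trans (sum-cong {m} λ i → trans (*-congʳ j.0#-homo) (zeroˡ (g i))) (L-0 (sum-additive m))

    combination-shift : ∀ {m} (g : Vector Carrier m) A u c →
      combination g (λ i → A i ℚₗ.+ u ℚₗ.* c i) ≈ combination g A + j u * combination g c
    combination-shift {m} g A u c = trans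
      (sum-cong {m} λ i → trans (*-congʳ (trans (j.+-homo _ _) (+-congˡ (j.*-homo _ _))))
        (solve 4 (λ A u c g → (A :+ u :* c) :* g := A :* g :+ u :* (c :* g)) ≈-refl (j (A i)) (j u) (j (c i)) (g i)))
      (trans (L-+ (sum-additive m) _ _) (+-congˡ (sym (*-sum g c))))
      where
      *-sum : ∀ {m} (g : Vector Carrier m) c → j u * combination g c ≈ sum (λ i → j u * (j (c i) * g i))
      *-sum g c = L-sum (*-additive (j u)) (λ i _ → j (c i) * g i)

    -- One more ℓ-adic digit. The error of the k-th approximation, divided by ℓ^k, is an integral
    -- element of the span and is expanded modulo ℓ by the generators. The coordinates move by
    -- multiples of ℓ^k only, so they form Cauchy sequences in ℚ_ℓ.
    refine : ∀ k → ((A , _) : Approximation k) →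
      ∃ λ ((A′ , _) : Approximation (suc k)) → ∀ i → k • 1ℚ ≼ j (A′ i) - j (A i)
    refine k (A , near) = (A′ , near′) , λ i → ≼-cong (A′-A i) (subst (_≼ j (ϖ k) * j (c i)) (ℚₚ.+-identityʳ (k • 1ℚ)) (≼-ϖ* k (ic i)))
      where
      x = s (suc k) - combination gen A
      x-small : k • 1ℚ ≼ x
      x-small = ≼-triangle (s (suc k)) (s k) (combination gen A) (s-close k _ (index-mono k)) near
      y = j (ϖ⁻ k) * x
      dc = digits-combination gen y (digits y
        (span-* es (ϖ⁻ k) (span-+ es (S-span _) (span-neg es (combination-span gen gen-span A)))) (integral-ϖ⁻* k x-small))
      c = proj₁ dc
      ic = proj₁ (proj₂ dc)
      A′ : Vector ℚₗ.Carrier size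
      A′ i = A i ℚₗ.+ ϖ k ℚₗ.* c i
      A′-A : ∀ i → j (ϖ k) * j (c i) ≈ j (A′ i) - j (A i)
      A′-A i = trans (solve 3 (λ A u c → u :* c := (A :+ u :* c) :- A) ≈-refl (j (A i)) (j (ϖ k)) (j (c i)))
        (+-congʳ (sym (trans (j.+-homo _ _) (+-congˡ (j.*-homo _ _)))))
      near′ : suc k • 1ℚ ≼ s (suc k) - combination gen A′
      near′ = ≼-cong (begin
        j (ϖ k) * (y - combination gen c)
          ≈⟨ solve 4 (λ P Q x C → P :* (Q :* x :- C) := (P :* Q) :* x :- P :* C) ≈-refl (j (ϖ k)) (j (ϖ⁻ k)) x (combination gen c) ⟩
        (j (ϖ k) * j (ϖ⁻ k)) * x - j (ϖ k) * combination gen c ≈⟨ +-congʳ (trans (*-congʳ (ϖϖ⁻ k)) (*-identityˡ x)) ⟩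
        x - j (ϖ k) * combination gen c
          ≈⟨ solve 3 (λ s A C → (s :- A) :- C := s :- (A :+ C)) ≈-refl (s (suc k)) (combination gen A) _ ⟩
        s (suc k) - (combination gen A + j (ϖ k) * combination gen c) ≈⟨ +-congˡ (-‿cong (combination-shift gen A (ϖ k) c)) ⟨
        s (suc k) - combination gen A′ ∎)
        (subst (_≼ j (ϖ k) * (y - combination gen c)) (ℚₚ.+-comm (k • 1ℚ) 1ℚ) (≼-ϖ* k (proj₂ (proj₂ dc))))
        where open SetoidReasoning setoid

    approximation : ∀ k → Approximation k
    approximation zero = (λ _ → ℚₗ.0#) , ≼-sub (S-integral _) (≼-≈0 (combination-0 gen))
    approximation (suc k) = proj₁ (refine k (approximation k))

    A : ℕ → Vector ℚₗ.Carrier size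
    A k = proj₁ (approximation k)

    A-close : ∀ i {k N} → k ℕ.≤′ N → k • 1ℚ ≼ j (A N i) - j (A k i)
    A-close i ℕ.≤′-refl = ≼-≈0 (-‿inverseʳ _)
    A-close i {k} (ℕ.≤′-step {N} le) = ≼-triangle (j (A (suc N) i)) (j (A N i)) (j (A k i))
      (≼-weaken (•-monoˡ {1ℚ} {k} {N} 0≤1 (ℕₚ.≤′⇒≤ le)) (proj₂ (refine N (approximation N)) i)) (A-close i le)

    A-cauchy : ∀ i → IsCauchy ℚₗ vℚₗ (λ k → A k i)
    A-cauchy i q = k , λ m n k≤m k≤n → ≼-cong (sym (j.sub-homo (A m i) (A n i)))
      (≼-triangle (j (A m i)) (j (A k i)) (j (A n i))
        (≼-weaken (proj₂ (≤-natural q)) (A-close i (ℕₚ.≤⇒≤′ k≤m)))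
        (≼-swap (j (A n i)) (j (A k i)) (≼-weaken (proj₂ (≤-natural q)) (A-close i (ℕₚ.≤⇒≤′ k≤n)))))
      where k = proj₁ (≤-natural q)

    limitₗ : Vector ℚₗ.Carrier size
    limitₗ i = proj₁ (complete (λ k → A k i) (A-cauchy i))

    limit : Carrier
    limit = combination gen limitₗ

    combination-close : ∀ {q m} (g : Vector Carrier m) c c′ → (∀ i → 0ℚ ≼ g i) → (∀ i → q ≼ j (c i) - j (c′ i)) →
      q ≼ combination g c - combination g c′
    combination-close {m = zero} g c c′ ig d = ≼-≈0 (-‿inverseʳ _)
    combination-close {m = suc m} g c c′ ig d = ≼-cong
      (solve 5 (λ c c′ g x y → (c :- c′) :* g :+ (x :- y) := (c :* g :+ x) :- (c′ :* g :+ y)) ≈-refl _ _ (g Fin.zero) _ _)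
      (≼-+ (≼-*ʳ (d Fin.zero) (ig Fin.zero)) (combination-close (g ∘ Fin.suc) (c ∘ Fin.suc) (c′ ∘ Fin.suc) (ig ∘ Fin.suc) (d ∘ Fin.suc)))

    converges : Conv S limit
    converges q = index k , λ N le → ≼-triangle (S N) (s k) limit
        (≼-weaken q≤k (s-close k N le))
        (≼-triangle (s k) (combination gen (A k)) limit (≼-weaken q≤k (proj₂ (approximation k)))
          (combination-close gen (A k) limitₗ integral λ i → ≼-cong (j.sub-homo (A k i) (limitₗ i))
            (proj₂ eventually k (ℕₚ.m≤n⊔m k₀ (proj₁ eventually)) i)))
      where
      eventually : Σ ℕ λ M → ∀ N → M ℕ.≤ N → ∀ i → [ q ] ≤⁺ vℚₗ (A N i ℚₗ.- limitₗ i)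
      eventually = eventually-all {P = λ i N → [ q ] ≤⁺ vℚₗ (A N i ℚₗ.- limitₗ i)} λ i → proj₂ (complete (λ k → A k i) (A-cauchy i)) q
      k₀ = proj₁ (≤-natural q)
      k = k₀ ℕ.⊔ proj₁ eventually
      q≤k : q ℚ.≤ k • 1ℚ
      q≤k = ℚₚ.≤-trans (proj₂ (≤-natural q)) (•-monoˡ {1ℚ} {k₀} {k} 0≤1 (ℕₚ.m≤m⊔n k₀ _))

  abstract
    span-complete : ∀ es → Generators es → ∀ S → (∀ N → Span es (S N)) → (∀ N → 0ℚ ≼ S N) →
      IsCauchy K̄ v S → ∃ λ z → Conv S z
    span-complete es G S S-span S-integral cauchy = Limit.limit es G S S-span S-integral cauchy ,
      Limit.converges es G S S-span S-integral cauchy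

-- Finite modules stable under given algebraic elements.

module FiniteExtensions {ℓ : ℕ} {a b : Level} (ℓ-prime : Prime ℓ) (E : UnramifiedExtension ℓ a b) where
  open UnramifiedExtension E
  open K̄ hiding (inverse; sum) renaming (refl to ≈-refl)
  open Valued K̄ v isValuation
  open Antidiagonal K̄.commutativeRing hiding (T; T-cong)
  open SeriesAlgebra K̄.commutativeRing using (_^ᵐ_)
  open PowerSeries K̄.rawRing using (sumDegree≤)
  open IntegerSolver K̄.commutativeRing
  open ℓ-Adic ℓ-prime E
  open Spans ℓ-prime E

  -- A K-subspace of K̄ containing 1 and of finite dimension over ℚ_ℓ. It stands in for the field
  -- K(x₁,...,xₘ): stability under multiplication by each xᵢ already puts all their monomials into
  -- it, and any monic equation for xᵢ provides that stability.
  record FiniteModule : Set (Level.suc (a ⊔ b)) where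
    field
      T       : Carrier → Set (a ⊔ b)
      T-cong  : ∀ {x y} → x ≈ y → T x → T y
      T-0     : T 0#
      T-1     : T 1#
      T-+     : ∀ {x y} → T x → T y → T (x + y)
      T-scale : ∀ k {x} → T x → T (ι k * x)
      basis   : List Carrier
      spans   : ∀ x → T x → Span basis x

  ClosedUnder : (Carrier → Set (a ⊔ b)) → Carrier → Set (a ⊔ b)
  ClosedUnder T u = ∀ {x} → T x → T (u * x)

  span-sum : ∀ {m} (e : Vector Carrier m) (c : Vector ℚₗ.Carrier m) → Span (List.tabulate e) (sum (λ i → j (c i) * e i))
  span-sum {zero} e c = lift ≈-refl
  span-sum {suc m} e c = c Fin.zero , sum (λ i → j (c (Fin.suc i)) * e (Fin.suc i)) , span-sum (e ∘ Fin.suc) (c ∘ Fin.suc) , +-comm _ _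

  base : FiniteModule
  base = record
    { T = λ x → ∃ λ k → Lift a (x ≈ ι k)
    ; T-cong = λ { x≈y (k , lift e) → k , lift (trans (sym x≈y) e) }
    ; T-0 = K.0# , lift (sym ι.0#-homo)
    ; T-1 = K.1# , lift (sym ι.1#-homo)
    ; T-+ = λ { (k , lift e) (k′ , lift e′) → k K.+ k′ , lift (trans (+-cong e e′) (sym (ι.+-homo k k′))) }
    ; T-scale = λ { k (k′ , lift e) → k K.* k′ , lift (trans (*-congˡ e) (sym (ι.*-homo k k′))) }
    ; basis = List.tabulate (λ i → ι (proj₁ (proj₂ finite) i))
    ; spans = λ { x (k , lift e) → span-cong (List.tabulate (λ i → ι (proj₁ (proj₂ finite) i)))
        (sym (trans e (trans (ι.⟦⟧-cong (proj₂ (proj₂ (proj₂ finite) k))) (trans (ι.sum-homo {proj₁ finite} _)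
          (sum-cong {proj₁ finite} λ i → ι.*-homo _ _)))))
        (span-sum (λ i → ι (proj₁ (proj₂ finite) i)) (proj₁ (proj₂ (proj₂ finite) k))) }
    }

  span-++ˡ : ∀ es fs {x} → Span es x → Span (es List.++ fs) x
  span-++ˡ [] fs (lift x≈0) = span-cong fs (sym x≈0) (span-0 fs)
  span-++ˡ (e ∷ es) fs (c , w , sw , eq) = c , w , span-++ˡ es fs sw , eq

  span-++ʳ : ∀ es fs {x} → Span fs x → Span (es List.++ fs) x
  span-++ʳ [] fs sx = sx
  span-++ʳ (e ∷ es) fs sx = span-tail e (es List.++ fs) (span-++ʳ es fs sx)

  span-map : ∀ u es {x} → Span es x → Span (List.map (u *_) es) (u * x)
  span-map u [] (lift x≈0) = lift (trans (*-congˡ x≈0) (zeroʳ u))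
  span-map u (e ∷ es) (c , w , sw , eq) = c , u * w , span-map u es sw ,
    trans (*-congˡ eq) (solve 4 (λ u w c e → u :* (w :+ c :* e) := u :* w :+ c :* (u :* e)) ≈-refl u w (j c) e)

  module Extend (M : FiniteModule) (x : Carrier) where
    open FiniteModule M

    -- Values at x of polynomials of degree < d with coefficients in `T`, in Horner form.
    Poly : ℕ → Carrier → Set (a ⊔ b)
    Poly zero    y = Lift a (y ≈ 0#)
    Poly (suc d) y = ∃ λ s → ∃ λ z → T s × Poly d z × y ≈ s + x * z

    poly-cong : ∀ d {y z} → y ≈ z → Poly d y → Poly d z
    poly-cong zero y≈z (lift e) = lift (trans (sym y≈z) e)
    poly-cong (suc d) y≈z (s , w , ts , pw , e) = s , w , ts , pw , trans (sym y≈z) e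

    poly-0 : ∀ d → Poly d 0#
    poly-0 zero = lift ≈-refl
    poly-0 (suc d) = 0# , 0# , T-0 , poly-0 d , solve 1 (λ x → :0 := :0 :+ x :* :0) ≈-refl x

    poly-+ : ∀ d {y z} → Poly d y → Poly d z → Poly d (y + z)
    poly-+ zero (lift e) (lift e′) = lift (trans (+-cong e e′) (+-identityˡ 0#))
    poly-+ (suc d) (s , w , ts , pw , e) (s′ , w′ , ts′ , pw′ , e′) = s + s′ , w + w′ , T-+ ts ts′ , poly-+ d pw pw′ ,
      trans (+-cong e e′) (solve 5 (λ s w s′ w′ x → (s :+ x :* w) :+ (s′ :+ x :* w′) := (s :+ s′) :+ x :* (w :+ w′)) ≈-refl s w s′ w′ x)

    poly-closed : ∀ d {u} → ClosedUnder T u → ClosedUnder (Poly d) u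
    poly-closed zero cu (lift e) = lift (trans (*-congˡ e) (zeroʳ _))
    poly-closed (suc d) {u} cu (s , w , ts , pw , e) = u * s , u * w , cu ts , poly-closed d cu pw ,
      trans (*-congˡ e) (solve 4 (λ u s x w → u :* (s :+ x :* w) := u :* s :+ x :* (u :* w)) ≈-refl u s x w)

    poly-spans : ∀ d → ∃ λ es → ∀ y → Poly d y → Span es y
    poly-spans zero = [] , λ y p → p
    poly-spans (suc d) = basis List.++ List.map (x *_) fs , λ { y (s , w , ts , pw , e) →
      span-cong (basis List.++ List.map (x *_) fs) (sym e) (span-+ (basis List.++ List.map (x *_) fs)
        (span-++ˡ basis _ (spans s ts)) (span-++ʳ basis _ (span-map x fs (proj₂ (poly-spans d) w pw)))) }
      where fs = proj₁ (poly-spans d)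

    poly-top : ∀ d {y} → Poly (suc d) y → ∃ λ s → ∃ λ z → T s × Poly d z × y ≈ z + s * x ^ d
    poly-top zero (s , w , ts , lift e′ , e) = s , 0# , ts , lift ≈-refl ,
      trans e (trans (+-congˡ (trans (*-congˡ e′) (zeroʳ x))) (solve 1 (λ s → s :+ :0 := :0 :+ s :* :1) ≈-refl s))
    poly-top (suc d) (s , w , ts , pw , e) with poly-top d pw
    ... | t , z , T-t , pz , e′ = t , s + x * z , T-t , (s , z , ts , pz , ≈-refl) ,
      trans e (trans (+-congˡ (*-congˡ e′))
        (solve 5 (λ s x z t X → s :+ x :* (z :+ t :* X) := (s :+ x :* z) :+ t :* (x :* X)) ≈-refl s x z t (x ^ d)))

    poly-eval : ∀ d (c : Vector K.Carrier d) {s} → T s → Poly d (s * sum (λ i → ι (c i) * x ^ toℕ i))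
    poly-eval zero c {s} ts = lift (zeroʳ s)
    poly-eval (suc d) c {s} ts = ι (c Fin.zero) * s , s * rest , T-scale (c Fin.zero) ts , poly-eval d (c ∘ Fin.suc) ts , (begin
      s * (ι (c Fin.zero) * 1# + sum (λ i → ι (c (Fin.suc i)) * (x * x ^ toℕ i)))
        ≈⟨ *-congˡ (+-congˡ (trans (sum-cong {d} λ i → solve 3 (λ c x y → c :* (x :* y) := x :* (c :* y)) ≈-refl _ x _)
             (sym (L-sum (*-additive x) {d} (λ i _ → ι (c (Fin.suc i)) * x ^ toℕ i))))) ⟩
      s * (ι (c Fin.zero) * 1# + x * rest)
        ≈⟨ solve 4 (λ s c x r → s :* (c :* :1 :+ x :* r) := c :* s :+ x :* (s :* r)) ≈-refl s (ι (c Fin.zero)) x rest ⟩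
      ι (c Fin.zero) * s + x * (s * rest) ∎)
      where
      open SetoidReasoning setoid
      rest = sum (λ i → ι (c (Fin.suc i)) * x ^ toℕ i)

    module _ (d : ℕ) (c : Vector K.Carrier d) (root : x ^ d + sum (λ i → ι (c i) * x ^ toℕ i) ≈ 0#) where

      T-neg : ∀ {y} → T y → T (- y)
      T-neg {y} ty = T-cong (trans (*-congʳ (trans (ι.-‿homo K.1#) (-‿cong ι.1#-homo))) (solve 1 (λ y → (:- :1) :* y := :- y) ≈-refl y)) (T-scale (K.- K.1#) ty)

      -- The monic equation replaces the leading term s x^d by -s times a polynomial of degree < d
      -- in x.
      poly-reduce : ∀ {y} → Poly (suc d) y → Poly d y
      poly-reduce {y} p with poly-top d p
      ... | s , z , ts , pz , e = poly-cong d (sym (begin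
        y ≈⟨ e ⟩
        z + s * x ^ d ≈⟨ solve 4 (λ z s X e → z :+ s :* X := (z :+ (:- s) :* e) :+ s :* (X :+ e)) ≈-refl z s (x ^ d) ev ⟩
        (z + - s * ev) + s * (x ^ d + ev) ≈⟨ +-congˡ (trans (*-congˡ root) (zeroʳ s)) ⟩
        (z + - s * ev) + 0# ≈⟨ +-identityʳ _ ⟩
        z + - s * ev ∎)) (poly-+ d pz (poly-eval d c (T-neg ts)))
        where
        open SetoidReasoning setoid
        ev = sum (λ i → ι (c i) * x ^ toℕ i)

      poly-x : ClosedUnder (Poly d) x
      poly-x {y} py = poly-reduce (0# , y , T-0 , py , sym (+-identityˡ _))

    poly-1 : ∀ d (c : Vector K.Carrier d) → x ^ d + sum (λ i → ι (c i) * x ^ toℕ i) ≈ 0# → Poly d 1#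
    -- For d = 0 the monic equation reads 1 = 0.
    poly-1 zero c root = ⊥-elim (0≉1 (sym (trans (sym (+-identityʳ 1#)) root)))
    poly-1 (suc d) c root = 1# , 0# , T-1 , poly-0 d , solve 1 (λ x → :1 := :1 :+ x :* :0) ≈-refl x

    extended : ∃ λ M′ → ClosedUnder (FiniteModule.T M′) x × (∀ {u} → ClosedUnder T u → ClosedUnder (FiniteModule.T M′) u)
    extended = go (IsAlgebraicClosure.isAlgebraic isAlgebraicClosure x)
      where
      go : (Σ ℕ λ d → ∃ λ (c : Vector K.Carrier d) → x ^ d + evalPoly K→K̄ c x ≈ 0#) →
        ∃ λ M′ → ClosedUnder (FiniteModule.T M′) x × (∀ {u} → ClosedUnder T u → ClosedUnder (FiniteModule.T M′) u)
      go (d , c , root) = record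
        { T = Poly d
        ; T-cong = poly-cong d
        ; T-0 = poly-0 d
        ; T-1 = poly-1 d c root
        ; T-+ = poly-+ d
        ; T-scale = λ k → poly-closed d (T-scale k)
        ; basis = proj₁ (poly-spans d)
        ; spans = proj₂ (poly-spans d)
        } , (λ {y} → poly-x d c root {y}) , λ {u} cu {y} → poly-closed d {u} cu {y}

  finiteModule : ∀ {m} (x : Vector Carrier m) → ∃ λ M → ∀ i → ClosedUnder (FiniteModule.T M) (x i)
  finiteModule {zero} x = base , λ ()
  finiteModule {suc m} x = proj₁ ext , λ
    { Fin.zero {y} → proj₁ (proj₂ ext) {y} ; (Fin.suc i) {y} → proj₂ (proj₂ ext) (λ {z} → proj₂ rest i {z}) {y} }
    where
    rest = finiteModule (x ∘ Fin.suc)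
    ext = Extend.extended (proj₁ rest) (x Fin.zero)

  module _ (M : FiniteModule) where
    open FiniteModule M

    T-^ : ∀ {u} → ClosedUnder T u → ∀ k → ClosedUnder T (u ^ k)
    T-^ cu zero tx = T-cong (sym (*-identityˡ _)) tx
    T-^ cu (suc k) tx = T-cong (sym (*-assoc _ _ _)) (cu (T-^ cu k tx))

    T-monomial : ∀ {m} {x : Vector Carrier m} → (∀ i → ClosedUnder T (x i)) → ∀ μ → ClosedUnder T (x ^ᵐ μ)
    T-monomial cx [] tx = T-cong (sym (*-identityˡ _)) tx
    T-monomial cx (k ∷ μ) tx = T-cong (sym (*-assoc _ _ _)) (T-^ (cx Fin.zero) k (T-monomial (cx ∘ Fin.suc) μ tx))

    T-sum : ∀ {m} (h : Fin m → Carrier) → (∀ i → T (h i)) → T (sum h)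
    T-sum {zero} h th = T-0
    T-sum {suc m} h th = T-+ (th Fin.zero) (T-sum (h ∘ Fin.suc) (th ∘ Fin.suc))

    T-sumDegree≤ : ∀ {m} N (h : Vec ℕ m → Carrier) → (∀ μ → T (h μ)) → T (sumDegree≤ N h)
    T-sumDegree≤ {zero} N h th = th []
    T-sumDegree≤ {suc m} N h th = T-sum {suc N} (λ i → sumDegree≤ (N ℕ.∸ toℕ i) λ μ → h (toℕ i ∷ μ))
      λ i → T-sumDegree≤ {m} (N ℕ.∸ toℕ i) (λ μ → h (toℕ i ∷ μ)) λ μ → th (toℕ i ∷ μ)

-- Existence of sums of points.

module Existence {ℓ : ℕ} {a b : Level} (ℓ-prime : Prime ℓ) (E : UnramifiedExtension ℓ a b) {n : ℕ}
  (𝓕 : Theory.CommutativeFormalGroupLaw𝒪 E n) where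
  open UnramifiedExtension E
  open Theory E
  open CommutativeFormalGroupLaw𝒪 𝓕
  open GroupOfPoints 𝓕
  open PointGroup E 𝓕
  open K̄ hiding (inverse; sum) renaming (refl to ≈-refl)
  open Valued K̄ v isValuation
  open Antidiagonal K̄.commutativeRing
  open SeriesAlgebra K̄.commutativeRing
  open Estimates K̄ v isValuation
  open Spans ℓ-prime E
  open FiniteExtensions ℓ-prime E

  module _ (p q : Point n) where
    private
      x = proj₁ p ++ proj₁ q
      bounded = common-bound x (++-all (0ℚ ≺_) (proj₂ p) (proj₂ q))
      δ = proj₁ bounded
      0<δ = proj₁ (proj₂ bounded)
      0≤δ = ℚₚ.<⇒≤ 0<δ
      δx = proj₂ (proj₂ bounded)

      S : Fin n → ℕ → Carrier
      S i = partialSum (F i) x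

      a-bounded : ∀ i → Bounded δ (part x (f i))
      a-bounded i = part-bounded (integral i) δx

      S≈T : ∀ i N → S i N ≈ T (part x (f i)) N
      S≈T i N = sumDegree≤≈T {n ℕ.+ n} N (weight x (f i))

      S-bound : ∀ i N → δ ≼ S i N
      S-bound i N = ≼-cong (sym (S≈T i N)) (T-bound 0≤δ (part-constant (constant-part i)) (a-bounded i) N)

      S-cauchy : ∀ i → IsCauchy K̄ v (S i)
      S-cauchy i r = M , λ k l M≤k M≤l → ≼-cong (sym (+-cong (S≈T i k) (-‿cong (S≈T i l))))
        (≼-weaken r≤ (≼-triangle (T α k) (T α M) (T α l) (T-tail 0≤δ (a-bounded i) (ℕₚ.≤⇒≤′ M≤k))
          (≼-swap (T α l) (T α M) (T-tail 0≤δ (a-bounded i) (ℕₚ.≤⇒≤′ M≤l)))))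
        where
        α = part x (f i)
        M = proj₁ (archimedean 0<δ r)
        r≤ : r ℚ.≤ suc M • δ
        r≤ = ℚₚ.≤-trans (proj₂ (archimedean 0<δ r)) (•-monoˡ {δ} {M} {suc M} 0≤δ (ℕₚ.n≤1+n M))

      module Mod = FiniteModule (proj₁ (finiteModule x))

      -- The module contains 1 and is stable under K and under all coordinates of p and q, hence
      -- contains every term of the partial sums, uniformly in i and N.
      S-span : ∀ i N → Span Mod.basis (S i N)
      S-span i N = Mod.spans _ (T-sumDegree≤ (proj₁ (finiteModule x)) {n ℕ.+ n} N _ λ μ → Mod.T-scale (F i μ)
        (Mod.T-cong (*-identityʳ _) (T-monomial (proj₁ (finiteModule x)) (proj₂ (finiteModule x)) μ Mod.T-1)))

    -- The generators are the only ingredient known up to double negation; given them, all n limits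
    -- are constructed simultaneously.
    ⊕-exists : ¬ ¬ (∃ λ s → p ⊕ q ↦ s)
    ⊕-exists k = generators Mod.basis λ G → k (limits G)
      where
      limits : Generators Mod.basis → ∃ λ s → p ⊕ q ↦ s
      limits G = ((λ i → proj₁ (z i)) , λ i → ≼⇒≺ {0ℚ} {δ} {proj₁ (z i)} 0<δ
        (limit-bound {S i} {proj₁ (z i)} {δ} (S-bound i) (proj₂ (z i)))) , λ i → proj₂ (z i)
        where
        z : ∀ i → ∃ λ z → _⟶_ K̄ v (S i) z
        z i = span-complete Mod.basis G (S i) (S-span i) (λ N → ≼-weaken {0ℚ} {δ} {S i N} 0≤δ (S-bound i N)) (S-cauchy i)

-- Divisibility by a prime; tame elements and Frobenius.

prime∤! : ∀ {p} → Prime p → ∀ m → m ℕ.< p → ¬ (p ∣ m !)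
prime∤! p-prime zero m<p p∣1 = ℕₚ.<-irrefl refl (ℕₚ.<-≤-trans (ℕ.nonTrivial⇒n>1 _ {{prime⇒nonTrivial p-prime}}) (∣⇒≤ p∣1))
prime∤! p-prime (suc m) m<p p∣ with euclidsLemma (suc m) (m !) p-prime p∣
... | inj₁ p∣m = ℕₚ.<-irrefl refl (ℕₚ.<-≤-trans m<p (∣⇒≤ p∣m))
... | inj₂ p∣m! = prime∤! p-prime m (ℕₚ.<-trans (ℕₚ.n<1+n m) m<p) p∣m!

-- The prime p divides p! = C(p,k) · k! · (p - k)! but neither of the two factorials.
prime∣C : ∀ {p} → Prime p → ∀ k → 0 ℕ.< k → k ℕ.< p → p ∣ p choose k
prime∣C {suc q} p-prime k 0<k k<p = [ (λ d → d) , (λ d → ⊥-elim (denominator d)) ]′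
  (euclidsLemma (suc q choose k) (k ! ℕ.* (suc q ℕ.∸ k) !) p-prime (subst (suc q ∣_) (≡.sym product) (m∣m*n (q !))))
  where
  instance _ = k ℕₚ.!* (suc q ℕ.∸ k) !≢0
  product : (suc q choose k) ℕ.* (k ! ℕ.* (suc q ℕ.∸ k) !) ≡ suc q !
  product = ≡.trans (cong (ℕ._* (k ! ℕ.* (suc q ℕ.∸ k) !)) (nCk≡n!/k![n-k]! (ℕₚ.<⇒≤ k<p)))
    (m/n*n≡m (k![n∸k]!∣n! (ℕₚ.<⇒≤ k<p)))
  denominator : ¬ (suc q ∣ k ! ℕ.* (suc q ℕ.∸ k) !)
  denominator d with euclidsLemma (k !) _ p-prime d
  ... | inj₁ d′ = prime∤! p-prime k k<p d′
  ... | inj₂ d′ = prime∤! p-prime (suc q ℕ.∸ k) (ℕₚ.∸-monoʳ-< 0<k (ℕₚ.<⇒≤ k<p)) d′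

prime-power-part : ∀ {p} → Prime p → ∀ n → ∃ λ r → ∃ λ e → suc n ≡ p ℕ.^ r ℕ.* suc e × ¬ (p ∣ suc e)
prime-power-part {p} p-prime n = <-rec P step (suc n)
  where
  P : ℕ → Set
  P n = .{{NonZero n}} → ∃ λ r → ∃ λ e → n ≡ p ℕ.^ r ℕ.* suc e × ¬ (p ∣ suc e)
  1<p : 1 ℕ.< p
  1<p = ℕ.nonTrivial⇒n>1 p {{prime⇒nonTrivial p-prime}}
  step : ∀ n → (∀ {m} → m ℕ.< n → P m) → P n
  step (suc n) rec with p ∣? suc n
  ... | no p∤n = 0 , n , ≡.sym (ℕₚ.+-identityʳ (suc n)) , p∤n
  ... | yes (divides (suc c) eq) with rec {suc c} (subst (suc c ℕ.<_) (≡.sym eq) (ℕₚ.m<m*n (suc c) p 1<p))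
  ... | r , e , eq′ , p∤e = suc r , e , ≡.trans eq (≡.trans (ℕₚ.*-comm (suc c) p)
          (≡.trans (cong (p ℕ.*_) eq′) (≡.sym (ℕₚ.*-assoc p (p ℕ.^ r) (suc e))))) , p∤e

module TameElements {ℓ : ℕ} {a b : Level} (ℓ-prime : Prime ℓ) (E : UnramifiedExtension ℓ a b) where
  open UnramifiedExtension E
  open Theory E
  open K̄ hiding (inverse; sum) renaming (refl to ≈-refl)
  open Valued K̄ v isValuation
  open Antidiagonal K̄.commutativeRing using (sum; sum-cong; L-sum; *-additive; L-0; sum-additive)
  open IntegerSolver K̄.commutativeRing
  open ℓ-Adic ℓ-prime E
  open Spans ℓ-prime E
  open FiniteExtensions ℓ-prime E

  -- Index 1 means a single coset of the value group of ℚ_ℓ, but with an arbitrary representative r.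
  -- Comparing both q and 0 = v(1) with r eliminates it.
  Γ-K-integer : ∀ {q} → Γ-K q → IsInteger q
  Γ-K-integer {q} q∈Γ = subst IsInteger q-r+r (integer-+ (coset q q∈Γ)
    (subst IsInteger r≡ (integer-neg (coset 0ℚ (K.1# , ≡.trans (v-cong ι.1#-homo) v1)))))
    where
    r : ℚ
    r = proj₁ unramified Fin.zero
    coset : ∀ δ → Γ-K δ → IsInteger (δ ℚ.- r)
    coset δ δ∈Γ with proj₂ (proj₂ unramified) δ δ∈Γ
    ... | Fin.zero , (x , vx) , _ = v-ℚₗ-integer x vx
    r≡ : ℚ.- (0ℚ ℚ.- r) ≡ r
    r≡ = -[0-x]≈x r
    q-r+r : q ℚ.- r ℚ.+ r ≡ q
    q-r+r = x-y+y≈x q r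

  integer-Γ-K : ∀ {q} → IsInteger q → Γ-K q
  integer-Γ-K {q} (integer m n eq) = Embedding.⟦_⟧ ℚₗ→K (ϖ m ℚₗ.* ϖ⁻ n) ,
    ≡.trans (v-cong (j.*-homo (ϖ m) (ϖ⁻ n))) (≡.trans (v-*-finite (v-ϖ m) (v-ϖ⁻ n))
      (cong [_] (≡.trans (cong (ℚ._- n • 1ℚ) (≡.sym eq)) (x+r-r≈x q (n • 1ℚ)))))

  module Root (e-1 : ℕ) (ℓ∤e : ¬ (ℓ ∣ suc e-1)) where
    e : ℕ
    e = suc e-1

    coefficients : Vector K.Carrier e
    coefficients Fin.zero = K.- Embedding.⟦_⟧ ℚₗ→K π
    coefficients (Fin.suc _) = K.0#

    ℓ-root : ∃ λ t → t ^ e + sum (λ i → ι (coefficients i) * t ^ toℕ i) ≈ 0#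
    ℓ-root = IsAlgebraicClosure.isAlgebraicallyClosed isAlgebraicClosure e-1 (ι ∘ coefficients)

    t : Carrier
    t = proj₁ ℓ-root

    t^e : t ^ e ≈ j π
    t^e = trans (solve 2 (λ x y → x := (x :+ y) :- y) ≈-refl (t ^ e) S) (trans (+-congʳ (proj₂ ℓ-root)) (trans (+-congˡ (-‿cong S≈))
      (solve 1 (λ x → :0 :- (:- x) := x) ≈-refl (j π))))
      where
      S = sum (λ i → ι (coefficients i) * t ^ toℕ i)
      S≈ : S ≈ - j π
      S≈ = trans (+-cong (trans (*-identityʳ _) (ι.-‿homo _))
        (trans (sum-cong {e-1} λ i → trans (*-congʳ ι.0#-homo) (zeroˡ _)) (L-0 (sum-additive e-1)))) (+-identityʳ _)

    abstract
      t-finite : ∃ λ τ → v t ≡ [ τ ]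
      t-finite = ≉0⇒finite λ t≈0 → finite⇒≉0 v-π (trans (sym t^e) (trans (*-congʳ t≈0) (zeroˡ _)))

    τ : ℚ
    τ = proj₁ t-finite

    v-t : v t ≡ [ τ ]
    v-t = proj₂ t-finite

    eτ≡1 : e • τ ≡ 1ℚ
    eτ≡1 = v-unique {t ^ e} (v-^ e v-t) (≡.trans (v-cong t^e) v-π)

    0<τ : 0ℚ ℚ.< τ
    0<τ = •-cancel-< e (≡.subst₂ ℚ._<_ (≡.sym (n•0≡0 e)) (≡.sym eτ≡1) 0<1)

    -- (k - i) τ lies strictly between 0 and e τ = 1.
    less-impossible : ∀ {i k} → i ℕ.< k → k ℕ.< e → ¬ IsInteger (k • τ ℚ.- i • τ)
    less-impossible {i} {k} i<k k<e int = ℚₚ.<-irrefl refl (begin-strict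
      1ℚ ≤⟨ integer-0<⇒1≤ (subst IsInteger difference int) 0<d ⟩
      suc d • τ <⟨ subst (ℚ._< e • τ) (ℚₚ.+-identityˡ (suc d • τ)) (begin-strict
        0ℚ ℚ.+ suc d • τ <⟨ ℚₚ.+-monoˡ-< (suc d • τ) 0<τ ⟩
        suc (suc d) • τ ≤⟨ •-monoˡ {τ} {suc (suc d)} {e} (ℚₚ.<⇒≤ 0<τ) (ℕₚ.≤-trans (ℕ.s≤s d<k) k<e) ⟩
        e • τ ∎) ⟩
      e • τ ≡⟨ eτ≡1 ⟩
      1ℚ ∎)
      where
      open ℚₚ.≤-Reasoning
      -- Chosen so that suc d = k - i, which is visibly positive.
      d = k ℕ.∸ suc i
      k≡ : suc d ℕ.+ i ≡ k
      k≡ = ≡.trans (≡.sym (ℕₚ.+-suc d i)) (ℕₚ.m∸n+n≡m i<k)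
      d<k : suc d ℕ.≤ k
      d<k = subst (suc d ℕ.≤_) k≡ (ℕₚ.m≤m+n (suc d) i)
      difference : k • τ ℚ.- i • τ ≡ suc d • τ
      difference = ≡.trans (cong (ℚ._- i • τ) (≡.trans (cong (_• τ) (≡.sym k≡)) (•-homo-+ τ (suc d) i)))
        (x+r-r≈x (suc d • τ) (i • τ))
      0<d : 0ℚ ℚ.< suc d • τ
      0<d = subst (ℚ._< suc d • τ) (n•0≡0 (suc d)) (•-monoʳ-< d 0<τ)

    distinct : ∀ {i k} → i ℕ.< e → k ℕ.< e → IsInteger (k • τ ℚ.- i • τ) → i ≡ k
    distinct {i} {k} i<e k<e int = go (ℕₚ.<-cmp i k)
      where
      go : Tri (i ℕ.< k) (i ≡ k) (k ℕ.< i) → i ≡ k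
      go (tri< i<k _ _) = contradiction int (less-impossible i<k k<e)
      go (tri≈ _ i≡k _) = i≡k
      go (tri> _ _ k<i) = contradiction (subst IsInteger
        (-[x-y]≈y-x (k • τ) (i • τ)) (integer-neg int)) (less-impossible k<i i<e)

    open Extend base t

    -- Horner evaluation inside `Poly e`, which tᵉ = ℓ makes stable under multiplication by t; so
    -- every element of K(t) is a polynomial in t of degree < e.
    adjoin-poly : ∀ {y} → Adjoin K→K̄ t y → Poly e y
    adjoin-poly {y} (d , c , eq) = poly-cong e (sym eq) (evaluation d c)
      where
      evaluation : ∀ d (c : Vector K.Carrier d) → Poly e (sum (λ i → ι (c i) * t ^ toℕ i))
      evaluation zero c = poly-0 e
      evaluation (suc d) c = poly-cong e (+-congˡ (sym (trans
          (sum-cong {d} λ i → solve 3 (λ c x y → c :* (x :* y) := x :* (c :* y)) ≈-refl _ t _)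
          (sym (L-sum (*-additive t) {d} (λ i _ → ι (c (Fin.suc i)) * t ^ toℕ i))))))
        (poly-+ e (poly-closed e {ι (c Fin.zero)} (λ {x} → FiniteModule.T-scale base (c Fin.zero) {x}) {1#} (poly-1 e coefficients (proj₂ ℓ-root)))
          (poly-x e coefficients (proj₂ ℓ-root) (evaluation d (c ∘ Fin.suc))))

    -- The valuations of the terms s tⁱ, i < e, are distinct modulo ℤ.
    poly-valuation : ∀ k {y} → k ℕ.≤ e → Poly k y →
      (y ≈ 0#) ⊎ (∃ λ i → i ℕ.< k × ∃ λ m → IsInteger m × v y ≡ [ m ℚ.+ i • τ ])
    poly-valuation zero k≤e (lift y≈0) = inj₁ y≈0
    poly-valuation (suc k) {y} k≤e py = go (poly-top k py)
      where
      Goal = (y ≈ 0#) ⊎ (∃ λ i → i ℕ.< suc k × ∃ λ m → IsInteger m × v y ≡ [ m ℚ.+ i • τ ])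
      go : (∃ λ s → ∃ λ z → FiniteModule.T base s × Poly k z × y ≈ z + s * t ^ k) → Goal
      go (s , z , (c , lift s≈) , pz , y≈) = combine (poly-valuation k (ℕₚ.≤-trans (ℕₚ.n≤1+n k) k≤e) pz) (zero-or-finite s)
        where
        combine : (z ≈ 0#) ⊎ (∃ λ i → i ℕ.< k × ∃ λ m → IsInteger m × v z ≡ [ m ℚ.+ i • τ ]) →
          ZeroOrFinite s → Goal
        combine (inj₁ z≈0) (inj₁ s≈0) = inj₁ (trans y≈ (trans (+-cong z≈0 (trans (*-congʳ s≈0) (zeroˡ _))) (+-identityˡ 0#)))
        combine (inj₂ (i , i<k , m , im , vz)) (inj₁ s≈0) = inj₂ (i , ℕₚ.m<n⇒m<1+n i<k , m , im ,
          ≡.trans (v-cong (trans y≈ (trans (+-congˡ (trans (*-congʳ s≈0) (zeroˡ _))) (+-identityʳ z)))) vz)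
        combine (inj₁ z≈0) (inj₂ (q , vs)) = inj₂ (k , ℕₚ.n<1+n k , q , Γ-K-integer (c , ≡.trans (v-cong (sym s≈)) vs) ,
          ≡.trans (v-cong (trans y≈ (trans (+-congʳ z≈0) (+-identityˡ _)))) (v-*-finite vs (v-^ k v-t)))
        combine (inj₂ (i , i<k , m , im , vz)) (inj₂ (q , vs)) = compare (ℚₚ.<-cmp (m ℚ.+ i • τ) (q ℚ.+ k • τ))
          where
          iq : IsInteger q
          iq = Γ-K-integer (c , ≡.trans (v-cong (sym s≈)) vs)
          vst : v (s * t ^ k) ≡ [ q ℚ.+ k • τ ]
          vst = v-*-finite vs (v-^ k v-t)
          compare : Tri (m ℚ.+ i • τ ℚ.< q ℚ.+ k • τ) (m ℚ.+ i • τ ≡ q ℚ.+ k • τ) (q ℚ.+ k • τ ℚ.< m ℚ.+ i • τ) → Goal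
          compare (tri< lt _ _) = inj₂ (i , ℕₚ.m<n⇒m<1+n i<k , m , im , ≡.trans (v-cong y≈) (strict vz (≺-finite vst lt)))
          compare (tri> _ _ gt) = inj₂ (k , ℕₚ.n<1+n k , q , iq ,
            ≡.trans (v-cong (trans y≈ (+-comm z _))) (strict vst (≺-finite vz gt)))
          -- Equality would make k τ - i τ = m - q an integer.
          compare (tri≈ _ eq _) = contradiction
            (subst IsInteger (≡.sym (x+y≈z+w⇒w-y≈x-z {m} {i • τ} {q} {k • τ} eq)) (integer-sub im iq))
            (less-impossible i<k k≤e)

    adjoin-^ : ∀ i → Adjoin K→K̄ t (t ^ i)
    adjoin-^ zero = 1 , (λ _ → K.1#) , sym (trans (+-identityʳ _) (trans (*-identityʳ _) ι.1#-homo))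
    adjoin-^ (suc i) = shift (adjoin-^ i)
      where
      shift : Adjoin K→K̄ t (t ^ i) → Adjoin K→K̄ t (t ^ suc i)
      shift (d , c , eq) = suc d , (λ { Fin.zero → K.0# ; (Fin.suc k) → c k }) , (begin
        t * t ^ i ≈⟨ *-congˡ eq ⟩
        t * sum (λ i → ι (c i) * t ^ toℕ i) ≈⟨ L-sum (*-additive t) {d} (λ i _ → ι (c i) * t ^ toℕ i) ⟩
        sum (λ i → t * (ι (c i) * t ^ toℕ i))
          ≈⟨ sum-cong {d} (λ i → solve 3 (λ c x y → x :* (c :* y) := c :* (x :* y)) ≈-refl _ t _) ⟩
        sum (λ i → ι (c i) * (t * t ^ toℕ i)) ≈⟨ +-identityˡ _ ⟨
        0# + sum (λ i → ι (c i) * (t * t ^ toℕ i)) ≈⟨ +-congʳ (trans (*-congʳ ι.0#-homo) (zeroˡ _)) ⟨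
        ι K.0# * 1# + sum (λ i → ι (c i) * (t * t ^ toℕ i)) ∎)
        where open SetoidReasoning setoid

    -- The values i τ of tⁱ for i < e represent the cosets of ℤ in the value group of K(t):
    -- `poly-valuation` shows that every coset occurs, `distinct` that none occurs twice. The
    -- ramification index is therefore e.
    tame : IsTame t
    tame = e , ((λ i → toℕ i • τ) , (λ i → t ^ toℕ i , adjoin-^ (toℕ i) , v-^ (toℕ i) v-t) , unique) , ℓ∤e
      where
      unique : ∀ δ → Γ-K⟨ t ⟩ δ → ∃! _≡_ λ (i : Fin e) → Γ-K (δ ℚ.- toℕ i • τ)
      unique δ (y , y∈ , vy) = go (poly-valuation e ℕₚ.≤-refl (adjoin-poly y∈))
        where
        go : (y ≈ 0#) ⊎ (∃ λ i → i ℕ.< e × ∃ λ m → IsInteger m × v y ≡ [ m ℚ.+ i • τ ]) →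
          ∃! _≡_ λ (i : Fin e) → Γ-K (δ ℚ.- toℕ i • τ)
        go (inj₁ y≈0) = contradiction y≈0 (finite⇒≉0 vy)
        go (inj₂ (i , i<e , m , im , vy′)) = i′ , integer-Γ-K coset , λ {k} k∈ → Finₚ.toℕ-injective
          (distinct (Finₚ.toℕ<n i′) (Finₚ.toℕ<n k) (subst IsInteger
            ([d-i]-[d-k]≈k-i δ (toℕ i′ • τ) (toℕ k • τ))
            (integer-sub coset (Γ-K-integer k∈))))
          where
          i′ : Fin e
          i′ = Fin.fromℕ< i<e
          coset : IsInteger (δ ℚ.- toℕ i′ • τ)
          coset = subst IsInteger (≡.sym (≡.trans
            (≡.cong₂ (λ δ k → δ ℚ.- k • τ) (v-unique {y} vy vy′) (Finₚ.toℕ-fromℕ< i<e))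
            (x+r-r≈x m (i • τ)))) im

  -- By the binomial theorem the difference consists of the middle terms, whose coefficients are
  -- divisible by ℓ.
  frobenius : ∀ {z} → 0ℚ ≼ z → 1ℚ ≼ (z + 1#) ^ ℓ - (1# + z ^ ℓ)
  frobenius {z} 0z = go ℓ refl
    where
    open Binomial commutativeSemiring using (theorem; binomialTerm)
    open MonoidSum +-monoid using (sum-init-last)
    go : ∀ p → p ≡ ℓ → 1ℚ ≼ (z + 1#) ^ p - (1# + z ^ p)
    go zero 0≡ℓ = contradiction ℓ>1 (λ lt → ℕₚ.n≮0 (subst (1 ℕ.<_) (≡.sym 0≡ℓ) lt))
    go (suc q) refl = ≼-cong (sym (begin
      (z + 1#) ^ ℓ - (1# + z ^ ℓ) ≈⟨ +-congʳ (theorem ℓ z 1#) ⟩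
      (term Fin.zero + sum {ℓ} (term ∘ Fin.suc)) - (1# + z ^ ℓ)
        ≈⟨ +-congʳ (+-cong first (trans (sum-init-last {q} (term ∘ Fin.suc)) (+-congˡ last))) ⟩
      (1# + (sum {q} middle + z ^ ℓ)) - (1# + z ^ ℓ)
        ≈⟨ solve 2 (λ m x → (:1 :+ (m :+ x)) :- (:1 :+ x) := m) ≈-refl (sum {q} middle) (z ^ ℓ) ⟩
      sum {q} middle ∎)) (≼-sum middle middle-small)
      where
      open SetoidReasoning setoid
      term = binomialTerm z 1# ℓ
      middle : Fin q → Carrier
      middle i = term (Fin.suc (Fin.inject₁ i))
      first : term Fin.zero ≈ 1#
      first = trans (#×.×-homo-1 _) (trans (*-identityˡ _) (1^ ℓ))
      last : term (Fin.suc (Fin.fromℕ q)) ≈ z ^ ℓ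
      last = begin
        term (Fin.suc (Fin.fromℕ q)) ≡⟨ cong (λ k → (ℓ choose suc k) ×# (z ^ suc k * 1# ^ (ℓ ℕ.∸ suc k))) (Finₚ.toℕ-fromℕ q) ⟩
        (ℓ choose ℓ) ×# (z ^ ℓ * 1# ^ (ℓ ℕ.∸ ℓ)) ≡⟨ cong (_×# (z ^ ℓ * 1# ^ (ℓ ℕ.∸ ℓ))) (nCn≡1 ℓ) ⟩
        1 ×# (z ^ ℓ * 1# ^ (ℓ ℕ.∸ ℓ)) ≈⟨ #×.×-homo-1 _ ⟩
        z ^ ℓ * 1# ^ (ℓ ℕ.∸ ℓ) ≈⟨ *-congˡ (1^ (ℓ ℕ.∸ ℓ)) ⟩
        z ^ ℓ * 1# ≈⟨ *-identityʳ _ ⟩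
        z ^ ℓ ∎
      ℓ∣× : ∀ n {x} → ℓ ∣ n → 0ℚ ≼ x → 1ℚ ≼ n ×# x
      ℓ∣× n {x} (divides c n≡) 0x = ≼-cong (begin
        nat ℓ * (nat c * x) ≈⟨ solve 3 (λ l c x → l :* (c :* x) := (c :* l) :* x) ≈-refl (nat ℓ) (nat c) x ⟩
        nat c * nat ℓ * x ≈⟨ *-congʳ (nat-* c ℓ) ⟨
        nat (c ℕ.* ℓ) * x ≡⟨ cong (λ n → nat n * x) n≡ ⟨
        nat n * x ≈⟨ #×.×-assoc-* n 1# x ⟩
        n ×# (1# * x) ≈⟨ #×.×-congʳ n (*-identityˡ x) ⟩
        n ×# x ∎) (ℓ-multiple (≼-*ˡ (integral-×# c) 0x))
      middle-small : ∀ i → 1ℚ ≼ middle i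
      middle-small i = ℓ∣× _ (prime∣C ℓ-prime _ (ℕ.s≤s ℕ.z≤n)
          (ℕ.s≤s (subst (ℕ._< q) (≡.sym (Finₚ.toℕ-inject₁ i)) (Finₚ.toℕ<n i))))
        (≼-*ˡ (integral-^ (suc (toℕ (Fin.inject₁ i))) 0z) (≼-cong (sym (1^ (q ℕ.∸ toℕ (Fin.inject₁ i)))) ≼-1))

  -- With z = w - 1, Frobenius gives w^ℓ ≡ 1 + z^ℓ modulo ℓ, so z^ℓ has positive valuation. This
  -- means ℓ v(z) > 0 unless z = 0, and thus v(z) > 0.
  no-ℓ-th-roots : ∀ {w} → 0ℚ ≼ w → 0ℚ ≺ w ^ ℓ - 1# → 0ℚ ≺ w - 1#
  no-ℓ-th-roots {w} 0w small = decide (zero-or-finite z)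
    where
    z = w - 1#
    0z : 0ℚ ≼ z
    0z = ≼-sub 0w ≼-1
    z+1≈w : z + 1# ≈ w
    z+1≈w = solve 1 (λ w → (w :- :1) :+ :1 := w) ≈-refl w
    z^ℓ-small : 0ℚ ≺ z ^ ℓ
    z^ℓ-small = ≺-cong
      (solve 3 (λ W Z o → (W :- o) :+ (:- (W :- (o :+ Z))) := Z) ≈-refl (w ^ ℓ) (z ^ ℓ) 1#)
      (≺-+ small (≼⇒≺ 0<1 (≼-neg (≼-cong (+-congʳ (Exp.^-congˡ semiring ℓ z+1≈w)) (frobenius 0z)))))
    decide : ZeroOrFinite z → 0ℚ ≺ z
    decide (inj₁ z≈0) = ≺-≈0 z≈0
    decide (inj₂ (q , vz)) = ≺-finite vz (•-cancel-< ℓ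
      (subst (ℚ._< ℓ • q) (≡.sym (n•0≡0 ℓ)) (≺-finite⁻¹ (v-^ ℓ vz) z^ℓ-small)))

  no-ℓ-power-roots : ∀ r {w} → 0ℚ ≼ w → 0ℚ ≺ w ^ (ℓ ℕ.^ r) - 1# → 0ℚ ≺ w - 1#
  no-ℓ-power-roots zero {w} 0w small = ≺-cong (+-congʳ (*-identityʳ w)) small
  no-ℓ-power-roots (suc r) {w} 0w small = no-ℓ-th-roots 0w (no-ℓ-power-roots r (integral-^ ℓ 0w)
    (≺-cong (+-congʳ (sym (Exp.^-assocʳ semiring w ℓ (ℓ ℕ.^ r)))) small))

-- Wild inertia moves every element by less than its size.

module WildAction {ℓ : ℕ} {a b : Level} (ℓ-prime : Prime ℓ) (E : UnramifiedExtension ℓ a b)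
  (σ : Theory.Gal E) (wild : Theory.WildInertia E σ) where
  open UnramifiedExtension E
  open Theory E
  open Gal σ
  open K̄ hiding (inverse; sum) renaming (refl to ≈-refl)
  open Valued K̄ v isValuation
  open IntegerSolver K̄.commutativeRing
  open ℓ-Adic ℓ-prime E
  open Spans ℓ-prime E
  open TameElements ℓ-prime E
  module σ = RingHomomorphism K̄.commutativeRing K̄.commutativeRing act
    (RingMorphisms.IsRingIsomorphism.isRingHomomorphism isRingIsomorphism)

  act-j : ∀ c → act (j c) ≈ j c
  act-j c = fixes-K (Embedding.⟦_⟧ ℚₗ→K c)

  act-unit : ∀ {u} → v u ≡ [ 0ℚ ] → v (act u) ≡ [ 0ℚ ]
  act-unit {u} vu = v-close u (act u) vu (proj₁ wild u (≼-finite vu ℚₚ.≤-refl))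

  -- Obtained from inertia rather than from uniqueness of the extension of v. A power x^(k+1) times
  -- a power of ℓ is a unit, inertia maps units to units and σ fixes ℓ; cancelling k + 1 recovers
  -- v(σx).
  act-v : ∀ x → v (act x) ≡ v x
  act-v x = go (zero-or-finite x)
    where
    go : ZeroOrFinite x → v (act x) ≡ v x
    go (inj₁ x≈0) = v-cong (trans (σ.⟦⟧-cong x≈0) (trans σ.0#-homo (sym x≈0)))
    go (inj₂ (α , vx)) = ≡.trans (proj₂ act-finite) (≡.trans (cong [_] (•-cancel k same)) (≡.sym vx))
      where
      cd = clear-denominator α
      k = proj₁ cd
      m = proj₁ (proj₂ cd)
      n = proj₁ (proj₂ (proj₂ cd))
      c = ϖ n ℚₗ.* ϖ⁻ m
      u : Carrier → Carrier
      u y = y ^ suc k * j c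
      v-c : v (j c) ≡ [ n • 1ℚ ℚ.- m • 1ℚ ]
      v-c = ≡.trans (v-cong (j.*-homo (ϖ n) (ϖ⁻ m))) (v-*-finite (v-ϖ n) (v-ϖ⁻ m))
      v-u : ∀ {y β} → v y ≡ [ β ] → v (u y) ≡ [ suc k • β ℚ.+ (n • 1ℚ ℚ.- m • 1ℚ) ]
      v-u vy = v-*-finite (v-^ (suc k) vy) v-c
      zero-sum : suc k • α ℚ.+ (n • 1ℚ ℚ.- m • 1ℚ) ≡ 0ℚ
      zero-sum = ≡.trans (≡.sym (ℚₚ.+-assoc (suc k • α) (n • 1ℚ) (ℚ.- (m • 1ℚ))))
        (≡.trans (cong (ℚ._- m • 1ℚ) (proj₂ (proj₂ (proj₂ cd)))) (ℚₚ.+-inverseʳ (m • 1ℚ)))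
      act-u : act (u x) ≈ u (act x)
      act-u = trans (σ.*-homo _ _) (*-cong (σ.^-homo x (suc k)) (act-j c))
      v-act-u : v (u (act x)) ≡ [ 0ℚ ]
      v-act-u = ≡.trans (v-cong (sym act-u)) (act-unit (≡.trans (v-u vx) (cong [_] zero-sum)))
      act-finite : ∃ λ β → v (act x) ≡ [ β ]
      act-finite = ≉0⇒finite λ σx≈0 → finite⇒≉0 v-act-u (trans (*-congʳ (trans (*-congʳ σx≈0) (zeroˡ _))) (zeroˡ _))
      same : suc k • proj₁ act-finite ≡ suc k • α
      same = ℚ-Ring.+-cancelʳ (n • 1ℚ ℚ.- m • 1ℚ) _ _
        (≡.trans (v-unique {u (act x)} (v-u (proj₂ act-finite)) v-act-u) (≡.sym zero-sum))

  act-close : ∀ {x α} → v x ≡ [ α ] → α ≺ act x - x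
  act-close {x} {α} vx = ≺-cong wx-x (subst (_≺ (w - 1#) * x) (ℚₚ.+-identityˡ α)
    (≼-≺-* (no-ℓ-power-roots r (≼-finite v-w ℚₚ.≤-refl) w-power) (≼-finite vx ℚₚ.≤-refl)))
    where
    cd = clear-denominator α
    k = proj₁ cd
    m = proj₁ (proj₂ cd)
    n = proj₁ (proj₂ (proj₂ cd))
    pp = prime-power-part ℓ-prime k
    r = proj₁ pp
    e = suc (proj₁ (proj₂ pp))
    k≡ : suc k ≡ ℓ ℕ.^ r ℕ.* e
    k≡ = proj₁ (proj₂ (proj₂ pp))
    open Root (proj₁ (proj₂ pp)) (proj₂ (proj₂ (proj₂ pp))) using (t; τ; v-t; eτ≡1; tame)

    t⁻¹ = proj₁ (inverse v-t)
    tt⁻¹ : t * t⁻¹ ≈ 1#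
    tt⁻¹ = proj₂ (inverse v-t)
    v-t⁻¹ : v t⁻¹ ≡ [ ℚ.- τ ]
    v-t⁻¹ = v-inverse v-t tt⁻¹

    σt : act t ≈ t
    σt = proj₂ wild t tame

    σt⁻¹ : act t⁻¹ ≈ t⁻¹
    σt⁻¹ = begin
      act t⁻¹ ≈⟨ *-identityˡ _ ⟨
      1# * act t⁻¹ ≈⟨ *-congʳ tt⁻¹ ⟨
      t * t⁻¹ * act t⁻¹ ≈⟨ solve 3 (λ t s u → t :* s :* u := s :* (t :* u)) ≈-refl t t⁻¹ (act t⁻¹) ⟩
      t⁻¹ * (t * act t⁻¹) ≈⟨ *-congˡ (*-congʳ σt) ⟨
      t⁻¹ * (act t * act t⁻¹) ≈⟨ *-congˡ (trans (sym (σ.*-homo t t⁻¹)) (trans (σ.⟦⟧-cong tt⁻¹) σ.1#-homo)) ⟩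
      t⁻¹ * 1# ≈⟨ *-identityʳ _ ⟩
      t⁻¹ ∎
      where open SetoidReasoning setoid

    R = ℓ ℕ.^ r
    X = x ^ R
    -- The exponent n - m of t makes u a unit: since k + 1 = ℓ^r e and e τ = 1, one has e v(u) = (k
    -- + 1) α + n - m = 0.
    θ = t ^ n * t⁻¹ ^ m
    u = X * θ

    σθ : act θ ≈ θ
    σθ = trans (σ.*-homo _ _) (*-cong
      (trans (σ.^-homo t n) (Exp.^-congˡ semiring n σt)) (trans (σ.^-homo t⁻¹ m) (Exp.^-congˡ semiring m σt⁻¹)))

    v-u : v u ≡ [ 0ℚ ]
    v-u = ≡.trans (v-*-finite (v-^ R vx) (v-*-finite (v-^ n v-t) (v-^ m v-t⁻¹)))
      (cong [_] (•-cancel (proj₁ (proj₂ pp)) (≡.trans scaled (≡.sym (n•0≡0 e)))))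
      where
      open ≡.≡-Reasoning
      swap : ∀ n q → e • (n • q) ≡ n • (e • q)
      swap n q = ≡.trans (•-assoc q e n) (≡.trans (cong (_• q) (ℕₚ.*-comm e n)) (≡.sym (•-assoc q n e)))
      e-τ : e • (ℚ.- τ) ≡ ℚ.- 1ℚ
      e-τ = ℚ-Ring.+-inverseʳ-unique 1ℚ (e • (ℚ.- τ)) (≡.trans (cong (ℚ._+ e • (ℚ.- τ)) (≡.sym eτ≡1))
        (≡.trans (≡.sym (•-distrib-+ τ (ℚ.- τ) e)) (≡.trans (cong (e •_) (ℚₚ.+-inverseʳ τ)) (n•0≡0 e))))
      m• : m • (ℚ.- 1ℚ) ≡ ℚ.- (m • 1ℚ)
      m• = ℚ-Ring.+-inverseʳ-unique (m • 1ℚ) (m • (ℚ.- 1ℚ))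
        (≡.trans (≡.sym (•-distrib-+ 1ℚ (ℚ.- 1ℚ) m)) (≡.trans (cong (m •_) (ℚₚ.+-inverseʳ 1ℚ)) (n•0≡0 m)))
      scaled : e • (R • α ℚ.+ (n • τ ℚ.+ m • (ℚ.- τ))) ≡ 0ℚ
      scaled = begin
        e • (R • α ℚ.+ (n • τ ℚ.+ m • (ℚ.- τ))) ≡⟨ •-distrib-+ (R • α) _ e ⟩
        e • (R • α) ℚ.+ e • (n • τ ℚ.+ m • (ℚ.- τ)) ≡⟨ cong (e • (R • α) ℚ.+_) (•-distrib-+ (n • τ) (m • (ℚ.- τ)) e) ⟩
        e • (R • α) ℚ.+ (e • (n • τ) ℚ.+ e • (m • (ℚ.- τ)))
          ≡⟨ ≡.cong₂ ℚ._+_ (≡.trans (•-assoc α e R) (cong (_• α) (≡.trans (ℕₚ.*-comm e R) (≡.sym k≡))))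
               (≡.cong₂ ℚ._+_ (≡.trans (swap n τ) (cong (n •_) eτ≡1)) (≡.trans (swap m (ℚ.- τ)) (≡.trans (cong (m •_) e-τ) m•))) ⟩
        suc k • α ℚ.+ (n • 1ℚ ℚ.- m • 1ℚ) ≡⟨ ℚₚ.+-assoc (suc k • α) (n • 1ℚ) (ℚ.- (m • 1ℚ)) ⟨
        suc k • α ℚ.+ n • 1ℚ ℚ.- m • 1ℚ ≡⟨ cong (ℚ._- m • 1ℚ) (proj₂ (proj₂ (proj₂ cd))) ⟩
        m • 1ℚ ℚ.- m • 1ℚ ≡⟨ ℚₚ.+-inverseʳ (m • 1ℚ) ⟩
        0ℚ ∎

    x⁻¹ = proj₁ (inverse vx)
    xx⁻¹ : x * x⁻¹ ≈ 1#
    xx⁻¹ = proj₂ (inverse vx)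
    u⁻¹ = proj₁ (inverse v-u)
    uu⁻¹ : u * u⁻¹ ≈ 1#
    uu⁻¹ = proj₂ (inverse v-u)

    w = act x * x⁻¹

    v-w : v w ≡ [ 0ℚ ]
    v-w = ≡.trans (v-*-finite (≡.trans (act-v x) vx) (v-inverse vx xx⁻¹)) (cong [_] (ℚₚ.+-inverseʳ α))

    wx-x : (w - 1#) * x ≈ act x - x
    wx-x = trans (solve 3 (λ s i x → (s :* i :- :1) :* x := s :* (x :* i) :- x) ≈-refl (act x) x⁻¹ x)
      (+-congʳ (trans (*-congˡ xx⁻¹) (*-identityʳ _)))

    -- As σ fixes θ, the power w^R equals σu / u, and inertia moves the unit u by an element of
    -- positive valuation.
    w-power : 0ℚ ≺ w ^ R - 1#
    w-power = ≺-cong (begin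
      (act u - u) * u⁻¹ ≈⟨ *-congʳ (+-congʳ (trans (σ.*-homo X θ) (*-cong (σ.^-homo x R) σθ))) ⟩
      (act x ^ R * θ - X * θ) * u⁻¹
        ≈⟨ solve 4 (λ Y θ X i → (Y :* θ :- X :* θ) :* i := Y :* (θ :* i) :- (X :* θ) :* i) ≈-refl (act x ^ R) θ X u⁻¹ ⟩
      act x ^ R * (θ * u⁻¹) - u * u⁻¹ ≈⟨ +-cong (*-congˡ θu⁻¹) (-‿cong uu⁻¹) ⟩
      act x ^ R * x⁻¹ ^ R - 1# ≈⟨ +-congʳ (CommutativeExp.^-distrib-* commutativeSemiring (act x) x⁻¹ R) ⟨
      w ^ R - 1# ∎)
      (≼-≺-* (proj₁ wild u (≼-finite v-u ℚₚ.≤-refl)) (≼-finite (v-inverse v-u uu⁻¹) ℚₚ.≤-refl))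
      where
      open SetoidReasoning setoid
      θu⁻¹ : θ * u⁻¹ ≈ x⁻¹ ^ R
      θu⁻¹ = begin
        θ * u⁻¹ ≈⟨ *-identityˡ _ ⟨
        1# * (θ * u⁻¹) ≈⟨ *-congʳ (trans (Exp.^-congˡ semiring R xx⁻¹) (1^ R)) ⟨
        (x * x⁻¹) ^ R * (θ * u⁻¹) ≈⟨ *-congʳ (CommutativeExp.^-distrib-* commutativeSemiring x x⁻¹ R) ⟩
        X * x⁻¹ ^ R * (θ * u⁻¹) ≈⟨ solve 4 (λ X I θ i → X :* I :* (θ :* i) := I :* (X :* θ :* i)) ≈-refl X (x⁻¹ ^ R) θ u⁻¹ ⟩
        x⁻¹ ^ R * (u * u⁻¹) ≈⟨ *-congˡ uu⁻¹ ⟩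
        x⁻¹ ^ R * 1# ≈⟨ *-identityʳ _ ⟩
        x⁻¹ ^ R ∎

-- The torsion point contradicting Hypothesis (H).

module MainTheorem {ℓ : ℕ} {a b : Level} (ℓ-prime : Prime ℓ) (E : UnramifiedExtension ℓ a b) {n : ℕ}
  (𝓕 : Theory.CommutativeFormalGroupLaw𝒪 E n) (σ : Theory.Gal E) (wild : Theory.WildInertia E σ) where
  open UnramifiedExtension E
  open Theory E
  open GroupOfPoints 𝓕
  open PointGroup E 𝓕
  open Existence ℓ-prime E 𝓕
  open WildAction ℓ-prime E σ wild
  open Gal σ
  open K̄ hiding (inverse; sum) renaming (refl to ≈-refl)
  open Valued K̄ v isValuation
  open IntegerSolver K̄.commutativeRing

  minVal-bound : ∀ {m q p} (x : Vector Carrier m) → minVal x ≡ [ p ] → (∀ i → q ≼ x i) → q ℚ.≤ p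
  minVal-bound {q = q} x eq qx = go (subst ([ q ] ≤⁺_) eq (bound x qx))
    where
    go : ∀ {p} → [ q ] ≤⁺ [ p ] → q ℚ.≤ p
    go [ le ] = le
    ⊓-glb : ∀ s t → [ q ] ≤⁺ s → [ q ] ≤⁺ t → [ q ] ≤⁺ (s ⊓∞ t)
    ⊓-glb ⊤⁺ t _ qt = qt
    ⊓-glb [ s ] ⊤⁺ qs _ = qs
    ⊓-glb [ s ] [ t ] [ qs ] [ qt ] = [ ℚₚ.⊓-glb qs qt ]
    bound : ∀ {m} (x : Vector Carrier m) → (∀ i → q ≼ x i) → [ q ] ≤⁺ minVal x
    bound {zero} x qx = _ ≤⊤⁺
    bound {suc m} x qx = ⊓-glb (v (x Fin.zero)) (minVal (x ∘ Fin.suc)) (qx Fin.zero) (bound (x ∘ Fin.suc) (qx ∘ Fin.suc))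

  minVal-≼ : ∀ {m p} (x : Vector Carrier m) → minVal x ≡ [ p ] → ∀ i → p ≼ x i
  minVal-≼ {p = p} x eq i = below x (subst ([ p ] ≤⁺_) (≡.sym eq) [ ℚₚ.≤-refl ]) i
    where
    ⊓-≤ˡ : ∀ s t → [ p ] ≤⁺ (s ⊓∞ t) → [ p ] ≤⁺ s
    ⊓-≤ˡ ⊤⁺ t _ = _ ≤⊤⁺
    ⊓-≤ˡ [ s ] ⊤⁺ le = le
    ⊓-≤ˡ [ s ] [ t ] [ le ] = [ ℚₚ.≤-trans le (ℚₚ.p⊓q≤p s t) ]
    ⊓-≤ʳ : ∀ s t → [ p ] ≤⁺ (s ⊓∞ t) → [ p ] ≤⁺ t
    ⊓-≤ʳ ⊤⁺ t le = le
    ⊓-≤ʳ [ s ] ⊤⁺ le = _ ≤⊤⁺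
    ⊓-≤ʳ [ s ] [ t ] [ le ] = [ ℚₚ.≤-trans le (ℚₚ.p⊓q≤q s t) ]
    below : ∀ {m} (x : Vector Carrier m) → [ p ] ≤⁺ minVal x → ∀ i → p ≼ x i
    below x le Fin.zero = ⊓-≤ˡ (v (x Fin.zero)) _ le
    below x le (Fin.suc i) = below (x ∘ Fin.suc) (⊓-≤ʳ (v (x Fin.zero)) _ le) i

  -- The index of the minimum is recorded because at that coordinate z will be seen to be non-zero
  -- and β to exceed α.
  attained-minimum : ∀ {m} (x : Vector Carrier m) → (∀ i → x i ≈ 0#) ⊎
    (∃ λ i → ∃ λ β → v (x i) ≡ [ β ] × (∀ k → β ≼ x k))
  attained-minimum {zero} x = inj₁ λ ()
  attained-minimum {suc m} x = go (zero-or-finite (x Fin.zero)) (attained-minimum (x ∘ Fin.suc))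
    where
    Goal = (∀ i → x i ≈ 0#) ⊎ (∃ λ i → ∃ λ β → v (x i) ≡ [ β ] × (∀ k → β ≼ x k))
    go : (x Fin.zero ≈ 0#) ⊎ (∃ λ q → v (x Fin.zero) ≡ [ q ]) →
      (∀ i → x (Fin.suc i) ≈ 0#) ⊎ (∃ λ i → ∃ λ β → v (x (Fin.suc i)) ≡ [ β ] × (∀ k → β ≼ x (Fin.suc k))) → Goal
    go (inj₁ z) (inj₁ zs) = inj₁ λ { Fin.zero → z ; (Fin.suc i) → zs i }
    go (inj₁ z) (inj₂ (i , β , vi , le)) = inj₂ (Fin.suc i , β , vi , λ { Fin.zero → ≼-≈0 z ; (Fin.suc k) → le k })
    go (inj₂ (q , vq)) (inj₁ zs) = inj₂ (Fin.zero , q , vq , λ { Fin.zero → ≼-finite vq ℚₚ.≤-refl ; (Fin.suc k) → ≼-≈0 (zs k) })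
    go (inj₂ (q , vq)) (inj₂ (i , β , vi , le)) with ℚₚ.≤-total q β
    ... | inj₁ q≤β = inj₂ (Fin.zero , q , vq , λ { Fin.zero → ≼-finite vq ℚₚ.≤-refl ; (Fin.suc k) → ≼-weaken q≤β (le k) })
    ... | inj₂ β≤q = inj₂ (Fin.suc i , β , vi , λ { Fin.zero → ≼-finite vq β≤q ; (Fin.suc k) → le k })

  predecessor : ∃ λ q → ℓ ≡ suc q
  predecessor = go ℓ refl
    where
    go : ∀ k → k ≡ ℓ → ∃ λ q → ℓ ≡ suc q
    go zero 0≡ℓ = contradiction (subst (1 ℕ.<_) (≡.sym 0≡ℓ) (ℓ-Adic.ℓ>1 ℓ-prime E)) λ ()
    go (suc q) eq = q , ≡.sym eq

  module _ (x : Point n) (x-torsion : IsTorsion x) where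

    -- Writing ℓ as a successor exposes the last summation step of [ℓ]x, namely x ⊕ w = o with w =
    -- [ℓ-1]x and o zero.
    multiple-ℓ : IsMultiple (suc (proj₁ predecessor)) x (proj₁ x-torsion)
    multiple-ℓ = subst (λ k → IsMultiple k x (proj₁ x-torsion)) (proj₂ predecessor) (proj₁ (proj₂ x-torsion))

    o w : Point n
    o = proj₁ x-torsion
    w = proj₁ multiple-ℓ

    D : Vector Carrier n
    D i = act (proj₁ x i) - proj₁ x i

    x⊕w : x ⊕ w ↦ o
    x⊕w = proj₂ (proj₂ multiple-ℓ)

    w-torsion : ¬ ¬ IsTorsion w
    w-torsion = multiple-torsion ⊕-exists (proj₁ predecessor) x w x-torsion (proj₁ (proj₂ multiple-ℓ))

    σx : Point n
    σx = act-point σ act-v x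

    module _ {k β} (v-Dk : v (D k) ≡ [ β ]) (β≼D : ∀ i → β ≼ D i) (z : Point n) (σx⊕w : σx ⊕ w ↦ z) where

      private
        bounded = common-bound (proj₁ σx ++ (proj₁ x ++ proj₁ w))
          (++-all (0ℚ ≺_) (proj₂ σx) (++-all (0ℚ ≺_) (proj₂ x) (proj₂ w)))
        δ = proj₁ bounded
        0<δ = proj₁ (proj₂ bounded)
        δσx : ∀ i → δ ≼ proj₁ σx i
        δσx i = subst (δ ≼_) (lookup-++ˡ (proj₁ σx) (proj₁ x ++ proj₁ w) i) (proj₂ (proj₂ bounded) (i ↑ˡ (n ℕ.+ n)))
        δxw : ∀ i → δ ≼ (proj₁ x ++ proj₁ w) i
        δxw i = subst (δ ≼_) (lookup-++ʳ (proj₁ σx) (proj₁ x ++ proj₁ w) i) (proj₂ (proj₂ bounded) (n ↑ʳ i))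
        δx : ∀ i → δ ≼ proj₁ x i
        δx i = subst (δ ≼_) (lookup-++ˡ (proj₁ x) (proj₁ w) i) (δxw (i ↑ˡ n))
        δw : ∀ i → δ ≼ proj₁ w i
        δw i = subst (δ ≼_) (lookup-++ʳ (proj₁ x) (proj₁ w) i) (δxw (n ↑ʳ i))

      -- `⊕-difference` compares σx ⊕ w = z with x ⊕ w = o, and o is zero. The gain δ is a positive
      -- lower bound for the valuations of all coordinates of σx, x and w.
      z≈D : ∀ i → β ℚ.+ δ ≼ proj₁ z i - D i
      z≈D i = ≼-cong (+-congʳ (trans (+-congˡ (-‿cong (proj₂ (proj₂ x-torsion) i)))
          (solve 1 (λ z → z :- :0 := z) ≈-refl (proj₁ z i))))
        (⊕-difference (ℚₚ.<⇒≤ 0<δ) σx x w z o σx⊕w x⊕w δσx δx δw β≼D i)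

      β<β+δ : β ℚ.< β ℚ.+ δ
      β<β+δ = subst (ℚ._< β ℚ.+ δ) (ℚₚ.+-identityʳ β) (ℚₚ.+-monoʳ-< β 0<δ)

      z-nonzero : ¬ IsZero (proj₁ z)
      z-nonzero z≈0 = finite⇒≉0 (v-close (D k) (proj₁ z k) v-Dk (≼⇒≺ β<β+δ (z≈D k))) (z≈0 k)

      β≼z : ∀ i → β ≼ proj₁ z i
      β≼z i = ≼-recover (proj₁ z i) (D i) (≼-weaken (ℚₚ.<⇒≤ β<β+δ) (z≈D i)) (β≼D i)

    -- The non-zero torsion point z has minimal valuation α by (H), although all its coordinates
    -- have valuation at least β > α. The double negations unwind because the goal is a
    -- contradiction.
    no-difference : HypothesisH → ∀ {k β} → v (D k) ≡ [ β ] → ¬ (∀ i → β ≼ D i)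
    no-difference (α , _ , h) {k} {β} v-Dk β≼D =
      ⊕-exists σx w λ (z , σx⊕w) → w-torsion λ tw →
      torsion-⊕ ⊕-exists σx w z σx⊕w (act-torsion σ act-v x x-torsion) tw λ tz →
      ℚₚ.<-irrefl refl (ℚₚ.<-≤-trans α<β (minVal-bound (proj₁ z) (h z tz (z-nonzero v-Dk β≼D z σx⊕w)) (β≼z v-Dk β≼D z σx⊕w)))
      where
      xk-finite : ∃ λ q → v (proj₁ x k) ≡ [ q ]
      xk-finite = ≉0⇒finite λ xk≈0 → finite⇒≉0 v-Dk
        (trans (+-cong (trans (σ.⟦⟧-cong xk≈0) σ.0#-homo) (-‿cong xk≈0)) (-‿inverseʳ 0#))
      α≼x : ∀ i → α ≼ proj₁ x i
      α≼x = minVal-≼ (proj₁ x) (h x x-torsion λ x≈0 → finite⇒≉0 (proj₂ xk-finite) (x≈0 k))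
      -- Only the coordinate k where D attains β matters: α ≤ v(x k) < v(D k) = β. There x k is
      -- non-zero, as otherwise D k would vanish.
      α<β : α ℚ.< β
      α<β = ℚₚ.≤-<-trans (≼-finite⁻¹ (proj₂ xk-finite) (α≼x k)) (≺-finite⁻¹ v-Dk (act-close (proj₂ xk-finite)))

    fixed : HypothesisH → ∀ i → act (proj₁ x i) ≈ proj₁ x i
    fixed H i = go (attained-minimum D)
      where
      go : (∀ i → D i ≈ 0#) ⊎ (∃ λ k → ∃ λ β → v (D k) ≡ [ β ] × (∀ i → β ≼ D i)) → act (proj₁ x i) ≈ proj₁ x i
      go (inj₁ D≈0) = trans (solve 2 (λ s x → s := (s :- x) :+ x) ≈-refl (act (proj₁ x i)) (proj₁ x i))
        (trans (+-congʳ (D≈0 i)) (+-identityˡ _))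
      go (inj₂ (k , β , v-Dk , β≼D)) = contradiction β≼D (no-difference H v-Dk)

theorem3p1 : ∀ {a b} (ℓ : ℕ) → Prime ℓ → (E : UnramifiedExtension ℓ a b) →
    let open UnramifiedExtension E
        open Theory E
    in (n : ℕ) (𝓕 : CommutativeFormalGroupLaw𝒪 n) →
       let open GroupOfPoints 𝓕
       in HypothesisH →
          (σ : Gal) → WildInertia σ →
          ∀ x → IsTorsion x → ∀ i → Gal.act σ (proj₁ x i) K̄.≈ proj₁ x i
theorem3p1 ℓ ℓ-prime E n 𝓕 H σ wild x x-torsion = MainTheorem.fixed ℓ-prime E 𝓕 σ wild x x-torsion H
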